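{- For all $\varepsilon>0$ and integers $r\geq 2$, $k\geq 2$ there exist $\rho=\rho(\varepsilon,r,k)>0$, $K=K(\varepsilon,r,k)$ and $n_0$ such that for every graph $G$ of order $n\geq n_0$ the following holds: if $k_r(G)\leq\rho n^r$, then there exists a partition $V(G)=\bigcup_{i=1}^{q}V_i$ with $k\leq q\leq K$ such that \[ \lfloor n/q\rfloor\leq|V_i|\leq\lceil n/q\rceil,\qquad e(V_i)\leq\varepsilon\binom{|V_i|}{2} \] for every $i\in[q]$, and at most $\varepsilon q^2$ pairs $(V_i,V_j)$ are not $\varepsilon$-uniform.
   Context: All graphs are finite and simple. $k_r(G)$ is the number of $r$-cliques of $G$; $e(U)$ is the number of edges of $G[U]$. For disjoint nonempty $A,B\subset V(G)$, $d(A,B)=e(A,B)/(|A||B|)$ with $e(A,B)$ the number of $A$–$B$ edges. A pair $(A,B)$ is $\varepsilon$-uniform if for all $X\subset A$, $Y\subset B$ with $|X|\geq\varepsilon|A|$, $|Y|\geq\varepsilon|B|$ one has $|d(X,Y)-d(A,B)|<\varepsilon$. -}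

module Defs where

open import Data.Bool.Base using (Bool; true; false; if_then_else_; _∧_; _∨_; not)
open import Data.Nat.Base as ℕ using (ℕ; zero; suc; _<ᵇ_)
open import Data.Nat.DivMod using (_/_)
open import Data.Nat.Combinatorics using (_C_)
open import Data.Fin.Base using (Fin; zero; suc; toℕ)
open import Data.Fin.Properties using (_≟_)
open import Data.Fin.Subset using (Subset; inside; outside; _⊆_; ∣_∣)
open import Data.Vec.Base using (Vec; []; _∷_; lookup; tabulate)
open import Data.Integer.Base using (+_)
open import Data.Rational.Base as ℚ using (ℚ; 0ℚ)
open import Relation.Nullary.Decidable using (isYes)
open import Relation.Binary.PropositionalEquality using (_≡_)

record Graph (n : ℕ) : Set where
  field
    adj    : Fin n → Fin n → Bool
    sym    : ∀ x y → adj x y ≡ adj y x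
    irrefl : ∀ x → adj x x ≡ false
open Graph public

⟦_⟧ : ℕ → ℚ
⟦ m ⟧ = + m ℚ./ 1

sumFin : ∀ {n} → (Fin n → ℕ) → ℕ
sumFin {zero}  f = 0
sumFin {suc n} f = f zero ℕ.+ sumFin (λ i → f (suc i))

countFin : ∀ {n} → (Fin n → Bool) → ℕ
countFin p = sumFin (λ i → if p i then 1 else 0)

countSub : ∀ n → (Subset n → Bool) → ℕ
countSub zero    p = if p [] then 1 else 0
countSub (suc n) p = countSub n (λ S → p (outside ∷ S)) ℕ.+ countSub n (λ S → p (inside ∷ S))

allFin : ∀ {n} → (Fin n → Bool) → Bool
allFin {zero}  p = true
allFin {suc n} p = p zero ∧ allFin (λ i → p (suc i))

isClique : ∀ {n} → Graph n → Subset n → Bool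
isClique G S = allFin (λ x → allFin (λ y →
  not (lookup S x ∧ lookup S y ∧ not (isYes (x ≟ y))) ∨ adj G x y))

kᵣ : ∀ {n} → Graph n → ℕ → ℕ
kᵣ {n} G r = countSub n (λ S → (∣ S ∣ ℕ.≡ᵇ r) ∧ isClique G S)

eBetween : ∀ {n} → Graph n → Subset n → Subset n → ℕ
eBetween G A B = sumFin (λ x → countFin (λ y → lookup A x ∧ lookup B y ∧ adj G x y))

eIn : ∀ {n} → Graph n → Subset n → ℕ
eIn G U = sumFin (λ x → countFin (λ y →
  (toℕ x <ᵇ toℕ y) ∧ lookup U x ∧ lookup U y ∧ adj G x y))

-- e / m as a rational (m = 0 never occurs for nonempty sets; value 0 then)
ratio : ℕ → ℕ → ℚ
ratio e zero    = 0ℚ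
ratio e (suc m) = + e ℚ./ suc m

density : ∀ {n} → Graph n → Subset n → Subset n → ℚ
density G A B = ratio (eBetween G A B) (∣ A ∣ ℕ.* ∣ B ∣)

Uniform : ∀ {n} → Graph n → ℚ → Subset n → Subset n → Set
Uniform G ε A B = ∀ (X Y : Subset _) → X ⊆ A → Y ⊆ B →
  ε ℚ.* ⟦ ∣ A ∣ ⟧ ℚ.≤ ⟦ ∣ X ∣ ⟧ → ε ℚ.* ⟦ ∣ B ∣ ⟧ ℚ.≤ ⟦ ∣ Y ∣ ⟧ →
  ℚ.∣ density G X Y ℚ.- density G A B ∣ ℚ.< ε

part : ∀ {n q} → (Fin n → Fin q) → Fin q → Subset n
part f i = tabulate (λ v → isYes (f v ≟ i))

-- ⌊n/q⌋ and ⌈n/q⌉ (only used with q ≥ 1)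
⌊_/_⌋ : ℕ → ℕ → ℕ
⌊ n / zero ⌋ = 0
⌊ n / suc q ⌋ = n / suc q

⌈_/_⌉ : ℕ → ℕ → ℕ
⌈ n / zero ⌉ = 0
⌈ n / suc q ⌉ = (n ℕ.+ q) / suc q

countPairs : ∀ {q} → (Fin q → Fin q → Bool) → ℕ
countPairs b = sumFin (λ i → countFin (λ j → (toℕ i <ᵇ toℕ j) ∧ b i j))

{-# OPTIONS --safe #-}
module Submission where

-- Let 1/M ≤ ε and N = 5M.  Instead of the mean-square density, the energy of the regularity argument is the
-- squared distance Σ (N·adj(x,y) − h(x,y))² of the graph to an integer-valued step function h.  If the sum of
-- N·adj − h over a box X × Y inside a pair of parts exceeds |X||Y| in absolute value, then changing h by ±1 on
-- that box lowers the energy by at least |X||Y|; if a positive proportion of the pairs has such a large box, all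
-- these changes together lower it by a constant multiple of n², which can happen only boundedly often.
--
-- After each change the vertex set is cut again into disjoint cores of a common size s, chosen greedily such that
-- h is constant on pairs of cores and every core spans few edges.  Sparse s-sets exist in every vertex set of size
-- at least R·s: if at least s of its vertices have large degree inside it, pass to their neighbourhoods, where
-- induction on r yields a sparse set or too many r-cliques; otherwise discard these vertices and add vertices one
-- by one, each with few neighbours among the chosen ones.
--
-- At the end the few vertices outside the cores are distributed evenly, which changes all densities only slightly.

open import Defs
open import Data.Bool.Base using (Bool; true; false; _∧_; _∨_; not)
open import Data.Bool.Properties using (∧-assoc; ∧-comm; ∧-zeroʳ) renaming (_≟_ to _≟ᵇ_)
open import Data.Empty using (⊥; ⊥-elim)
open import Data.Fin.Base using (Fin; zero; suc; toℕ)
open import Data.Fin.Properties using (all?; any?) renaming (_≟_ to _≟ᶠ_)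
open import Data.Fin.Subset using (Subset; inside; outside; _⊆_)
open import Data.Fin.Subset.Properties using (anySubset?)
open import Data.Product using (Σ; _×_; _,_; proj₁; proj₂)
open import Data.Sum using (_⊎_; inj₁; inj₂)
open import Data.Vec.Base using ([]; _∷_; lookup; tabulate)
open import Data.Vec.Properties using (lookup∘tabulate; lookup⇒[]=; []=⇒lookup)
open import Relation.Nullary using (¬_; Dec; yes; no)
open import Relation.Nullary.Decidable using (isYes; _×-dec_; _→-dec_)
open import Relation.Binary.PropositionalEquality as ≡ using (_≡_; refl; cong; cong₂; trans; subst)
import Data.Nat.Tactic.RingSolver as ℕR
import Data.Integer.Tactic.RingSolver as ℤR

-- Only `1/M` stands for `ε` until the last step, so densities are handled as integers: they are
-- compared with `γ / N`, where `γ` is a value of `h`, and `1 / N` is the unit of error. Regularity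
-- of the cores costs one unit and enlarging them another. Two densities near the same `γ` thus
-- differ by at most `4 / N`, strictly less than `1 / M` because `N = 5M`.
--
-- The function `h` need not consist of averages, so nothing is recomputed when the cores are cut;
-- boxes in different pairs of cores have disjoint supports, so their gains simply add up.
--
-- The obstacle is that sparsity must be available after every cut, while the clique bound `ρ` is
-- fixed beforehand. The number of refinements is bounded in terms of `M` alone, hence the number of
-- cores by some `K`. Since the cores always cover half of the vertices, their size is at least
-- `n / (2K)`, and `ρ` is chosen after `K` so that `s ^ r / r !` exceeds the number of `r`-cliques
-- at every stage. Sparse sets of one prescribed size cannot exhaust the vertex set; each cut
-- therefore loses up to `2n / D` vertices, and `D` is taken so large that the total loss stays
-- negligible.

module Counting where

  open import Data.Bool.Base using (if_then_else_)
  open import Data.Nat.Base using (ℕ; zero; suc; _+_; _*_; _^_; _≤_; _<_; z≤n; s≤s; NonZero; >-nonZero; _≡ᵇ_; _<ᵇ_; _!)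
  open import Data.Nat.DivMod using (_/_; _%_; m≡m%n+[m/n]*n; m%n<n; m<n*o⇒m/o<n; /-monoˡ-≤; m*n/n≡m)
  open import Data.Nat.Properties
  open import Data.Fin.Subset using (∣_∣)

  VSet : ℕ → Set
  VSet n = Fin n → Bool

  𝟙 : Bool → ℕ
  𝟙 b = if b then 1 else 0

  card : ∀ {n} → VSet n → ℕ
  card = countFin

  infix 4 _⊑_
  _⊑_ : ∀ {n} → VSet n → VSet n → Set
  U ⊑ W = ∀ x → U x ≡ true → W x ≡ true

  infixr 6 _∩_ _∖_
  _∩_ _∖_ : ∀ {n} → VSet n → VSet n → VSet n
  (U ∩ W) x = U x ∧ W x
  (U ∖ W) x = U x ∧ not (W x)

  -- Finite sums

  sum-cong : ∀ {n} {f g : Fin n → ℕ} → (∀ i → f i ≡ g i) → sumFin f ≡ sumFin g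
  sum-cong {zero}  p = refl
  sum-cong {suc n} p = cong₂ _+_ (p zero) (sum-cong (λ i → p (suc i)))

  sum-mono : ∀ {n} {f g : Fin n → ℕ} → (∀ i → f i ≤ g i) → sumFin f ≤ sumFin g
  sum-mono {zero}  p = z≤n
  sum-mono {suc n} p = +-mono-≤ (p zero) (sum-mono (λ i → p (suc i)))

  sum-mono-< : ∀ {n} {f g : Fin n → ℕ} → (∀ i → f i ≤ g i) → ∀ j → f j < g j → sumFin f < sumFin g
  sum-mono-< p zero    f<g = +-mono-<-≤ f<g (sum-mono (λ i → p (suc i)))
  sum-mono-< p (suc j) f<g = +-mono-≤-< (p zero) (sum-mono-< (λ i → p (suc i)) j f<g)

  sum-+ : ∀ {n} (f g : Fin n → ℕ) → sumFin (λ i → f i + g i) ≡ sumFin f + sumFin g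
  sum-+ {zero}  f g = refl
  sum-+ {suc n} f g
    rewrite sum-+ (λ i → f (suc i)) (λ i → g (suc i)) = interchange (f zero) (g zero) _ _
    where
    interchange : ∀ a b c d → (a + b) + (c + d) ≡ (a + c) + (b + d)
    interchange = ℕR.solve-∀

  sum-*ˡ : ∀ {n} c (f : Fin n → ℕ) → sumFin (λ i → c * f i) ≡ c * sumFin f
  sum-*ˡ {zero}  c f = ≡.sym (*-zeroʳ c)
  sum-*ˡ {suc n} c f rewrite sum-*ˡ c (λ i → f (suc i)) = ≡.sym (*-distribˡ-+ c (f zero) _)

  sum-*ʳ : ∀ {n} c (f : Fin n → ℕ) → sumFin (λ i → f i * c) ≡ sumFin f * c
  sum-*ʳ c f = trans (sum-cong (λ i → *-comm (f i) c)) (trans (sum-*ˡ c f) (*-comm c _))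

  sum-const : ∀ n c → sumFin {n} (λ _ → c) ≡ n * c
  sum-const zero    c = refl
  sum-const (suc n) c = cong (c +_) (sum-const n c)

  sum-zero : ∀ n → sumFin {n} (λ _ → 0) ≡ 0
  sum-zero n = trans (sum-const n 0) (*-zeroʳ n)

  sum-swap : ∀ {m n} (f : Fin m → Fin n → ℕ) →
    sumFin (λ i → sumFin (f i)) ≡ sumFin (λ j → sumFin (λ i → f i j))
  sum-swap {zero} {n} f = ≡.sym (sum-zero n)
  sum-swap {suc m} f rewrite sum-swap (λ i → f (suc i)) = ≡.sym (sum-+ (f zero) _)

  𝟙-∧ : ∀ a b → 𝟙 (a ∧ b) ≡ 𝟙 a * 𝟙 b
  𝟙-∧ true  b = ≡.sym (+-identityʳ _)
  𝟙-∧ false b = refl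

  𝟙≤1 : ∀ b → 𝟙 b ≤ 1
  𝟙≤1 true  = ≤-refl
  𝟙≤1 false = z≤n

  𝟙-mono : ∀ {a b} → (a ≡ true → b ≡ true) → 𝟙 a ≤ 𝟙 b
  𝟙-mono {false} p = z≤n
  𝟙-mono {true}  p rewrite p refl = ≤-refl

  ∧-trueˡ : ∀ {a b} → a ∧ b ≡ true → a ≡ true
  ∧-trueˡ {true} _ = refl

  ∧-trueʳ : ∀ {a b} → a ∧ b ≡ true → b ≡ true
  ∧-trueʳ {true} p = p

  ∧-true : ∀ {a b} → a ≡ true → b ≡ true → a ∧ b ≡ true
  ∧-true refl refl = refl

  not-true : ∀ {a} → not a ≡ true → a ≡ false
  not-true {false} _ = refl

  card-mono : ∀ {n} {U W : VSet n} → U ⊑ W → card U ≤ card W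
  card-mono p = sum-mono (λ x → 𝟙-mono (p x))

  card-split : ∀ {n} (U W : VSet n) → card U ≡ card (U ∩ W) + card (U ∖ W)
  card-split U W = trans (sum-cong (λ x → point (U x) (W x)))
    (sum-+ (λ x → 𝟙 ((U ∩ W) x)) (λ x → 𝟙 ((U ∖ W) x)))
    where
    point : ∀ a b → 𝟙 a ≡ 𝟙 (a ∧ b) + 𝟙 (a ∧ not b)
    point false b     = refl
    point true  false = refl
    point true  true  = refl

  card-full : ∀ n → card {n} (λ _ → true) ≡ n
  card-full n = trans (sum-const n 1) (*-identityʳ n)

  card-element : ∀ {n} (U : VSet n) → 1 ≤ card U → Σ (Fin n) λ x → U x ≡ true
  card-element {suc n} U p with U zero in eq
  ... | true  = zero , eq
  ... | false with x , Ux ← card-element (λ i → U (suc i)) p = suc x , Ux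

  -- Cliques

  Rel : ℕ → Set
  Rel n = Fin n → Fin n → Bool

  tailᵛ : ∀ {n} → VSet (suc n) → VSet n
  tailᵛ U x = U (suc x)

  tailʳ : ∀ {n} → Rel (suc n) → Rel n
  tailʳ a x y = a (suc x) (suc y)

  -- A clique is built from its smallest vertex upwards: vertex zero is left out, or it is taken and
  -- the rest must lie in its neighbourhood. Each clique is thus counted once, and no division by
  -- `r !` occurs.
  cliques : ∀ {n} → ℕ → Rel n → VSet n → ℕ
  cliques {zero}  zero    a U = 1
  cliques {zero}  (suc r) a U = 0
  cliques {suc n} zero    a U = cliques zero (tailʳ a) (tailᵛ U)
  cliques {suc n} (suc r) a U =
    cliques (suc r) (tailʳ a) (tailᵛ U) +
    𝟙 (U zero) * cliques r (tailʳ a) (tailᵛ (U ∩ a zero))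

  cliques-cong : ∀ {n} r (a : Rel n) {U W : VSet n} → (∀ x → U x ≡ W x) → cliques r a U ≡ cliques r a W
  cliques-cong {zero}  zero    a p = refl
  cliques-cong {zero}  (suc r) a p = refl
  cliques-cong {suc n} zero    a p = cliques-cong zero (tailʳ a) (λ x → p (suc x))
  cliques-cong {suc n} (suc r) a p = cong₂ _+_
    (cliques-cong (suc r) (tailʳ a) (λ x → p (suc x)))
    (cong₂ _*_ (cong 𝟙 (p zero))
      (cliques-cong r (tailʳ a) (λ x → cong (_∧ a zero (suc x)) (p (suc x)))))

  cliques-zero : ∀ {n} (a : Rel n) (U : VSet n) → cliques 0 a U ≡ 1
  cliques-zero {zero}  a U = refl
  cliques-zero {suc n} a U = cliques-zero (tailʳ a) (tailᵛ U)

  -- Double counting of cliques with a marked vertex, by induction on the vertex set. A clique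
  -- through vertex zero is seen once from zero itself; its views from the other vertices are
  -- counted by the induction hypothesis inside the neighbourhood of zero.
  Σ-cliques-nbhd : ∀ {n} r (a : Rel n) → (∀ x y → a x y ≡ a y x) → (∀ x → a x x ≡ false) → (U : VSet n) →
    sumFin (λ v → 𝟙 (U v) * cliques r a (U ∩ a v)) ≡ suc r * cliques (suc r) a U
  Σ-cliques-nbhd {zero}  r a sy ir U = ≡.sym (*-zeroʳ (suc r))
  Σ-cliques-nbhd {suc n} zero a sy ir U = begin
      𝟙 (U zero) * K₀ + sumFin (λ v → 𝟙 (U (suc v)) * cliques 0 (tailʳ a) (tailᵛ U ∩ tailʳ a v))
        ≡⟨ cong (𝟙 (U zero) * K₀ +_) (Σ-cliques-nbhd zero (tailʳ a) (λ x y → sy (suc x) (suc y))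
            (λ x → ir (suc x)) (tailᵛ U)) ⟩
      𝟙 (U zero) * K₀ + 1 * cliques 1 (tailʳ a) (tailᵛ U)
        ≡⟨ rearrange (𝟙 (U zero) * K₀) _ ⟩
      1 * (cliques 1 (tailʳ a) (tailᵛ U) + 𝟙 (U zero) * K₀) ∎
    where
    open ≡.≡-Reasoning
    K₀ = cliques 0 (tailʳ a) (tailᵛ (U ∩ a zero))
    rearrange : ∀ x y → x + 1 * y ≡ 1 * (y + x)
    rearrange = ℕR.solve-∀
  Σ-cliques-nbhd {suc n} (suc r) a sy ir U = begin
      𝟙 (U zero) * (K₀ + 𝟙 (U zero ∧ a zero zero) * cliques r a′ (tailᵛ ((U ∩ a zero) ∩ a zero))) +
      sumFin (λ v → 𝟙 (U′ v) * (cliques (suc r) a′ (U′ ∩ a′ v) +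
                                𝟙 (U zero ∧ a (suc v) zero) * cliques r a′ (tailᵛ ((U ∩ a (suc v)) ∩ a zero))))
        ≡⟨ cong₂ _+_ head (trans (sum-cong point) (sum-+ (λ v → 𝟙 (U′ v) * cliques (suc r) a′ (U′ ∩ a′ v))
            (λ v → 𝟙 (U zero) * (𝟙 (V v) * cliques r a′ (V ∩ a′ v))))) ⟩
      𝟙 (U zero) * K₀ +
      (sumFin (λ v → 𝟙 (U′ v) * cliques (suc r) a′ (U′ ∩ a′ v)) +
       sumFin (λ v → 𝟙 (U zero) * (𝟙 (V v) * cliques r a′ (V ∩ a′ v))))
        ≡⟨ cong (𝟙 (U zero) * K₀ +_) (cong₂ _+_ (Σ-cliques-nbhd (suc r) a′ sy′ ir′ U′)
             (trans (sum-*ˡ (𝟙 (U zero)) (λ v → 𝟙 (V v) * cliques r a′ (V ∩ a′ v)))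
                 (cong (𝟙 (U zero) *_) (Σ-cliques-nbhd r a′ sy′ ir′ V)))) ⟩
      𝟙 (U zero) * K₀ + (suc (suc r) * cliques (suc (suc r)) a′ U′ + 𝟙 (U zero) * (suc r * K₀))
        ≡⟨ rearrange (𝟙 (U zero)) K₀ (cliques (suc (suc r)) a′ U′) r ⟩
      suc (suc r) * (cliques (suc (suc r)) a′ U′ + 𝟙 (U zero) * K₀) ∎
    where
    open ≡.≡-Reasoning
    a′ = tailʳ a
    U′ = tailᵛ U
    V = tailᵛ (U ∩ a zero)
    K₀ = cliques (suc r) a′ V
    sy′ : ∀ x y → a′ x y ≡ a′ y x
    sy′ x y = sy (suc x) (suc y)
    ir′ : ∀ x → a′ x x ≡ false
    ir′ x = ir (suc x)
    head : 𝟙 (U zero) * (K₀ + 𝟙 (U zero ∧ a zero zero) * cliques r a′ (tailᵛ ((U ∩ a zero) ∩ a zero)))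
        ≡ 𝟙 (U zero) * K₀
    -- Vertex zero is not its own neighbour, so no clique is extended by it twice.
    head rewrite ir zero | ∧-zeroʳ (U zero) = cong (𝟙 (U zero) *_) (+-identityʳ K₀)
    shuffle : ∀ u k z t l → u * (k + z * t * l) ≡ u * k + z * (u * t * l)
    shuffle = ℕR.solve-∀
    swap∧ : ∀ p q s → (p ∧ q) ∧ s ≡ (p ∧ s) ∧ q
    swap∧ p q s = trans (∧-assoc p q s) (trans (cong (p ∧_) (∧-comm q s)) (≡.sym (∧-assoc p s q)))
    point : ∀ v → 𝟙 (U′ v) * (cliques (suc r) a′ (U′ ∩ a′ v) +
                                𝟙 (U zero ∧ a (suc v) zero) * cliques r a′ (tailᵛ ((U ∩ a (suc v)) ∩ a zero)))
                ≡ 𝟙 (U′ v) * cliques (suc r) a′ (U′ ∩ a′ v) + 𝟙 (U zero) * (𝟙 (V v) * cliques r a′ (V ∩ a′ v))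
    point v
      rewrite 𝟙-∧ (U zero) (a (suc v) zero) | sy (suc v) zero | 𝟙-∧ (U′ v) (a zero (suc v))
            | cliques-cong r a′ {tailᵛ ((U ∩ a (suc v)) ∩ a zero)} {V ∩ a′ v}
                (λ x → swap∧ (U (suc x)) (a (suc v) (suc x)) (a zero (suc x)))
      = shuffle (𝟙 (U′ v)) _ (𝟙 (U zero)) _ _
    rearrange : ∀ u k c r → u * k + (suc (suc r) * c + u * (suc r * k)) ≡ suc (suc r) * (c + u * k)
    rearrange = ℕR.solve-∀

  countSub-mono : ∀ n {p p′ : Subset n → Bool} → (∀ S → p S ≡ true → p′ S ≡ true) → countSub n p ≤ countSub n p′
  countSub-mono zero    h = 𝟙-mono (h [])
  countSub-mono (suc n) h = +-mono-≤ (countSub-mono n (λ S → h (outside ∷ S)))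
      (countSub-mono n (λ S → h (inside ∷ S)))

  allFin-intro : ∀ {n} {p : Fin n → Bool} → (∀ i → p i ≡ true) → allFin p ≡ true
  allFin-intro {zero}  h = refl
  allFin-intro {suc n} h = ∧-true (h zero) (allFin-intro (λ i → h (suc i)))

  allFin-elim : ∀ {n} {p : Fin n → Bool} → allFin p ≡ true → ∀ i → p i ≡ true
  allFin-elim h zero    = ∧-trueˡ h
  allFin-elim h (suc i) = allFin-elim (∧-trueʳ h) i

  cliqueᵇ : ∀ {n} → Rel n → Subset n → Bool
  cliqueᵇ a S = allFin (λ x → allFin (λ y →
    not (lookup S x ∧ lookup S y ∧ not (isYes (x ≟ᶠ y))) ∨ a x y))

  withinᵇ : ∀ {n} → Subset n → VSet n → Bool
  withinᵇ S U = allFin (λ x → not (lookup S x) ∨ U x)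

  Clique : ∀ {n} → Rel n → Subset n → Set
  Clique a S = ∀ x y → lookup S x ≡ true → lookup S y ≡ true → ¬ x ≡ y → a x y ≡ true

  clique-elim : ∀ {n} (a : Rel n) S → cliqueᵇ a S ≡ true → Clique a S
  clique-elim a S h x y Sx Sy x≢y with allFin-elim (allFin-elim h x) y
  ... | q rewrite Sx | Sy with x ≟ᶠ y
  ...   | yes e = ⊥-elim (x≢y e)
  ...   | no _  = q

  clique-intro : ∀ {n} (a : Rel n) S → Clique a S → cliqueᵇ a S ≡ true
  clique-intro a S h = allFin-intro (λ x → allFin-intro (λ y → point x y))
    where
    point : ∀ x y → not (lookup S x ∧ lookup S y ∧ not (isYes (x ≟ᶠ y))) ∨ a x y ≡ true
    point x y with lookup S x in Sx | lookup S y in Sy | x ≟ᶠ y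
    ... | false | _     | _     = refl
    ... | true  | false | _     = refl
    ... | true  | true  | yes _ = refl
    ... | true  | true  | no ne = h x y Sx Sy ne

  within-elim : ∀ {n} (S : Subset n) U → withinᵇ S U ≡ true → lookup S ⊑ U
  within-elim S U h x Sx with allFin-elim h x
  ... | q rewrite Sx = q

  within-intro : ∀ {n} (S : Subset n) U → lookup S ⊑ U → withinᵇ S U ≡ true
  within-intro S U h = allFin-intro point
    where
    point : ∀ x → not (lookup S x) ∨ U x ≡ true
    point x with lookup S x in Sx
    ... | false = refl
    ... | true  = h x Sx

  -- Both counts branch on vertex zero. The condition `withinᵇ S U` is carried along because the
  -- recursion shrinks `U` to a neighbourhood, and exactly this makes `inside ∷ S` a clique again.
  cliques≤countSub : ∀ {n} r (a : Rel n) → (∀ x y → a x y ≡ a y x) → (U : VSet n) →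
    cliques r a U ≤ countSub n (λ S → (∣ S ∣ ≡ᵇ r) ∧ cliqueᵇ a S ∧ withinᵇ S U)
  cliques≤countSub {zero} zero    a sy U = ≤-refl
  cliques≤countSub {zero} (suc r) a sy U = z≤n
  cliques≤countSub {suc n} r a sy U = helper r
    where
    a′ = tailʳ a
    U′ = tailᵛ U
    sy′ : ∀ x y → a′ x y ≡ a′ y x
    sy′ x y = sy (suc x) (suc y)
    out : ∀ r S → (∣ S ∣ ≡ᵇ r) ∧ cliqueᵇ a′ S ∧ withinᵇ S U′ ≡ true →
          (∣ outside ∷ S ∣ ≡ᵇ r) ∧ cliqueᵇ a (outside ∷ S) ∧ withinᵇ (outside ∷ S) U ≡ true
    out r S h = ∧-true (∧-trueˡ {∣ S ∣ ≡ᵇ r} h) (∧-true (clique-intro a (outside ∷ S) cl)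
        (within-intro (outside ∷ S) U wi))
      where
      hC = clique-elim a′ S (∧-trueˡ (∧-trueʳ {∣ S ∣ ≡ᵇ r} h))
      hW = within-elim S U′ (∧-trueʳ {cliqueᵇ a′ S} (∧-trueʳ {∣ S ∣ ≡ᵇ r} h))
      cl : Clique a (outside ∷ S)
      cl (suc x) (suc y) Sx Sy ne = hC x y Sx Sy (λ e → ne (cong suc e))
      wi : lookup (outside ∷ S) ⊑ U
      wi (suc x) Sx = hW x Sx
    ins : ∀ r S → U zero ≡ true → (∣ S ∣ ≡ᵇ r) ∧ cliqueᵇ a′ S ∧ withinᵇ S (tailᵛ (U ∩ a zero)) ≡ true →
          (∣ inside ∷ S ∣ ≡ᵇ suc r) ∧ cliqueᵇ a (inside ∷ S) ∧ withinᵇ (inside ∷ S) U ≡ true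
    ins r S U0 h = ∧-true (∧-trueˡ {∣ S ∣ ≡ᵇ r} h) (∧-true (clique-intro a (inside ∷ S) cl)
        (within-intro (inside ∷ S) U wi))
      where
      hC = clique-elim a′ S (∧-trueˡ (∧-trueʳ {∣ S ∣ ≡ᵇ r} h))
      hW = within-elim S (tailᵛ (U ∩ a zero)) (∧-trueʳ {cliqueᵇ a′ S} (∧-trueʳ {∣ S ∣ ≡ᵇ r} h))
      cl : Clique a (inside ∷ S)
      cl zero    zero    Sx Sy ne = ⊥-elim (ne refl)
      cl zero    (suc y) Sx Sy ne = ∧-trueʳ {U (suc y)} (hW y Sy)
      cl (suc x) zero    Sx Sy ne = trans (sy (suc x) zero) (∧-trueʳ {U (suc x)} (hW x Sx))
      cl (suc x) (suc y) Sx Sy ne = hC x y Sx Sy (λ e → ne (cong suc e))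
      wi : lookup (inside ∷ S) ⊑ U
      wi zero    _  = U0
      wi (suc x) Sx = ∧-trueˡ (hW x Sx)
    helper : ∀ r → cliques r a U ≤ countSub (suc n) (λ S → (∣ S ∣ ≡ᵇ r) ∧ cliqueᵇ a S ∧ withinᵇ S U)
    helper zero = ≤-trans (cliques≤countSub zero a′ sy′ U′) (≤-trans (countSub-mono n (out zero)) (m≤m+n _ _))
    helper (suc r) = +-mono-≤ (≤-trans (cliques≤countSub (suc r) a′ sy′ U′) (countSub-mono n (out (suc r))))
                               (new (U zero) refl)
      where
      new : ∀ b → U zero ≡ b → 𝟙 b * cliques r a′ (tailᵛ (U ∩ a zero)) ≤
        countSub n (λ S → (∣ inside ∷ S ∣ ≡ᵇ suc r) ∧ cliqueᵇ a (inside ∷ S) ∧ withinᵇ (inside ∷ S) U)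
      new false _  = z≤n
      new true  U0 = ≤-trans (≤-reflexive (+-identityʳ _)) (≤-trans (cliques≤countSub r a′ sy′ _)
        (countSub-mono n (λ S → ins r S U0)))

  cliques≤kᵣ : ∀ {n} (G : Graph n) r U → cliques r (adj G) U ≤ kᵣ G r
  cliques≤kᵣ {n} G r U = ≤-trans (cliques≤countSub r (adj G) (sym G) U)
    (countSub-mono n (λ S h → ∧-true (∧-trueˡ {∣ S ∣ ≡ᵇ r} h) (∧-trueˡ {isClique G S} (∧-trueʳ {∣ S ∣ ≡ᵇ r} h))))

  -- Sparse subsets

  single : ∀ {n} → Fin n → VSet n
  single v x = isYes (x ≟ᶠ v)

  single-self : ∀ {n} (v x : Fin n) → single v x ≡ true → x ≡ v
  single-self v x p with x ≟ᶠ v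
  ... | yes e = e

  single-suc : ∀ {n} (v x : Fin n) → single (suc v) (suc x) ≡ single v x
  single-suc v x with x ≟ᶠ v
  ... | yes _ = refl
  ... | no _  = refl

  sum-single : ∀ {n} (v : Fin n) (f : Fin n → ℕ) → sumFin (λ x → 𝟙 (single v x) * f x) ≡ f v
  sum-single {suc n} zero f = trans (cong₂ _+_ (+-identityʳ (f zero)) (sum-zero n)) (+-identityʳ (f zero))
  sum-single {suc n} (suc v) f = trans (sum-cong {n} (λ x → cong (λ b → 𝟙 b * f (suc x)) (single-suc v x)))
      (sum-single v (λ x → f (suc x)))

  add : ∀ {n} → VSet n → Fin n → VSet n
  add S v x = S x ∨ single v x

  card-add : ∀ {n} (S : VSet n) v → S v ≡ false → card (add S v) ≡ suc (card S)
  card-add S v Sv = begin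
      card (add S v)                                     ≡⟨ sum-cong point ⟩
      sumFin (λ x → 𝟙 (single v x) * 1 + 𝟙 (S x))        ≡⟨ sum-+ (λ x → 𝟙 (single v x) * 1) (λ x → 𝟙 (S x)) ⟩
      sumFin (λ x → 𝟙 (single v x) * 1) + card S         ≡⟨ cong (_+ card S) (sum-single v (λ _ → 1)) ⟩
      suc (card S) ∎
    where
    open ≡.≡-Reasoning
    point : ∀ x → 𝟙 (S x ∨ single v x) ≡ 𝟙 (single v x) * 1 + 𝟙 (S x)
    point x with x ≟ᶠ v
    ... | yes refl rewrite Sv = refl
    ... | no _ with S x
    ...   | true  = refl
    ...   | false = refl

  -- Ordered pairs are counted, so an edge inside `U` contributes twice to `eB G U U`. On sets of
  -- the form `lookup A` this is `eBetween` by definition.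
  eB : ∀ {n} → Graph n → VSet n → VSet n → ℕ
  eB G U W = sumFin (λ x → countFin (λ y → U x ∧ W y ∧ adj G x y))

  eB-deg : ∀ {n} (G : Graph n) (U W : VSet n) → eB G U W ≡ sumFin (λ x → 𝟙 (U x) * card (W ∩ adj G x))
  eB-deg G U W = sum-cong (λ x → trans (sum-cong (λ y → 𝟙-∧ (U x) (W y ∧ adj G x y)))
      (sum-*ˡ (𝟙 (U x)) (λ y → 𝟙 ((W ∩ adj G x) y))))

  card-∩ : ∀ {n} (U W : VSet n) → card (U ∩ W) ≡ sumFin (λ x → 𝟙 (U x) * 𝟙 (W x))
  card-∩ U W = sum-cong (λ x → 𝟙-∧ (U x) (W x))

  𝟙-∨ : ∀ a b → 𝟙 (a ∨ b) ≤ 𝟙 b + 𝟙 a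
  𝟙-∨ true  b = m≤n+m 1 (𝟙 b)
  𝟙-∨ false b = m≤m+n (𝟙 b) 0

  Σ-add≤ : ∀ {n} (S : VSet n) v (f : Fin n → ℕ) →
    sumFin (λ x → 𝟙 (add S v x) * f x) ≤ f v + sumFin (λ x → 𝟙 (S x) * f x)
  Σ-add≤ S v f = begin
      sumFin (λ x → 𝟙 (add S v x) * f x)
        ≤⟨ sum-mono (λ x → *-monoˡ-≤ (f x) (𝟙-∨ (S x) (single v x))) ⟩
      sumFin (λ x → (𝟙 (single v x) + 𝟙 (S x)) * f x)
        ≡⟨ sum-cong (λ x → *-distribʳ-+ (f x) (𝟙 (single v x)) (𝟙 (S x))) ⟩
      sumFin (λ x → 𝟙 (single v x) * f x + 𝟙 (S x) * f x)
        ≡⟨ sum-+ (λ x → 𝟙 (single v x) * f x) (λ x → 𝟙 (S x) * f x) ⟩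
      sumFin (λ x → 𝟙 (single v x) * f x) + sumFin (λ x → 𝟙 (S x) * f x)
        ≡⟨ cong (_+ sumFin (λ x → 𝟙 (S x) * f x)) (sum-single v f) ⟩
      f v + sumFin (λ x → 𝟙 (S x) * f x) ∎
    where open ≤-Reasoning

  -- The neighbours of `v` in `S` enter once with `v` as first and once with `v` as second
  -- coordinate; the pair of `v` with itself is excluded by irreflexivity.
  eB-add : ∀ {n} (G : Graph n) (S : VSet n) v →
    eB G (add S v) (add S v) ≤ eB G S S + 2 * card (S ∩ adj G v)
  eB-add G S v = begin
      eB G (add S v) (add S v)
        ≡⟨ eB-deg G (add S v) (add S v) ⟩
      sumFin (λ x → 𝟙 (add S v x) * card (add S v ∩ adj G x))
        ≤⟨ Σ-add≤ S v (λ x → card (add S v ∩ adj G x)) ⟩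
      card (add S v ∩ adj G v) + sumFin (λ x → 𝟙 (S x) * card (add S v ∩ adj G x))
        ≤⟨ +-mono-≤ (deg≤ v) (sum-mono (λ x → *-monoʳ-≤ (𝟙 (S x)) (deg≤ x))) ⟩
      (𝟙 (adj G v v) + d v) + sumFin (λ x → 𝟙 (S x) * (𝟙 (adj G x v) + d x))
        ≡⟨ cong₂ _+_ (cong (λ b → 𝟙 b + d v) (irrefl G v))
             (trans (sum-cong (λ x → trans (*-distribˡ-+ (𝟙 (S x)) (𝟙 (adj G x v)) (d x))
                 (cong (λ b → 𝟙 (S x) * 𝟙 b + 𝟙 (S x) * d x) (sym G x v))))
                    (sum-+ (λ x → 𝟙 (S x) * 𝟙 (adj G v x)) (λ x → 𝟙 (S x) * d x))) ⟩
      d v + (sumFin (λ x → 𝟙 (S x) * 𝟙 (adj G v x)) + sumFin (λ x → 𝟙 (S x) * d x))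
        ≡⟨ cong (d v +_) (cong₂ _+_ (≡.sym (card-∩ S (adj G v))) (≡.sym (eB-deg G S S))) ⟩
      d v + (d v + eB G S S)
        ≡⟨ rearrange (d v) (eB G S S) ⟩
      eB G S S + 2 * d v ∎
    where
    open ≤-Reasoning
    d = λ x → card (S ∩ adj G x)
    deg≤ : ∀ x → card (add S v ∩ adj G x) ≤ 𝟙 (adj G x v) + d x
    deg≤ x = begin
      card (add S v ∩ adj G x)                          ≡⟨ card-∩ (add S v) (adj G x) ⟩
      sumFin (λ y → 𝟙 (add S v y) * 𝟙 (adj G x y))      ≤⟨ Σ-add≤ S v (λ y → 𝟙 (adj G x y)) ⟩
      𝟙 (adj G x v) + sumFin (λ y → 𝟙 (S y) * 𝟙 (adj G x y)) ≡⟨ cong (𝟙 (adj G x v) +_) (≡.sym (card-∩ S (adj G x))) ⟩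
      𝟙 (adj G x v) + d x ∎
    rearrange : ∀ d e → d + (d + e) ≡ e + 2 * d
    rearrange = ℕR.solve-∀

  -- Averaging with the quotient `A / card W` cleared: if every `card W * d v` were at least
  -- `suc A`, summing over `W` would give a total above `A`.
  below-average : ∀ {n} (W : VSet n) (d : Fin n → ℕ) A → 1 ≤ card W →
    sumFin (λ v → 𝟙 (W v) * d v) ≤ A → Σ (Fin n) λ v → W v ≡ true × card W * d v ≤ A
  below-average W d A pos total with any? (λ v → (W v ≟ᵇ true) ×-dec (card W * d v ≤? A))
  ... | yes found = found
  ... | no none = ⊥-elim (<-irrefl refl (begin-strict
      card W * A                                       <⟨ *-monoʳ-< (card W) {{>-nonZero pos}} (n<1+n A) ⟩
      card W * suc A                                   ≡⟨ sum-*ʳ (suc A) (λ v → 𝟙 (W v)) ⟨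
      sumFin (λ v → 𝟙 (W v) * suc A)                   ≤⟨ sum-mono point ⟩
      sumFin (λ v → card W * (𝟙 (W v) * d v))          ≡⟨ sum-*ˡ (card W) (λ v → 𝟙 (W v) * d v) ⟩
      card W * sumFin (λ v → 𝟙 (W v) * d v)            ≤⟨ *-monoʳ-≤ (card W) total ⟩
      card W * A ∎))
    where
    open ≤-Reasoning
    point : ∀ v → 𝟙 (W v) * suc A ≤ card W * (𝟙 (W v) * d v)
    point v with W v in Wv
    ... | false = z≤n
    ... | true  = ≤-trans (≤-reflexive (+-identityʳ (suc A)))
                    (≤-trans (≰⇒> (λ le → none (v , Wv , le)))
                      (≤-reflexive (cong (card W *_) (≡.sym (+-identityʳ (d v))))))

  -- The at most `s` chosen vertices send at most `s * b` edges to the remaining ones, of which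
  -- there are at least `2 * μ * b`. Some remaining vertex therefore has at most `s / (2μ)`
  -- neighbours among the chosen ones, and adding it costs at most `s / μ` ordered pairs; this is
  -- the invariant `j * s`.
  sparse-subset : ∀ {n} (G : Graph n) (μ s b : ℕ) → 1 ≤ μ → 1 ≤ b → (U : VSet n) →
    (∀ v → U v ≡ true → card (U ∩ adj G v) ≤ b) → s + 2 * μ * b ≤ card U →
    ∀ j → j ≤ s → Σ (VSet n) λ S → S ⊑ U × card S ≡ j × μ * eB G S S ≤ j * s
  sparse-subset {n} G μ s b μ≥1 b≥1 U deg≤b big zero _ =
    (λ _ → false) , (λ _ ()) , sum-zero n ,
    ≤-reflexive (trans (cong (μ *_) (trans (sum-cong {n} (λ _ → sum-zero n)) (sum-zero n))) (*-zeroʳ μ))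
  sparse-subset {n} G μ s b μ≥1 b≥1 U deg≤b big (suc j) j<s
    with S , S⊑U , cardS , sparse ← sparse-subset G μ s b μ≥1 b≥1 U deg≤b big j (<⇒≤ j<s)
    = add S v , add⊑U , trans (card-add S v Sv) (cong suc cardS) , sparse′
    where
    open ≤-Reasoning
    W = U ∖ S
    d = λ v → card (S ∩ adj G v)
    cardW : 2 * μ * b ≤ card W
    cardW = +-cancelˡ-≤ s _ _ (begin
      s + 2 * μ * b             ≤⟨ big ⟩
      card U                    ≡⟨ card-split U S ⟩
      card (U ∩ S) + card W     ≤⟨ +-monoˡ-≤ (card W) (card-mono {U = U ∩ S} {S} (λ x → ∧-trueʳ {U x})) ⟩
      card S + card W           ≡⟨ cong (_+ card W) cardS ⟩
      j + card W                ≤⟨ +-monoˡ-≤ (card W) (<⇒≤ j<s) ⟩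
      s + card W ∎)
    total : sumFin (λ v → 𝟙 (W v) * d v) ≤ s * b
    total = begin
      sumFin (λ v → 𝟙 (W v) * d v)
        ≡⟨ eB-deg G W S ⟨
      sumFin (λ v → sumFin (λ x → 𝟙 (W v ∧ S x ∧ adj G v x)))
        ≡⟨ sum-swap (λ v x → 𝟙 (W v ∧ S x ∧ adj G v x)) ⟩
      sumFin (λ x → sumFin (λ v → 𝟙 (W v ∧ S x ∧ adj G v x)))
        ≤⟨ sum-mono (λ x → ≤-trans (sum-mono (λ v → 𝟙-mono {W v ∧ S x ∧ adj G v x} {S x ∧ U v ∧ adj G x v}
            (flip x v)))
                                   (≤-reflexive (trans (sum-cong (λ v → 𝟙-∧ (S x) (U v ∧ adj G x v)))
                                       (sum-*ˡ (𝟙 (S x)) (λ v → 𝟙 (U v ∧ adj G x v)))))) ⟩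
      sumFin (λ x → 𝟙 (S x) * card (U ∩ adj G x))
        ≤⟨ sum-mono bound ⟩
      sumFin (λ x → 𝟙 (S x) * b)
        ≡⟨ sum-*ʳ b (λ x → 𝟙 (S x)) ⟩
      card S * b
        ≡⟨ cong (_* b) cardS ⟩
      j * b
        ≤⟨ *-monoˡ-≤ b (<⇒≤ j<s) ⟩
      s * b ∎
      where
      flip : ∀ x v → W v ∧ S x ∧ adj G v x ≡ true → S x ∧ U v ∧ adj G x v ≡ true
      flip x v h = ∧-true {S x} (∧-trueˡ {S x} (∧-trueʳ {W v} h)) (∧-true {U v} (∧-trueˡ {U v} (∧-trueˡ {W v} h))
                    (trans (sym G x v) (∧-trueʳ {S x} (∧-trueʳ {W v} h))))
      bound : ∀ x → 𝟙 (S x) * card (U ∩ adj G x) ≤ 𝟙 (S x) * b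
      bound x with S x in Sx
      ... | false = z≤n
      ... | true  = *-monoʳ-≤ 1 (deg≤b x (S⊑U x Sx))
    found = below-average W d (s * b) (≤-trans (*-mono-≤ (*-mono-≤ {1} {2} (s≤s z≤n) μ≥1) b≥1) cardW) total
    v = proj₁ found
    Wv = proj₁ (proj₂ found)
    Sv : S v ≡ false
    Sv = not-true (∧-trueʳ {U v} Wv)
    few : 2 * μ * d v ≤ s
    few = *-cancelʳ-≤ (2 * μ * d v) s b {{>-nonZero b≥1}} (begin
      2 * μ * d v * b       ≡⟨ comm (2 * μ) (d v) b ⟩
      2 * μ * b * d v       ≤⟨ *-monoˡ-≤ (d v) cardW ⟩
      card W * d v          ≤⟨ proj₂ (proj₂ found) ⟩
      s * b ∎)
      where
      comm : ∀ x y z → x * y * z ≡ x * z * y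
      comm = ℕR.solve-∀
    add⊑U : add S v ⊑ U
    add⊑U x h with S x in Sx
    ... | true  = S⊑U x Sx
    ... | false = subst (λ z → U z ≡ true) (≡.sym (single-self v x h)) (∧-trueˡ {U v} Wv)
    sparse′ : μ * eB G (add S v) (add S v) ≤ suc j * s
    sparse′ = begin
      μ * eB G (add S v) (add S v)          ≤⟨ *-monoʳ-≤ μ (eB-add G S v) ⟩
      μ * (eB G S S + 2 * d v)              ≡⟨ distr μ (eB G S S) (d v) ⟩
      2 * μ * d v + μ * eB G S S            ≤⟨ +-mono-≤ few sparse ⟩
      suc j * s ∎
      where
      distr : ∀ μ e d → μ * (e + 2 * d) ≡ 2 * μ * d + μ * e
      distr = ℕR.solve-∀

  all-or : ∀ {n} {A : Set} {P : Fin n → Set} → (∀ v → A ⊎ P v) → A ⊎ (∀ v → P v)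
  all-or {zero}  f = inj₂ (λ ())
  all-or {suc n} f with f zero | all-or (λ v → f (suc v))
  ... | inj₁ a | _      = inj₁ a
  ... | inj₂ _ | inj₁ a = inj₁ a
  ... | inj₂ p | inj₂ q = inj₂ λ { zero → p ; (suc v) → q v }

  SparseIn : ∀ {n} → Graph n → ℕ → ℕ → VSet n → Set
  SparseIn {n} G μ s W = Σ (VSet n) λ S → S ⊑ W × card S ≡ s × μ * eB G S S ≤ s * s

  -- One `s` pays for the discarded vertices of large degree and one for the vertices chosen
  -- greedily; the term `2 * μ * R μ r` is what the averaging needs when degrees are bounded by
  -- `R μ r * s`.
  R : ℕ → ℕ → ℕ
  R μ zero    = 1
  R μ (suc r) = 2 + 2 * μ * R μ r

  R≥1 : ∀ μ r → 1 ≤ R μ r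
  R≥1 μ zero    = ≤-refl
  R≥1 μ (suc r) = s≤s z≤n

  -- If at least s vertices of W have R μ r * s neighbours in W, recurse into these neighbourhoods;
  -- otherwise remove these vertices and pick s of the remaining ones greedily.
  sparse-or-cliques : ∀ {n} (G : Graph n) μ s → 1 ≤ μ → 1 ≤ s → ∀ r (W : VSet n) → R μ r * s ≤ card W →
    SparseIn G μ s W ⊎ s ^ r ≤ r ! * cliques r (adj G) W
  sparse-or-cliques G μ s μ≥1 s≥1 zero W big =
    -- The empty clique is always present.
    inj₂ (≤-reflexive (≡.sym (trans (+-identityʳ (cliques 0 (adj G) W)) (cliques-zero (adj G) W))))
  sparse-or-cliques {n} G μ s μ≥1 s≥1 (suc r) W big = decide (s ≤? card H)
    where
    open ≤-Reasoning
    b = R μ r * s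
    H : VSet n
    H v = W v ∧ isYes (b ≤? card (W ∩ adj G v))
    b≥1 : 1 ≤ b
    b≥1 = *-mono-≤ (R≥1 μ r) s≥1
    Many : Fin n → Set
    Many v = 𝟙 (H v) * s ^ r ≤ r ! * (𝟙 (W v) * cliques r (adj G) (W ∩ adj G v))
    recurse : ∀ v → SparseIn G μ s W ⊎ Many v
    recurse v with W v | b ≤? card (W ∩ adj G v)
    ... | false | _     = inj₂ z≤n
    ... | true  | no _  = inj₂ z≤n
    ... | true  | yes p with sparse-or-cliques G μ s μ≥1 s≥1 r (W ∩ adj G v) p
    ...   | inj₁ (S , S⊑ , rest) = inj₁ (S , (λ x Sx → ∧-trueˡ {W x} (S⊑ x Sx)) , rest)
    ...   | inj₂ many = inj₂ (≤-trans (≤-reflexive (+-identityʳ (s ^ r)))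
                          (≤-trans many (≤-reflexive (cong (r ! *_) (≡.sym (+-identityʳ _))))))
    decide : Dec (s ≤ card H) → SparseIn G μ s W ⊎ s ^ suc r ≤ suc r ! * cliques (suc r) (adj G) W
    -- Unless some neighbourhood already yields a sparse set, each vertex of `H` sees at least
    -- `s ^ r / r !` cliques of size `r`. Summed over `H`, every larger clique is counted `suc r`
    -- times, which turns `r !` into `suc r !`.
    decide (yes s≤H) with all-or recurse
    ... | inj₁ found = inj₁ found
    ... | inj₂ many  = inj₂ (begin
        s * s ^ r
          ≤⟨ *-monoˡ-≤ (s ^ r) s≤H ⟩
        card H * s ^ r
          ≡⟨ sum-*ʳ (s ^ r) (λ v → 𝟙 (H v)) ⟨
        sumFin (λ v → 𝟙 (H v) * s ^ r)
          ≤⟨ sum-mono many ⟩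
        sumFin (λ v → r ! * (𝟙 (W v) * cliques r (adj G) (W ∩ adj G v)))
          ≡⟨ sum-*ˡ (r !) (λ v → 𝟙 (W v) * cliques r (adj G) (W ∩ adj G v)) ⟩
        r ! * sumFin (λ v → 𝟙 (W v) * cliques r (adj G) (W ∩ adj G v))
          ≡⟨ cong (r ! *_) (Σ-cliques-nbhd r (adj G) (sym G) (irrefl G) W) ⟩
        r ! * (suc r * cliques (suc r) (adj G) W)
          ≡⟨ assoc (r !) (suc r) (cliques (suc r) (adj G) W) ⟩
        suc r * r ! * cliques (suc r) (adj G) W ∎)
      where
      assoc : ∀ x y z → x * (y * z) ≡ y * x * z
      assoc = ℕR.solve-∀
    decide (no s≰H) =
      let S , S⊑U , rest = sparse-subset G μ s b μ≥1 b≥1 U deg≤b bigU s ≤-refl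
      in inj₁ (S , (λ x Sx → ∧-trueˡ {W x} (S⊑U x Sx)) , rest)
      where
      U = W ∖ H
      deg≤b : ∀ v → U v ≡ true → card (U ∩ adj G v) ≤ b
      deg≤b v Uv with W v | b ≤? card (W ∩ adj G v) | Uv
      ... | true | no ¬p | _ = ≤-trans (card-mono {U = U ∩ adj G v} {W ∩ adj G v} (λ x h →
            ∧-true {W x} (∧-trueˡ {W x} (∧-trueˡ {U x} h)) (∧-trueʳ {U x} h))) (<⇒≤ (≰⇒> ¬p))
      bigU : s + 2 * μ * b ≤ card U
      bigU = +-cancelˡ-≤ s _ _ (begin
        s + (s + 2 * μ * b)        ≡⟨ expand s μ (R μ r) ⟩
        R μ (suc r) * s            ≤⟨ big ⟩
        card W                     ≡⟨ card-split W H ⟩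
        card (W ∩ H) + card U      ≤⟨ +-monoˡ-≤ (card U) (card-mono {U = W ∩ H} {H} (λ x → ∧-trueʳ {W x})) ⟩
        card H + card U            ≤⟨ +-monoˡ-≤ (card U) (<⇒≤ (≰⇒> s≰H)) ⟩
        s + card U ∎)
        where
        expand : ∀ s μ ρ → s + (s + 2 * μ * (ρ * s)) ≡ (2 + 2 * μ * ρ) * s
        expand = ℕR.solve-∀

  -- Selecting disjoint homogeneous sets

  -- Pigeonhole in the form that composes: `b` is the number of classes of a cut, and one class
  -- keeps a `1/b` share, but the classes themselves are never named.
  Splits : ∀ {n} → ℕ → (VSet n → Set) → Set
  Splits {n} b T = ∀ U u → b * u ≤ card U → Σ (VSet n) λ W → W ⊑ U × u ≤ card W × T W

  Hereditary : ∀ {n} → (VSet n → Set) → Set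
  Hereditary T = ∀ W W′ → W′ ⊑ W → T W → T W′

  ConstOn : ∀ {n} → VSet n → VSet n → Set
  ConstOn p W = ∀ x y → W x ≡ true → W y ≡ true → p x ≡ p y

  constOn-hereditary : ∀ {n} (p : VSet n) → Hereditary (ConstOn p)
  constOn-hereditary p W W′ sub c x y Wx Wy = c x y (sub x Wx) (sub y Wy)

  splits-const : ∀ {n} (p : VSet n) → Splits 2 (ConstOn p)
  splits-const p U u big with u ≤? card (U ∩ p)
  ... | yes le = U ∩ p , (λ x → ∧-trueˡ {U x}) , le ,
        λ x y Wx Wy → trans (∧-trueʳ {U x} Wx) (≡.sym (∧-trueʳ {U y} Wy))
  ... | no nle = U ∖ p , (λ x → ∧-trueˡ {U x}) , le ,
        λ x y Wx Wy → trans (not-true (∧-trueʳ {U x} Wx)) (≡.sym (not-true (∧-trueʳ {U y} Wy)))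
    where
    open ≤-Reasoning
    le : u ≤ card (U ∖ p)
    le = +-cancelˡ-≤ u _ _ (begin
      u + u                              ≡⟨ cong (u +_) (+-identityʳ u) ⟨
      2 * u                              ≤⟨ big ⟩
      card U                             ≡⟨ card-split U p ⟩
      card (U ∩ p) + card (U ∖ p)        ≤⟨ +-monoˡ-≤ _ (<⇒≤ (≰⇒> nle)) ⟩
      u + card (U ∖ p) ∎)

  -- Cut for `T` first and cut the large piece for `T′`; heredity preserves `T` in the second step.
  splits-× : ∀ {n b b′} {T T′ : VSet n → Set} → Hereditary T → Splits b T → Splits b′ T′ →
    Splits (b * b′) (λ W → T W × T′ W)
  splits-× {b = b} {b′} her sp sp′ U u big
    with W , W⊑U , le , TW ← sp U (b′ * u) (≤-trans (≤-reflexive (≡.sym (*-assoc b b′ u))) big)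
    with W′ , W′⊑W , le′ , T′W′ ← sp′ W u le
    = W′ , (λ x p → W⊑U x (W′⊑W x p)) , le′ , her W W′ W′⊑W TW , T′W′

  splits-∀ : ∀ {n b} q (T : Fin q → VSet n → Set) → (∀ i → Hereditary (T i)) → (∀ i → Splits b (T i)) →
    Splits (b ^ q) (λ W → ∀ i → T i W)
  splits-∀ zero T her sp U u big = U , (λ x p → p) , ≤-trans (≤-reflexive (≡.sym (+-identityʳ u))) big , λ ()
  splits-∀ {b = b} (suc q) T her sp U u big
    with W , W⊑U , le , T₀ , Tₛ ← splits-× {b = b} {b ^ q} (her zero) (sp zero)
           (splits-∀ q (λ i → T (suc i)) (λ i → her (suc i)) (λ i → sp (suc i))) U u big
    = W , W⊑U , le , λ { zero → T₀ ; (suc i) → Tₛ i }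

  Disjoint : ∀ {n q} → (Fin q → VSet n) → Set
  Disjoint C = ∀ i j x → C i x ≡ true → C j x ≡ true → i ≡ j

  -- The reserve `t` keeps `find` applicable: after any number of removals of `s` vertices at least
  -- `t` are left. Searching only in what remains makes the sets disjoint.
  greedy : ∀ {n} (Good : VSet n → Set) s t q (U₀ : VSet n) →
    (∀ U → U ⊑ U₀ → t ≤ card U → Σ (VSet n) λ S → S ⊑ U × card S ≡ s × Good S) →
    q * s + t ≤ card U₀ →
    Σ (Fin q → VSet n) λ C → (∀ i → C i ⊑ U₀) × (∀ i → card (C i) ≡ s) × (∀ i → Good (C i)) × Disjoint C
  greedy Good s t zero U₀ find big = (λ ()) , (λ ()) , (λ ()) , (λ ()) , λ ()
  greedy {n} Good s t (suc q) U₀ find big = C , C⊑U₀ , cardC , goodC , disjC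
    where
    open ≤-Reasoning
    first = find U₀ (λ _ p → p) (≤-trans (m≤n+m t (suc q * s)) big)
    S = proj₁ first
    S⊑U₀ = proj₁ (proj₂ first)
    cardS = proj₁ (proj₂ (proj₂ first))
    U₁ = U₀ ∖ S
    U₁⊑U₀ : U₁ ⊑ U₀
    U₁⊑U₀ x = ∧-trueˡ {U₀ x}
    big′ : q * s + t ≤ card U₁
    big′ = +-cancelˡ-≤ s _ _ (begin
      s + (q * s + t)                ≡⟨ +-assoc s (q * s) t ⟨
      suc q * s + t                  ≤⟨ big ⟩
      card U₀                        ≡⟨ card-split U₀ S ⟩
      card (U₀ ∩ S) + card U₁        ≤⟨ +-monoˡ-≤ (card U₁) (card-mono {U = U₀ ∩ S} {S} (λ x → ∧-trueʳ {U₀ x})) ⟩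
      card S + card U₁               ≡⟨ cong (_+ card U₁) cardS ⟩
      s + card U₁ ∎)
    rest = greedy Good s t q U₁ (λ U U⊑ → find U (λ x p → U₁⊑U₀ x (U⊑ x p))) big′
    C′ = proj₁ rest
    C′⊑ = proj₁ (proj₂ rest)
    C : Fin (suc q) → VSet n
    C zero    = S
    C (suc i) = C′ i
    C⊑U₀ : ∀ i → C i ⊑ U₀
    C⊑U₀ zero    = S⊑U₀
    C⊑U₀ (suc i) = λ x p → U₁⊑U₀ x (C′⊑ i x p)
    cardC : ∀ i → card (C i) ≡ s
    cardC zero    = cardS
    cardC (suc i) = proj₁ (proj₂ (proj₂ rest)) i
    goodC : ∀ i → Good (C i)
    goodC zero    = proj₂ (proj₂ (proj₂ first))
    goodC (suc i) = proj₁ (proj₂ (proj₂ (proj₂ rest))) i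
    apart : ∀ i x → S x ≡ true → C′ i x ≡ true → ⊥
    apart i x Sx Cx with trans (≡.sym Sx) (not-true (∧-trueʳ {U₀ x} (C′⊑ i x Cx)))
    ... | ()
    disjC : Disjoint C
    disjC zero    zero    x p p′ = refl
    disjC zero    (suc j) x p p′ = ⊥-elim (apart j x p p′)
    disjC (suc i) zero    x p p′ = ⊥-elim (apart i x p′ p)
    disjC (suc i) (suc j) x p p′ = cong suc (proj₂ (proj₂ (proj₂ (proj₂ rest))) i j x p p′)

  -- Dividing by `b * D + b` makes each old core large enough for `b * D` new ones and for `b * s′`
  -- spare vertices, which cover the reserve of the greedy selection. The spare vertices number at
  -- most `n / D` in total, and so do the remainders of the divisions because `n` is large; hence
  -- the `2 * n`.
  chunk-size : ∀ n q s L b D → 1 ≤ q → 1 ≤ b → 1 ≤ D → n ≡ q * s + L →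
    2 * D * (q * (b * D)) ≤ n →
    Σ ℕ λ s′ → Σ ℕ λ L′ → q * (b * D) * s′ + b * s′ ≤ q * s ×
      n ≡ q * (b * D) * s′ + L′ × D * L′ ≤ D * L + 2 * n
  chunk-size n q s L b D q≥1 b≥1 D≥1 n≡ large = s′ , L′ , fits , n≡′ , small
    where
    open ≤-Reasoning
    d = b * D + b
    instance
      d≢0 : NonZero d
      d≢0 = >-nonZero (≤-trans b≥1 (m≤n+m b (b * D)))
    s′ = s / d
    t = s % d
    s≡ : s ≡ t + s′ * d
    s≡ = m≡m%n+[m/n]*n s d
    L′ = L + q * (t + s′ * b)
    regroup : ∀ q t s′ b D L → q * (t + s′ * (b * D + b)) + L ≡ q * (b * D) * s′ + (L + q * (t + s′ * b))
    regroup = ℕR.solve-∀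
    n≡′ : n ≡ q * (b * D) * s′ + L′
    n≡′ = trans n≡ (trans (cong (λ z → q * z + L) s≡) (regroup q t s′ b D L))
    fits : q * (b * D) * s′ + b * s′ ≤ q * s
    fits = begin
      q * (b * D) * s′ + b * s′        ≤⟨ +-monoʳ-≤ (q * (b * D) * s′)
          (≤-trans (≤-reflexive (≡.sym (+-identityʳ (b * s′)))) (*-monoˡ-≤ (b * s′) q≥1)) ⟩
      q * (b * D) * s′ + q * (b * s′)  ≡⟨ factor q b D s′ ⟩
      q * (s′ * d)                     ≤⟨ *-monoʳ-≤ q (≤-trans (m≤n+m (s′ * d) t) (≤-reflexive (≡.sym s≡))) ⟩
      q * s ∎
      where
      factor : ∀ q b D s → q * (b * D) * s + q * (b * s) ≡ q * (s * (b * D + b))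
      factor = ℕR.solve-∀
    small : D * L′ ≤ D * L + 2 * n
    small = begin
      D * L′                                                      ≡⟨ expand D L q t s′ b ⟩
      D * L + (D * q * t + q * (b * D) * s′)                      ≤⟨ +-monoʳ-≤ (D * L) (+-mono-≤ left right) ⟩
      D * L + (n + n)                                             ≡⟨ cong (λ z → D * L + (n + z)) (+-identityʳ n) ⟨
      D * L + 2 * n ∎
      where
      expand : ∀ D L q t s b → D * (L + q * (t + s * b)) ≡ D * L + (D * q * t + q * (b * D) * s)
      expand = ℕR.solve-∀
      right : q * (b * D) * s′ ≤ n
      right = ≤-trans (m≤m+n _ L′) (≤-reflexive (≡.sym n≡′))
      left : D * q * t ≤ n
      left = begin
        D * q * t                              ≤⟨ *-monoʳ-≤ (D * q) (<⇒≤ (m%n<n s d)) ⟩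
        D * q * d                              ≡⟨ distr D q b ⟩
        D * (q * (b * D)) + 1 * (q * (b * D))  ≤⟨ +-monoʳ-≤ (D * (q * (b * D))) (*-monoˡ-≤ (q * (b * D)) D≥1) ⟩
        D * (q * (b * D)) + D * (q * (b * D))  ≡⟨ double D (q * (b * D)) ⟩
        2 * D * (q * (b * D))                  ≤⟨ large ⟩
        n ∎
        where
        distr : ∀ D q b → D * q * (b * D + b) ≡ D * (q * (b * D)) + 1 * (q * (b * D))
        distr = ℕR.solve-∀
        double : ∀ D x → D * x + D * x ≡ 2 * D * x
        double = ℕR.solve-∀

  -- The leftover is at most `B / D` of all vertices, and `2 * B ≤ D`.
  half-covered : ∀ n q s L D B → 1 ≤ B → 2 * B ≤ D → n ≡ q * s + L → D * L ≤ B * n → n ≤ 2 * (q * s)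
  half-covered n q s L D B B≥1 2B≤D n≡ small = +-cancelʳ-≤ n n (2 * (q * s)) (begin
      n + n                        ≡⟨ cong₂ _+_ n≡ n≡ ⟩
      (q * s + L) + (q * s + L)    ≡⟨ regroup (q * s) L ⟩
      2 * (q * s) + 2 * L          ≤⟨ +-monoʳ-≤ (2 * (q * s)) 2L≤n ⟩
      2 * (q * s) + n ∎)
    where
    open ≤-Reasoning
    regroup : ∀ x L → (x + L) + (x + L) ≡ 2 * x + 2 * L
    regroup = ℕR.solve-∀
    comm : ∀ B L → B * (2 * L) ≡ 2 * B * L
    comm = ℕR.solve-∀
    2L≤n : 2 * L ≤ n
    2L≤n = *-cancelˡ-≤ B {{>-nonZero B≥1}} (begin
      B * (2 * L)    ≡⟨ comm B L ⟩
      2 * B * L      ≤⟨ *-monoˡ-≤ L 2B≤D ⟩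
      D * L          ≤⟨ small ⟩
      B * n ∎)

  ^-distribʳ-* : ∀ r x y → (x * y) ^ r ≡ x ^ r * y ^ r
  ^-distribʳ-* zero    x y = refl
  ^-distribʳ-* (suc r) x y rewrite ^-distribʳ-* r x y = [m*n]*[o*p]≡[m*o]*[n*p] x y (x ^ r) (y ^ r)

  -- The origin of `ρ`. As `s` is at least `n / (2K)`, a failure would give `n ^ r ≤ A * k` with
  -- `A = r ! * (2 * K) ^ r`. Against `suc A * k ≤ n ^ r` this forces `k ≡ 0`, and then `n ^ r ≡ 0`.
  few-cliques : ∀ n r k K s → 1 ≤ n → n ≤ 2 * (K * s) →
    suc (r ! * (2 * K) ^ r) * k ≤ n ^ r → r ! * k < s ^ r
  few-cliques n r k K s n≥1 n≤ few with r ! * k <? s ^ r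
  ... | yes p = p
  ... | no ¬p = ⊥-elim (<-irrefl refl (≤-trans (m^n>0 n {{>-nonZero n≥1}} r) (≤-trans nʳ≤ (≤-reflexive Ak≡0))))
    where
    open ≤-Reasoning
    A = r ! * (2 * K) ^ r
    nʳ≤ : n ^ r ≤ A * k
    nʳ≤ = begin
      n ^ r                        ≤⟨ ^-monoˡ-≤ r n≤ ⟩
      (2 * (K * s)) ^ r            ≡⟨ cong (_^ r) (≡.sym (*-assoc 2 K s)) ⟩
      (2 * K * s) ^ r              ≡⟨ ^-distribʳ-* r (2 * K) s ⟩
      (2 * K) ^ r * s ^ r          ≤⟨ *-monoʳ-≤ ((2 * K) ^ r) (≮⇒≥ ¬p) ⟩
      (2 * K) ^ r * (r ! * k)      ≡⟨ swap ((2 * K) ^ r) (r !) k ⟩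
      A * k ∎
      where
      swap : ∀ x y z → x * (y * z) ≡ y * x * z
      swap = ℕR.solve-∀
    k≡0 : k ≡ 0
    k≡0 = n≤0⇒n≡0 (+-cancelʳ-≤ (A * k) k 0 (≤-trans few nʳ≤))
    Ak≡0 : A * k ≡ 0
    Ak≡0 = trans (cong (A *_) k≡0) (*-zeroʳ A)

  count-unique : ∀ {q} (p : Fin q → Bool) → (∀ i j → p i ≡ true → p j ≡ true → i ≡ j) → (u : Bool) →
    (∀ i → p i ≡ true → u ≡ true) → countFin p ≤ 𝟙 u
  count-unique {zero}  p uniq u hit = z≤n
  count-unique {suc q} p uniq u hit with p zero in p0
  ... | false = count-unique (λ i → p (suc i)) (λ i j a b → suc-inj (uniq (suc i) (suc j) a b)) u (λ i → hit (suc i))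
    where
    suc-inj : ∀ {i j : Fin q} → suc i ≡ suc j → i ≡ j
    suc-inj refl = refl
  ... | true rewrite hit zero p0 = s≤s (≤-trans (sum-mono {g = λ _ → 0} none) (≤-reflexive (sum-zero q)))
    where
    none : ∀ i → 𝟙 (p (suc i)) ≤ 0
    none i with p (suc i) in pi
    ... | false = z≤n
    ... | true with () ← uniq zero (suc i) p0 pi

  ⋃ : ∀ {n q} → (Fin q → VSet n) → VSet n
  ⋃ C x = isYes (any? (λ i → C i x ≟ᵇ true))

  ⋃-elim : ∀ {n q} (C : Fin q → VSet n) x → ⋃ C x ≡ true → Σ (Fin q) λ i → C i x ≡ true
  ⋃-elim C x p with any? (λ i → C i x ≟ᵇ true)
  ... | yes w = w

  ⋃-intro : ∀ {n q} (C : Fin q → VSet n) x i → C i x ≡ true → ⋃ C x ≡ true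
  ⋃-intro C x i p with any? (λ i → C i x ≟ᵇ true)
  ... | yes _ = refl
  ... | no no-i = ⊥-elim (no-i (i , p))

  card-⋃ : ∀ {n q s} (C : Fin q → VSet n) → Disjoint C → (∀ i → card (C i) ≡ s) → q * s ≤ card (⋃ C)
  card-⋃ {n} {q} {s} C disj size = begin
      q * s                                      ≡⟨ sum-const q s ⟨
      sumFin {q} (λ _ → s)                         ≡⟨ sum-cong size ⟨
      sumFin (λ i → sumFin (λ x → 𝟙 (C i x)))      ≡⟨ sum-swap (λ i x → 𝟙 (C i x)) ⟩
      sumFin (λ x → sumFin (λ i → 𝟙 (C i x)))      ≤⟨ sum-mono
          (λ x → count-unique (λ i → C i x) (λ i j → disj i j x) (⋃ C x) (⋃-intro C x)) ⟩
      card (⋃ C) ∎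
    where open ≤-Reasoning

  -- Distributing the leftover vertices

  argmin : ∀ {q} (σ : Fin (suc q) → ℕ) → Σ (Fin (suc q)) λ i → ∀ j → σ i ≤ σ j
  argmin {zero}  σ = zero , λ { zero → ≤-refl }
  argmin {suc q} σ with argmin (λ i → σ (suc i))
  ... | i , min with σ zero ≤? σ (suc i)
  ...   | yes le = zero , λ { zero → ≤-refl ; (suc j) → ≤-trans le (min j) }
  ...   | no gt  = suc i , λ { zero → <⇒≤ (≰⇒> gt) ; (suc j) → min j }

  fibre : ∀ {n q} → (Fin n → Fin q) → Fin q → VSet n
  fibre f i x = isYes (f x ≟ᶠ i)

  Balanced : ∀ {q} → (Fin q → ℕ) → Set
  Balanced σ = ∀ i j → σ i ≤ suc (σ j)

  balanced-bump : ∀ {q} (σ : Fin q → ℕ) i₀ → Balanced σ → (∀ j → σ i₀ ≤ σ j) →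
    Balanced (λ j → σ j + 𝟙 (isYes (i₀ ≟ᶠ j)))
  balanced-bump σ i₀ bal min i j with i₀ ≟ᶠ i | i₀ ≟ᶠ j
  ... | yes refl | yes _ = ≤-trans (≤-reflexive (+-comm (σ i₀) 1)) (s≤s (≤-trans (min j) (m≤m+n (σ j) 1)))
  ... | yes refl | no _  = ≤-trans (≤-reflexive (+-comm (σ i₀) 1)) (s≤s (≤-trans (min j) (m≤m+n (σ j) 0)))
  ... | no _     | yes _ = ≤-trans (≤-reflexive (+-identityʳ (σ i))) (≤-trans (bal i j) (s≤s (m≤m+n (σ j) 1)))
  ... | no _     | no _  = ≤-trans (≤-reflexive (+-identityʳ (σ i))) (≤-trans (bal i j) (s≤s (m≤m+n (σ j) 0)))

  balanced-cong : ∀ {q} {σ τ : Fin q → ℕ} → (∀ i → σ i ≡ τ i) → Balanced σ → Balanced τ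
  balanced-cong eq bal i j = ≤-trans (≤-reflexive (≡.sym (eq i))) (≤-trans (bal i j) (≤-reflexive (cong suc (eq j))))

  -- Each free vertex joins a currently smallest class. The accumulator `σ` holds the sizes reached
  -- so far, so that the induction on vertices can start from the sizes of the cores.
  distribute : ∀ {n q} (free : VSet n) (lab : Fin n → Fin (suc q)) (σ : Fin (suc q) → ℕ) → Balanced σ →
    Σ (Fin n → Fin (suc q)) λ f → (∀ x → free x ≡ false → f x ≡ lab x) ×
      Balanced (λ i → σ i + card (free ∩ fibre f i))
  distribute {zero} free lab σ bal = (λ ()) , (λ ()) , balanced-cong (λ i → ≡.sym (+-identityʳ (σ i))) bal
  distribute {suc n} {q} free lab σ bal with free zero in fz
  ... | false with f , keep , bal′ ← distribute (λ x → free (suc x)) (λ x → lab (suc x)) σ bal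
    = f⁺ , keep⁺ , bal′
    where
    f⁺ : Fin (suc n) → Fin (suc q)
    f⁺ zero    = lab zero
    f⁺ (suc x) = f x
    keep⁺ : ∀ x → free x ≡ false → f⁺ x ≡ lab x
    keep⁺ zero    _ = refl
    keep⁺ (suc x) p = keep x p
  ... | true with f , keep , bal′ ← distribute (λ x → free (suc x)) (λ x → lab (suc x))
                   (λ j → σ j + 𝟙 (isYes (proj₁ (argmin σ) ≟ᶠ j)))
                   (balanced-bump σ (proj₁ (argmin σ)) bal (proj₂ (argmin σ)))
    = f⁺ , keep⁺ , balanced-cong (λ i → +-assoc (σ i) (𝟙 (isYes (proj₁ (argmin σ) ≟ᶠ i)))
        (card ((λ x → free (suc x)) ∩ fibre f i))) bal′
    where
    f⁺ : Fin (suc n) → Fin (suc q)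
    f⁺ zero    = proj₁ (argmin σ)
    f⁺ (suc x) = f x
    keep⁺ : ∀ x → free x ≡ false → f⁺ x ≡ lab x
    keep⁺ zero    p with () ← trans (≡.sym fz) p
    keep⁺ (suc x) p = keep x p

  fibre-self : ∀ {n q} (f : Fin n → Fin q) i x → f x ≡ i → fibre f i x ≡ true
  fibre-self f i x e with f x ≟ᶠ i
  ... | yes _ = refl
  ... | no ne = ⊥-elim (ne e)

  extend-cores : ∀ {n q s} (C : Fin (suc q) → VSet n) → Disjoint C → (∀ i → card (C i) ≡ s) →
    Σ (Fin n → Fin (suc q)) λ f → (∀ i → C i ⊑ fibre f i) × Balanced (λ i → card (fibre f i))
  extend-cores {n} {q} {s} C disj size = f , sub , balanced-cong total (proj₂ (proj₂ dist))
    where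
    free : VSet n
    free x = not (⋃ C x)
    choose : ∀ x → Dec (Σ (Fin (suc q)) λ i → C i x ≡ true) → Fin (suc q)
    choose x (yes (i , _)) = i
    choose x (no _)        = zero
    lab : Fin n → Fin (suc q)
    lab x = choose x (any? (λ i → C i x ≟ᵇ true))
    lab-correct : ∀ i x → C i x ≡ true → lab x ≡ i
    lab-correct i x p with any? (λ i → C i x ≟ᵇ true)
    ... | yes (j , pj) = disj j i x pj p
    ... | no none      = ⊥-elim (none (i , p))
    dist = distribute free lab (λ _ → s) (λ _ _ → n≤1+n s)
    f = proj₁ dist
    f-core : ∀ i x → C i x ≡ true → f x ≡ i
    f-core i x p = trans (proj₁ (proj₂ dist) x (cong not (⋃-intro C x i p))) (lab-correct i x p)
    sub : ∀ i → C i ⊑ fibre f i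
    sub i x p = fibre-self f i x (f-core i x p)
    total : ∀ i → s + card (free ∩ fibre f i) ≡ card (fibre f i)
    total i = trans (cong (_+ card (free ∩ fibre f i)) (≡.sym (size i)))
      (trans (≡.sym (sum-+ (λ x → 𝟙 (C i x)) (λ x → 𝟙 ((free ∩ fibre f i) x)))) (sum-cong point))
      where
      point : ∀ x → 𝟙 (C i x) + 𝟙 (not (⋃ C x) ∧ fibre f i x) ≡ 𝟙 (fibre f i x)
      point x with C i x in Cx
      ... | true rewrite ⋃-intro C x i Cx | sub i x Cx = refl
      ... | false with ⋃ C x in Ux
      ...   | false = refl
      ...   | true with j , Cj ← ⋃-elim C x Ux with f x ≟ᶠ i
      ...     | no _  = refl
      ...     | yes e with () ← trans (≡.sym Cx) (subst (λ k → C k x ≡ true) (trans (≡.sym (f-core j x Cj)) e) Cj)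

  Σ-fibres : ∀ {n q} (f : Fin n → Fin q) → sumFin (λ i → card (fibre f i)) ≡ n
  Σ-fibres {n} {q} f = trans (sum-swap (λ i x → 𝟙 (fibre f i x)))
    (trans (sum-cong (λ x → one (f x))) (card-full n))
    where
    one : ∀ {q} (j : Fin q) → sumFin (λ i → 𝟙 (isYes (j ≟ᶠ i))) ≡ 1
    one {suc q} zero    = cong suc (sum-zero q)
    one {suc q} (suc j) = trans (sum-cong (λ i → cong 𝟙 (shift j i))) (one j)
      where
      shift : ∀ (j i : Fin q) → isYes (suc j ≟ᶠ suc i) ≡ isYes (j ≟ᶠ i)
      shift j i with j ≟ᶠ i
      ... | yes _ = refl
      ... | no _  = refl

  -- Every class has at most `suc (σ i)` vertices and class `i` itself fewer, so the total is
  -- strictly below `suc q * suc (σ i)`.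
  balanced-lower : ∀ {q} n (σ : Fin (suc q) → ℕ) → sumFin σ ≡ n → Balanced σ → ∀ i → n / suc q ≤ σ i
  balanced-lower {q} n σ total bal i = ≤-pred (m<n*o⇒m/o<n (begin-strict
      n                                      ≡⟨ total ⟨
      sumFin σ                               <⟨ sum-mono-< (λ j → bal j i) i (n<1+n (σ i)) ⟩
      sumFin {suc q} (λ _ → suc (σ i))       ≡⟨ sum-const (suc q) (suc (σ i)) ⟩
      suc q * suc (σ i)                      ≡⟨ *-comm (suc q) (suc (σ i)) ⟩
      suc (σ i) * suc q ∎))
    where open ≤-Reasoning

  balanced-upper-* : ∀ {q} n (σ : Fin (suc q) → ℕ) → sumFin σ ≡ n → Balanced σ → ∀ i → suc q * σ i ≤ n + q
  balanced-upper-* {q} n σ total bal i = ≤-pred (begin-strict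
      suc q * σ i                            ≡⟨ sum-const (suc q) (σ i) ⟨
      sumFin {suc q} (λ _ → σ i)             <⟨ sum-mono-< (λ j → bal i j) i (n<1+n (σ i)) ⟩
      sumFin (λ j → suc (σ j))               ≡⟨ sum-+ (λ _ → 1) σ ⟩
      sumFin {suc q} (λ _ → 1) + sumFin σ    ≡⟨ cong₂ _+_ (trans (sum-const (suc q) 1) (*-identityʳ (suc q))) total ⟩
      suc q + n                              ≡⟨ cong suc (+-comm q n) ⟩
      suc (n + q) ∎)
    where open ≤-Reasoning

  balanced-upper : ∀ {q} n (σ : Fin (suc q) → ℕ) → sumFin σ ≡ n → Balanced σ → ∀ i → σ i ≤ (n + q) / suc q
  balanced-upper {q} n σ total bal i = begin
      σ i                      ≡⟨ m*n/n≡m (σ i) (suc q) ⟨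
      σ i * suc q / suc q      ≤⟨ /-monoˡ-≤ (suc q) (≤-trans (≤-reflexive (*-comm (σ i) (suc q)))
          (balanced-upper-* n σ total bal i)) ⟩
      (n + q) / suc q ∎
    where open ≤-Reasoning

  -- A class exceeds its core through the leftover `L` and through rounding. Multiplied by `D`, each
  -- of the two totals is at most half of `suc q * s`, since `n ≤ 2 * (suc q * s)` absorbs half of
  -- the factor 4.
  excess-small : ∀ n q s L D v → 4 * D * L ≤ n → 4 * D * suc q ≤ n → n ≤ 2 * (suc q * s) → n ≡ suc q * s + L →
    suc q * v ≤ n + q → D * v ≤ D * s + s
  excess-small n q s L D v 4DL 4Dq half n≡ up = *-cancelˡ-≤ (4 * suc q) (begin
      4 * suc q * (D * v)                                ≡⟨ r₁ q D v ⟩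
      4 * D * (suc q * v)                                ≤⟨ *-monoʳ-≤ (4 * D)
          (≤-trans up (≤-trans (+-monoʳ-≤ n (n≤1+n q)) (≤-reflexive (cong (_+ suc q) n≡)))) ⟩
      4 * D * (suc q * s + L + suc q)                    ≡⟨ r₂ D q s L ⟩
      4 * D * (suc q * s) + (4 * D * L + 4 * D * suc q)  ≤⟨ +-monoʳ-≤ (4 * D * (suc q * s))
          (+-mono-≤ (≤-trans 4DL half) (≤-trans 4Dq half)) ⟩
      4 * D * (suc q * s) + (2 * (suc q * s) + 2 * (suc q * s)) ≡⟨ r₃ D q s ⟩
      4 * suc q * (D * s + s) ∎)
    where
    open ≤-Reasoning
    r₁ : ∀ q D v → 4 * suc q * (D * v) ≡ 4 * D * (suc q * v)
    r₁ = ℕR.solve-∀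
    r₂ : ∀ D q s L → 4 * D * (suc q * s + L + suc q) ≡ 4 * D * (suc q * s) + (4 * D * L + 4 * D * suc q)
    r₂ = ℕR.solve-∀
    r₃ : ∀ D q s → 4 * D * (suc q * s) + (2 * (suc q * s) + 2 * (suc q * s)) ≡ 4 * suc q * (D * s + s)
    r₃ = ℕR.solve-∀

  open import Data.Nat.Combinatorics using (_C_; nCk+nC[k+1]≡[n+1]C[k+1]; nC1≡n)

  -- Enlarging the cores

  card-superset : ∀ {n} (C V : VSet n) → C ⊑ V → card V ≡ card C + card (V ∖ C)
  card-superset C V C⊑V = trans (card-split V C) (cong (_+ card (V ∖ C)) (sum-cong point))
    where
    point : ∀ x → 𝟙 (V x ∧ C x) ≡ 𝟙 (C x)
    point x with C x in Cx
    ... | true rewrite C⊑V x Cx = refl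
    ... | false with V x
    ...   | true  = refl
    ...   | false = refl

  card-∩-core : ∀ {n} (C V X : VSet n) → X ⊑ V → card X ≤ card (X ∩ C) + card (V ∖ C)
  card-∩-core C V X X⊑V = ≤-trans (≤-reflexive (card-split X C)) (+-monoʳ-≤ (card (X ∩ C))
    (card-mono {U = X ∖ C} {V ∖ C} (λ x p → ∧-true {V x} (X⊑V x (∧-trueˡ {X x} p)) (∧-trueʳ {X x} p))))

  eB-mono : ∀ {n} (G : Graph n) {X′ X Y′ Y : VSet n} → X′ ⊑ X → Y′ ⊑ Y → eB G X′ Y′ ≤ eB G X Y
  eB-mono G {X′} {X} {Y′} {Y} sX sY = sum-mono (λ x → sum-mono (λ y → 𝟙-mono {X′ x ∧ Y′ y ∧ adj G x y} (λ p →
    ∧-true {X x} (sX x (∧-trueˡ {X′ x} p)) (∧-true {Y y} (sY y (∧-trueˡ {Y′ y} (∧-trueʳ {X′ x} p)))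
        (∧-trueʳ {Y′ y} (∧-trueʳ {X′ x} p))))))

  card-product : ∀ {n} (X Y : VSet n) → card X * card Y ≡ sumFin (λ x → sumFin (λ y → 𝟙 (X x ∧ Y y)))
  card-product X Y = ≡.sym
      (trans (sum-cong (λ x → trans (sum-cong (λ y → 𝟙-∧ (X x) (Y y))) (sum-*ˡ (𝟙 (X x)) (λ y → 𝟙 (Y y)))))
    (sum-*ʳ (card Y) (λ x → 𝟙 (X x))))

  -- The edges lost in passing to the smaller rectangle are among the pairs lost. Both differences
  -- are moved across to avoid subtraction in `ℕ`.
  eB-defect : ∀ {n} (G : Graph n) {X′ X Y′ Y : VSet n} → X′ ⊑ X → Y′ ⊑ Y →
    eB G X Y + card X′ * card Y′ ≤ eB G X′ Y′ + card X * card Y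
  eB-defect G {X′} {X} {Y′} {Y} sX sY = begin
      eB G X Y + card X′ * card Y′
        ≡⟨ cong (eB G X Y +_) (card-product X′ Y′) ⟩
      eB G X Y + sumFin (λ x → sumFin (λ y → 𝟙 (X′ x ∧ Y′ y)))
        ≡⟨ sum₂-+ (λ x y → 𝟙 (X x ∧ Y y ∧ adj G x y)) (λ x y → 𝟙 (X′ x ∧ Y′ y)) ⟨
      sumFin (λ x → sumFin (λ y → 𝟙 (X x ∧ Y y ∧ adj G x y) + 𝟙 (X′ x ∧ Y′ y)))
        ≤⟨ sum-mono (λ x → sum-mono (λ y → point (X′ x) (X x) (Y′ y) (Y y) (adj G x y) (sX x) (sY y))) ⟩
      sumFin (λ x → sumFin (λ y → 𝟙 (X′ x ∧ Y′ y ∧ adj G x y) + 𝟙 (X x ∧ Y y)))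
        ≡⟨ sum₂-+ (λ x y → 𝟙 (X′ x ∧ Y′ y ∧ adj G x y)) (λ x y → 𝟙 (X x ∧ Y y)) ⟩
      eB G X′ Y′ + sumFin (λ x → sumFin (λ y → 𝟙 (X x ∧ Y y)))
        ≡⟨ cong (eB G X′ Y′ +_) (card-product X Y) ⟨
      eB G X′ Y′ + card X * card Y ∎
    where
    open ≤-Reasoning
    sum₂-+ : ∀ {m n} (f g : Fin m → Fin n → ℕ) →
      sumFin (λ x → sumFin (λ y → f x y + g x y)) ≡ sumFin (λ x → sumFin (f x)) + sumFin (λ x → sumFin (g x))
    sum₂-+ f g = trans (sum-cong (λ x → sum-+ (f x) (g x))) (sum-+ (λ x → sumFin (f x)) (λ x → sumFin (g x)))
    point : ∀ p′ p q′ q a → (p′ ≡ true → p ≡ true) → (q′ ≡ true → q ≡ true) →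
      𝟙 (p ∧ q ∧ a) + 𝟙 (p′ ∧ q′) ≤ 𝟙 (p′ ∧ q′ ∧ a) + 𝟙 (p ∧ q)
    point true  p true  q a     ip iq rewrite ip refl | iq refl = ≤-refl
    point true  p false q true  ip iq rewrite ip refl = ≤-reflexive (trans (+-identityʳ (𝟙 (q ∧ true)))
        (cong 𝟙 (∧-idʳ q)))
      where
      ∧-idʳ : ∀ q → q ∧ true ≡ q
      ∧-idʳ true = refl
      ∧-idʳ false = refl
    point true  p false q false ip iq = ≤-trans
        (≤-reflexive (trans (+-identityʳ (𝟙 (p ∧ q ∧ false))) (zeros p q))) z≤n
      where
      zeros : ∀ p q → 𝟙 (p ∧ q ∧ false) ≡ 0
      zeros true true = refl
      zeros true false = refl
      zeros false q = refl
    point false p q′ q a ip iq = ≤-trans (≤-reflexive (+-identityʳ (𝟙 (p ∧ q ∧ a))))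
        (𝟙-mono {p ∧ q ∧ a} {p ∧ q} (λ h →
      ∧-true {p} (∧-trueˡ {p} h) (∧-trueˡ {q} (∧-trueʳ {p} h))))

  excess≤ : ∀ M N s a v → v ≡ s + a → 16 * M * N * v ≤ 16 * M * N * s + s → 16 * M * N * a ≤ s
  excess≤ M N s a v v≡ le = +-cancelˡ-≤ (16 * M * N * s) _ _
    (≤-trans (≤-reflexive (trans (≡.sym (*-distribˡ-+ (16 * M * N) s a)) (cong (16 * M * N *_) (≡.sym v≡)))) le)

  -- A set that holds a `1/M` share of an enlarged part keeps a `1/(2M)` share of the core, because
  -- the excess is tiny. This is why regularity of cores is tested with `2 * M`.
  core-large : ∀ M N s a x x′ → 1 ≤ N → 16 * M * N * a ≤ s → s + a ≤ M * x → x ≤ x′ + a → s ≤ 2 * M * x′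
  core-large M N s a x x′ N≥1 small big le = +-cancelʳ-≤ s s (2 * M * x′) (begin
      s + s                        ≤⟨ +-mono-≤ s≤ s≤ ⟩
      M * x + M * x                ≤⟨ +-mono-≤ (*-monoʳ-≤ M le) (*-monoʳ-≤ M le) ⟩
      M * (x′ + a) + M * (x′ + a)  ≡⟨ r₁ M x′ a ⟩
      2 * M * x′ + 2 * M * 1 * a   ≤⟨ +-monoʳ-≤ (2 * M * x′)
          (≤-trans (*-monoˡ-≤ a (*-mono-≤ (*-monoˡ-≤ M (s≤s (s≤s (z≤n {14})))) N≥1)) small) ⟩
      2 * M * x′ + s ∎)
    where
    open ≤-Reasoning
    s≤ : s ≤ M * x
    s≤ = ≤-trans (m≤m+n s a) big
    r₁ : ∀ M x a → M * (x + a) + M * (x + a) ≡ 2 * M * x + 2 * M * 1 * a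
    r₁ = ℕR.solve-∀

  excess-relative : ∀ M N s a x → 1 ≤ M → 16 * M * N * a ≤ s → s + a ≤ M * x → 2 * N * a ≤ x
  excess-relative M N s a x M≥1 small big = *-cancelˡ-≤ M {{>-nonZero M≥1}} (begin
      M * (2 * N * a)       ≡⟨ r₁ M N a ⟩
      2 * M * N * a         ≤⟨ *-monoˡ-≤ a (*-monoˡ-≤ N (*-monoˡ-≤ M (s≤s (s≤s (z≤n {14}))))) ⟩
      16 * M * N * a        ≤⟨ small ⟩
      s                     ≤⟨ ≤-trans (m≤m+n s a) big ⟩
      M * x ∎)
    where
    open ≤-Reasoning
    r₁ : ∀ M N a → M * (2 * N * a) ≡ 2 * M * N * a
    r₁ = ℕR.solve-∀

  -- Each factor loses at most a `1/(2N)` share, so at most a `1/N` share of the rectangle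
  -- disappears.
  product-defect : ∀ N x x′ y y′ a b → x ≤ x′ + a → y ≤ y′ + b → x′ ≤ x → 2 * N * a ≤ x → 2 * N * b ≤ y →
    N * (x * y) ≤ N * (x′ * y′) + x * y
  product-defect N x x′ y y′ a b x≤ y≤ x′≤x a≤ b≤ = *-cancelˡ-≤ 2 (begin
      2 * (N * (x * y))                                      ≤⟨ *-monoʳ-≤ 2 (*-monoʳ-≤ N (*-monoˡ-≤ y x≤)) ⟩
      2 * (N * ((x′ + a) * y))                               ≡⟨ r₁ N x′ a y ⟩
      2 * (N * (x′ * y)) + 2 * N * a * y
          ≤⟨ +-mono-≤ (*-monoʳ-≤ 2 (*-monoʳ-≤ N (*-monoʳ-≤ x′ y≤))) (*-monoˡ-≤ y a≤) ⟩
      2 * (N * (x′ * (y′ + b))) + x * y                      ≡⟨ r₂ N x′ y′ b (x * y) ⟩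
      2 * (N * (x′ * y′)) + (x′ * (2 * N * b) + x * y)       ≤⟨ +-monoʳ-≤ (2 * (N * (x′ * y′)))
          (+-monoˡ-≤ (x * y) (*-mono-≤ x′≤x b≤)) ⟩
      2 * (N * (x′ * y′)) + (x * y + x * y)                  ≡⟨ r₃ (N * (x′ * y′)) (x * y) ⟩
      2 * (N * (x′ * y′) + x * y) ∎)
    where
    open ≤-Reasoning
    r₁ : ∀ N x a y → 2 * (N * ((x + a) * y)) ≡ 2 * (N * (x * y)) + 2 * N * a * y
    r₁ = ℕR.solve-∀
    r₂ : ∀ N x y b z → 2 * (N * (x * (y + b))) + z ≡ 2 * (N * (x * y)) + (x * (2 * N * b) + z)
    r₂ = ℕR.solve-∀
    r₃ : ∀ u z → 2 * u + (z + z) ≡ 2 * (u + z)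
    r₃ = ℕR.solve-∀

  2*nC2 : ∀ n → 2 * (suc n C 2) ≡ suc n * n
  2*nC2 zero    = refl
  2*nC2 (suc n) = trans (cong (2 *_) (≡.sym (nCk+nC[k+1]≡[n+1]C[k+1] (suc n) 1)))
    (trans (*-distribˡ-+ 2 (suc n C 1) (suc n C 2)) (trans (cong₂ (λ u w → 2 * u + w) (nC1≡n (suc n)) (2*nC2 n))
        (r n)))
    where
    r : ∀ n → 2 * suc n + suc n * n ≡ suc (suc n) * suc n
    r = ℕR.solve-∀

  eIn≤eB : ∀ {n} (G : Graph n) (U : Subset n) → eIn G U ≤ eB G (lookup U) (lookup U)
  eIn≤eB G U = sum-mono (λ x → sum-mono (λ y →
    𝟙-mono {(toℕ x <ᵇ toℕ y) ∧ lookup U x ∧ lookup U y ∧ adj G x y} (∧-trueʳ {toℕ x <ᵇ toℕ y})))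

  -- The constants 8 and 16 meet here: `8 * M * e₀` is at most `s * s`, and the pairs added by the
  -- enlargement, times `8 * M`, are at most `v * v`. Together this is at most `2 * (v * v)`, which
  -- is at most `4 * (v * w)`, that is `8 * (v C 2)`, once `v` is at least 2.
  sparse-extends : ∀ M N s a v e e₀ → 1 ≤ N → 2 ≤ s → v ≡ s + a → 16 * M * N * a ≤ s →
    8 * M * e₀ ≤ s * s → e + s * s ≤ e₀ + v * v → M * e ≤ v C 2
  sparse-extends M N s a zero e e₀ N≥1 s≥2 v≡ _ _ _ with () ← ≤-trans s≥2
      (≤-trans (m≤m+n s a) (≤-reflexive (≡.sym v≡)))
  sparse-extends M N s a v@(suc w) e e₀ N≥1 s≥2 v≡ small sp le = *-cancelˡ-≤ 8
      (+-cancelʳ-≤ (8 * M * (s * s)) _ _ (begin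
      8 * (M * e) + 8 * M * (s * s)        ≡⟨ r₁ M e (s * s) ⟩
      8 * M * (e + s * s)                  ≤⟨ *-monoʳ-≤ (8 * M) le ⟩
      8 * M * (e₀ + v * v)                 ≡⟨ *-distribˡ-+ (8 * M) e₀ (v * v) ⟩
      8 * M * e₀ + 8 * M * (v * v)         ≤⟨ +-mono-≤ (≤-trans sp (*-mono-≤ s≤v s≤v)) vv≤ ⟩
      v * v + (8 * M * (s * s) + v * v)    ≡⟨ r₂ (v * v) (8 * M * (s * s)) ⟩
      2 * (v * v) + 8 * M * (s * s)        ≤⟨ +-monoˡ-≤ (8 * M * (s * s)) 2vv≤ ⟩
      4 * (v * w) + 8 * M * (s * s)        ≡⟨ cong (λ z → 4 * z + 8 * M * (s * s)) (2*nC2 w) ⟨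
      4 * (2 * (v C 2)) + 8 * M * (s * s)  ≡⟨ cong (_+ 8 * M * (s * s)) (≡.sym (*-assoc 4 2 (v C 2))) ⟩
      8 * (v C 2) + 8 * M * (s * s) ∎))
    where
    open ≤-Reasoning
    r₁ : ∀ M e x → 8 * (M * e) + 8 * M * x ≡ 8 * M * (e + x)
    r₁ = ℕR.solve-∀
    r₂ : ∀ x y → x + (y + x) ≡ 2 * x + y
    r₂ = ℕR.solve-∀
    s≤v : s ≤ v
    s≤v = ≤-trans (m≤m+n s a) (≤-reflexive (≡.sym v≡))
    16Ma : 16 * M * a ≤ s
    16Ma = ≤-trans (≤-reflexive (cong (_* a) (≡.sym (*-identityʳ (16 * M)))))
        (≤-trans (*-monoˡ-≤ a (*-monoʳ-≤ (16 * M) N≥1)) small)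
    vv≤ : 8 * M * (v * v) ≤ 8 * M * (s * s) + v * v
    vv≤ = begin
      8 * M * (v * v)                                      ≡⟨ cong (λ z → 8 * M * (z * z)) v≡ ⟩
      8 * M * ((s + a) * (s + a))                          ≡⟨ r₃ M s a ⟩
      8 * M * (s * s) + (16 * M * a * s + 8 * M * a * a)   ≤⟨ +-monoʳ-≤ (8 * M * (s * s))
          (+-monoʳ-≤ (16 * M * a * s)
          (*-monoˡ-≤ a (*-monoˡ-≤ a (*-monoˡ-≤ M (s≤s (s≤s (s≤s (s≤s (s≤s (s≤s (s≤s (s≤s (z≤n {8})))))))))))) ) ⟩
      8 * M * (s * s) + (16 * M * a * s + 16 * M * a * a)  ≡⟨ cong (8 * M * (s * s) +_)
          (*-distribˡ-+ (16 * M * a) s a) ⟨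
      8 * M * (s * s) + 16 * M * a * (s + a)               ≤⟨ +-monoʳ-≤ (8 * M * (s * s))
          (*-mono-≤ (≤-trans 16Ma s≤v) (≤-reflexive (≡.sym v≡))) ⟩
      8 * M * (s * s) + v * v ∎
      where
      r₃ : ∀ M s a → 8 * M * ((s + a) * (s + a)) ≡ 8 * M * (s * s) + (16 * M * a * s + 8 * M * a * a)
      r₃ = ℕR.solve-∀
    2vv≤ : 2 * (v * v) ≤ 4 * (v * w)
    2vv≤ = begin
      2 * (v * suc w)            ≡⟨ r₄ v w ⟩
      2 * (v * w) + 2 * (v * 1)  ≤⟨ +-monoʳ-≤ (2 * (v * w)) (*-monoʳ-≤ 2 (*-monoʳ-≤ v (≤-pred (≤-trans s≥2 s≤v)))) ⟩
      2 * (v * w) + 2 * (v * w)  ≡⟨ r₅ (v * w) ⟩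
      4 * (v * w) ∎
      where
      r₄ : ∀ v w → 2 * (v * suc w) ≡ 2 * (v * w) + 2 * (v * 1)
      r₄ = ℕR.solve-∀
      r₅ : ∀ x → 2 * x + 2 * x ≡ 4 * x
      r₅ = ℕR.solve-∀

open Counting

-- Integer sums and double sums.

module Energy where

  open import Data.Nat.Base as ℕ using (ℕ; zero; suc; z≤n; s≤s; _!; >-nonZero; _^_)
  import Data.Nat.Properties as ℕₚ
  open import Data.Integer.Base using (ℤ; +_; -[1+_]; 0ℤ; 1ℤ; -1ℤ; _+_; _*_; _-_; -_; ∣_∣; _≤_; +≤+; -≤+)
  import Data.Integer.Properties as ℤₚ

  ∑ : ∀ {n} → (Fin n → ℤ) → ℤ
  ∑ {zero}  f = 0ℤ
  ∑ {suc n} f = f zero + ∑ (λ i → f (suc i))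

  ∑-cong : ∀ {n} {f g : Fin n → ℤ} → (∀ i → f i ≡ g i) → ∑ f ≡ ∑ g
  ∑-cong {zero}  p = refl
  ∑-cong {suc n} p = cong₂ _+_ (p zero) (∑-cong (λ i → p (suc i)))

  ∑-mono : ∀ {n} {f g : Fin n → ℤ} → (∀ i → f i ≤ g i) → ∑ f ≤ ∑ g
  ∑-mono {zero}  p = ℤₚ.≤-refl
  ∑-mono {suc n} p = ℤₚ.+-mono-≤ (p zero) (∑-mono (λ i → p (suc i)))

  ∑-zero : ∀ n → ∑ {n} (λ _ → 0ℤ) ≡ 0ℤ
  ∑-zero zero    = refl
  ∑-zero (suc n) = trans (ℤₚ.+-identityˡ _) (∑-zero n)

  ∑-+ : ∀ {n} (f g : Fin n → ℤ) → ∑ (λ i → f i + g i) ≡ ∑ f + ∑ g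
  ∑-+ {zero}  f g = refl
  ∑-+ {suc n} f g
    rewrite ∑-+ (λ i → f (suc i)) (λ i → g (suc i)) = interchange (f zero) (g zero) _ _
    where
    interchange : ∀ a b c d → (a + b) + (c + d) ≡ (a + c) + (b + d)
    interchange = ℤR.solve-∀

  ∑-*ˡ : ∀ {n} c (f : Fin n → ℤ) → ∑ (λ i → c * f i) ≡ c * ∑ f
  ∑-*ˡ {zero}  c f = ≡.sym (ℤₚ.*-zeroʳ c)
  ∑-*ˡ {suc n} c f rewrite ∑-*ˡ c (λ i → f (suc i)) = ≡.sym (ℤₚ.*-distribˡ-+ c (f zero) _)

  ∑-*ʳ : ∀ {n} c (f : Fin n → ℤ) → ∑ (λ i → f i * c) ≡ ∑ f * c
  ∑-*ʳ c f = trans (∑-cong (λ i → ℤₚ.*-comm (f i) c)) (trans (∑-*ˡ c f) (ℤₚ.*-comm c (∑ f)))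

  ∑-swap : ∀ {m n} (f : Fin m → Fin n → ℤ) → ∑ (λ i → ∑ (f i)) ≡ ∑ (λ j → ∑ (λ i → f i j))
  ∑-swap {zero} {n} f = ≡.sym (∑-zero n)
  ∑-swap {suc m} f rewrite ∑-swap (λ i → f (suc i)) = ≡.sym (∑-+ (f zero) (λ j → ∑ (λ i → f (suc i) j)))

  ∑-pos : ∀ {n} (f : Fin n → ℕ) → + sumFin f ≡ ∑ (λ i → + f i)
  ∑-pos {zero}  f = refl
  ∑-pos {suc n} f = trans (ℤₚ.pos-+ (f zero) _) (cong (λ z → (+ f zero) + z) (∑-pos (λ i → f (suc i))))

  ∬ : ∀ {m n} → (Fin m → Fin n → ℤ) → ℤ
  ∬ F = ∑ (λ x → ∑ (F x))

  ∬-cong : ∀ {m n} {F H : Fin m → Fin n → ℤ} → (∀ x y → F x y ≡ H x y) → ∬ F ≡ ∬ H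
  ∬-cong p = ∑-cong (λ x → ∑-cong (p x))

  ∬-mono : ∀ {m n} {F H : Fin m → Fin n → ℤ} → (∀ x y → F x y ≤ H x y) → ∬ F ≤ ∬ H
  ∬-mono p = ∑-mono (λ x → ∑-mono (p x))

  ∬-+ : ∀ {m n} (F H : Fin m → Fin n → ℤ) → ∬ (λ x y → F x y + H x y) ≡ ∬ F + ∬ H
  ∬-+ F H = trans (∑-cong (λ x → ∑-+ (F x) (H x))) (∑-+ (λ x → ∑ (F x)) (λ x → ∑ (H x)))

  ∬-*ˡ : ∀ {m n} c (F : Fin m → Fin n → ℤ) → ∬ (λ x y → c * F x y) ≡ c * ∬ F
  ∬-*ˡ c F = trans (∑-cong (λ x → ∑-*ˡ c (F x))) (∑-*ˡ c (λ x → ∑ (F x)))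

  ∬-exchange : ∀ {m n} (H : Fin n → Fin n → Fin m → Fin m → ℤ) →
    ∬ (λ x y → ∬ (H x y)) ≡ ∬ (λ i j → ∬ (λ x y → H x y i j))
  ∬-exchange H = begin
      ∑ (λ x → ∑ (λ y → ∑ (λ i → ∑ (λ j → H x y i j))))
        ≡⟨ ∑-cong (λ x → ∑-swap (λ y i → ∑ (λ j → H x y i j))) ⟩
      ∑ (λ x → ∑ (λ i → ∑ (λ y → ∑ (λ j → H x y i j))))
        ≡⟨ ∑-cong (λ x → ∑-cong (λ i → ∑-swap (λ y j → H x y i j))) ⟩
      ∑ (λ x → ∑ (λ i → ∑ (λ j → ∑ (λ y → H x y i j))))
        ≡⟨ ∑-swap (λ x i → ∑ (λ j → ∑ (λ y → H x y i j))) ⟩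
      ∑ (λ i → ∑ (λ x → ∑ (λ j → ∑ (λ y → H x y i j))))
        ≡⟨ ∑-cong (λ i → ∑-swap (λ x j → ∑ (λ y → H x y i j))) ⟩
      ∑ (λ i → ∑ (λ j → ∑ (λ x → ∑ (λ y → H x y i j)))) ∎
    where open ≡.≡-Reasoning

  ι : Bool → ℤ
  ι b = + 𝟙 b

  ι-idem : ∀ b → ι b * ι b ≡ ι b
  ι-idem true  = refl
  ι-idem false = refl

  ∬-rect : ∀ {n} (X Y : VSet n) → ∬ (λ x y → ι (X x) * ι (Y y)) ≡ + (card X ℕ.* card Y)
  ∬-rect X Y = begin
      ∑ (λ x → ∑ (λ y → ι (X x) * ι (Y y)))       ≡⟨ ∑-cong (λ x → ∑-*ˡ (ι (X x)) (λ y → ι (Y y))) ⟩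
      ∑ (λ x → ι (X x) * ∑ (λ y → ι (Y y)))       ≡⟨ ∑-*ʳ (∑ (λ y → ι (Y y))) (λ x → ι (X x)) ⟩
      ∑ (λ x → ι (X x)) * ∑ (λ y → ι (Y y))       ≡⟨ cong₂ _*_ (∑-pos (λ x → 𝟙 (X x))) (∑-pos (λ y → 𝟙 (Y y))) ⟨
      + card X * + card Y                         ≡⟨ ℤₚ.pos-* (card X) (card Y) ⟨
      + (card X ℕ.* card Y) ∎
    where open ≡.≡-Reasoning

  -- Pythagoras; it will be applied pointwise, to the values of boxes with disjoint supports.
  sq-orthogonal : ∀ {n} (b : Fin n → ℤ) → (∀ i j → ¬ i ≡ j → b i * b j ≡ 0ℤ) → ∑ b * ∑ b ≡ ∑ (λ i → b i * b i)
  sq-orthogonal {zero}  b orth = refl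
  sq-orthogonal {suc n} b orth = begin
      (b zero + t) * (b zero + t)                     ≡⟨ square (b zero) t ⟩
      b zero * b zero + + 2 * (b zero * t) + t * t    ≡⟨ cong₂ (λ u v → b zero * b zero + + 2 * u + v) cross
                                                          (sq-orthogonal (λ i → b (suc i))
                                                              (λ i j ne → orth (suc i) (suc j)
                                                              (λ { refl → ne refl }))) ⟩
      b zero * b zero + + 2 * 0ℤ + ∑ (λ i → b (suc i) * b (suc i))
                                                      ≡⟨ cong (_+ ∑ (λ i → b (suc i) * b (suc i)))
                                                          (ℤₚ.+-identityʳ (b zero * b zero)) ⟩
      b zero * b zero + ∑ (λ i → b (suc i) * b (suc i)) ∎
    where
    open ≡.≡-Reasoning
    t = ∑ (λ i → b (suc i))
    square : ∀ a t → (a + t) * (a + t) ≡ a * a + + 2 * (a * t) + t * t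
    square = ℤR.solve-∀
    cross : b zero * t ≡ 0ℤ
    cross = trans (≡.sym (∑-*ˡ (b zero) (λ i → b (suc i)))) (trans (∑-cong (λ i → orth zero (suc i) (λ ())))
        (∑-zero n))

  -- Energy, boxes and irregular pairs.

  energy : ∀ {n} → (Fin n → Fin n → ℤ) → ℤ
  energy F = ∬ (λ x y → F x y * F x y)

  Σ-box : ∀ {q n} → (Fin q → Fin q → Fin n → Fin n → ℤ) → Fin n → Fin n → ℤ
  Σ-box b x y = ∬ (λ i j → b i j x y)

  -- Products of different boxes vanish pointwise, so the energy changes by the sum of what each box
  -- would change alone. All irregular pairs can therefore be corrected at the same time.
  energy-update : ∀ {q n} (F : Fin n → Fin n → ℤ) (b : Fin q → Fin q → Fin n → Fin n → ℤ) →
    (∀ i j i′ j′ x y → ¬ (i ≡ i′ × j ≡ j′) → b i j x y * b i′ j′ x y ≡ 0ℤ) →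
    energy (λ x y → F x y - Σ-box b x y) ≡
    energy F + ∬ (λ i j → ∬ (λ x y → b i j x y * b i j x y - + 2 * (F x y * b i j x y)))
  energy-update {q} F b orth = begin
      energy (λ x y → F x y - Σ-box b x y)
        ≡⟨ ∬-cong (λ x y → square (F x y) (Σ-box b x y)) ⟩
      ∬ (λ x y → F x y * F x y + (Σ-box b x y * Σ-box b x y + (- (+ 2 * F x y)) * Σ-box b x y))
        ≡⟨ ∬-cong (λ x y → cong (λ z → F x y * F x y + z) (point x y)) ⟩
      ∬ (λ x y → F x y * F x y + ∬ (λ i j → b i j x y * b i j x y - + 2 * (F x y * b i j x y)))
        ≡⟨ ∬-+ (λ x y → F x y * F x y) (λ x y → ∬ (λ i j → b i j x y * b i j x y - + 2 * (F x y * b i j x y))) ⟩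
      energy F + ∬ (λ x y → ∬ (λ i j → b i j x y * b i j x y - + 2 * (F x y * b i j x y)))
        ≡⟨ cong (λ z → energy F + z) (∬-exchange (λ x y i j → b i j x y * b i j x y - + 2 * (F x y * b i j x y))) ⟩
      energy F + ∬ (λ i j → ∬ (λ x y → b i j x y * b i j x y - + 2 * (F x y * b i j x y))) ∎
    where
    open ≡.≡-Reasoning
    square : ∀ f b → (f - b) * (f - b) ≡ f * f + (b * b + (- (+ 2 * f)) * b)
    square = ℤR.solve-∀
    point : ∀ x y → Σ-box b x y * Σ-box b x y + (- (+ 2 * F x y)) * Σ-box b x y
                  ≡ ∬ (λ i j → b i j x y * b i j x y - + 2 * (F x y * b i j x y))
    point x y = begin
      Σ-box b x y * Σ-box b x y + c * Σ-box b x y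
        ≡⟨ cong₂ _+_ squares (≡.sym (∬-*ˡ c (λ i j → b i j x y))) ⟩
      ∬ (λ i j → b i j x y * b i j x y) + ∬ (λ i j → c * b i j x y)
        ≡⟨ ∬-+ (λ i j → b i j x y * b i j x y) (λ i j → c * b i j x y) ⟨
      ∬ (λ i j → b i j x y * b i j x y + c * b i j x y)
        ≡⟨ ∬-cong (λ i j → cong (λ z → b i j x y * b i j x y + z) (pull (F x y) (b i j x y))) ⟩
      ∬ (λ i j → b i j x y * b i j x y - + 2 * (F x y * b i j x y)) ∎
      where
      c = - (+ 2 * F x y)
      pull : ∀ f b → (- (+ 2 * f)) * b ≡ - (+ 2 * (f * b))
      pull = ℤR.solve-∀
      row : Fin q → ℤ
      row i = ∑ (λ j → b i j x y)
      rows : ∀ i i′ → ¬ i ≡ i′ → row i * row i′ ≡ 0ℤ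
      rows i i′ ne = begin
        row i * row i′                       ≡⟨ ∑-*ʳ (row i′) (λ j → b i j x y) ⟨
        ∑ (λ j → b i j x y * row i′)         ≡⟨ ∑-cong (λ j → ≡.sym (∑-*ˡ (b i j x y) (λ j′ → b i′ j′ x y))) ⟩
        ∬ (λ j j′ → b i j x y * b i′ j′ x y) ≡⟨ ∬-cong (λ j j′ → orth i j i′ j′ x y (λ p → ne (proj₁ p))) ⟩
        ∬ {q} {q} (λ _ _ → 0ℤ)               ≡⟨ trans (∑-cong {q} (λ _ → ∑-zero q)) (∑-zero q) ⟩
        0ℤ ∎
      squares : Σ-box b x y * Σ-box b x y ≡ ∬ (λ i j → b i j x y * b i j x y)
      -- Orthogonality is used between different rows and then inside each row.
      squares = trans (sq-orthogonal row rows)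
        (∑-cong (λ i → sq-orthogonal (λ j → b i j x y) (λ j j′ ne → orth i j i j′ x y (λ p → ne (proj₂ p)))))

  box : ∀ {n} → ℤ → VSet n → VSet n → Fin n → Fin n → ℤ
  box δ X Y x y = δ * (ι (X x) * ι (Y y))

  boxSum : ∀ {n} → (Fin n → Fin n → ℤ) → VSet n → VSet n → ℤ
  boxSum F X Y = ∬ (λ x y → ι (X x) * ι (Y y) * F x y)

  ∬-box : ∀ {n} (F : Fin n → Fin n → ℤ) δ X Y →
    ∬ (λ x y → box δ X Y x y * box δ X Y x y - + 2 * (F x y * box δ X Y x y))
    ≡ δ * δ * + (card X ℕ.* card Y) - + 2 * δ * boxSum F X Y
  ∬-box F δ X Y = begin
      ∬ (λ x y → box δ X Y x y * box δ X Y x y - + 2 * (F x y * box δ X Y x y))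
        ≡⟨ ∬-cong (λ x y → trans (expand δ (ι (X x)) (ι (Y y)) (F x y))
             (cong₂ (λ u v → δ * δ * (u * v) + - (+ 2 * δ) * (ι (X x) * ι (Y y) * F x y)) (ι-idem (X x))
                 (ι-idem (Y y)))) ⟩
      ∬ (λ x y → δ * δ * (ι (X x) * ι (Y y)) + - (+ 2 * δ) * (ι (X x) * ι (Y y) * F x y))
        ≡⟨ ∬-+ (λ x y → δ * δ * (ι (X x) * ι (Y y))) (λ x y → - (+ 2 * δ) * (ι (X x) * ι (Y y) * F x y)) ⟩
      ∬ (λ x y → δ * δ * (ι (X x) * ι (Y y))) + ∬ (λ x y → - (+ 2 * δ) * (ι (X x) * ι (Y y) * F x y))
        ≡⟨ cong₂ _+_ (trans (∬-*ˡ (δ * δ) (λ x y → ι (X x) * ι (Y y))) (cong (δ * δ *_) (∬-rect X Y)))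
                     (trans (∬-*ˡ (- (+ 2 * δ)) (λ x y → ι (X x) * ι (Y y) * F x y))
                         (≡.sym (ℤₚ.neg-distribˡ-* (+ 2 * δ) (boxSum F X Y)))) ⟩
      δ * δ * + (card X ℕ.* card Y) - + 2 * δ * boxSum F X Y ∎
    where
    open ≡.≡-Reasoning
    expand : ∀ δ u v f → (δ * (u * v)) * (δ * (u * v)) - + 2 * (f * (δ * (u * v)))
                       ≡ δ * δ * ((u * u) * (v * v)) + - (+ 2 * δ) * (u * v * f)
    expand = ℤR.solve-∀

  -- On `X × Y` the average of `F` exceeds one in absolute value, where `X` and `Y` have at least
  -- `s / m` elements. The witnesses are of type `Subset` because subsets can be searched
  -- exhaustively; the set of bad pairs thereby becomes a Boolean function.
  Irregular : ∀ {n} → (Fin n → Fin n → ℤ) → ℕ → ℕ → VSet n → VSet n → Set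
  Irregular {n} F m s A B = Σ (Subset n) λ X → Σ (Subset n) λ Y →
    lookup X ⊑ A × lookup Y ⊑ B × s ℕ.≤ m ℕ.* card (lookup X) × s ℕ.≤ m ℕ.* card (lookup Y) ×
    card (lookup X) ℕ.* card (lookup Y) ℕ.< ∣ boxSum F (lookup X) (lookup Y) ∣

  _⊑?_ : ∀ {n} (U W : VSet n) → Dec (U ⊑ W)
  U ⊑? W = all? (λ x → (U x ≟ᵇ true) →-dec (W x ≟ᵇ true))

  irregular? : ∀ {n} (F : Fin n → Fin n → ℤ) m s A B → Dec (Irregular F m s A B)
  irregular? F m s A B = anySubset? λ X → anySubset? λ Y →
    (lookup X ⊑? A) ×-dec ((lookup Y ⊑? B) ×-dec ((s ℕₚ.≤? m ℕ.* card (lookup X)) ×-dec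
    ((s ℕₚ.≤? m ℕ.* card (lookup Y)) ×-dec
     (card (lookup X) ℕ.* card (lookup Y) ℕₚ.<? ∣ boxSum F (lookup X) (lookup Y) ∣))))

  -- Every pair receives a box, the zero box if it is regular, so that the gains can be summed
  -- uniformly. The factor `m * m` clears the denominator in the bound `s² / m²` on the size of a
  -- witness rectangle.
  record Correction {n} (F : Fin n → Fin n → ℤ) (m s : ℕ) (A B : VSet n) (bad : Bool) : Set where
    field
      δ    : ℤ
      X Y  : VSet n
      X⊑A  : X ⊑ A
      Y⊑B  : Y ⊑ B
      gain : + (m ℕ.* m) * ∬ (λ x y → box δ X Y x y * box δ X Y x y - + 2 * (F x y * box δ X Y x y))
             ≤ - + (𝟙 bad ℕ.* (s ℕ.* s))

  sign-witness : ∀ S → Σ ℤ λ δ → δ * δ ≡ 1ℤ × δ * S ≡ + ∣ S ∣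
  sign-witness (+ k)    = 1ℤ , refl , ℤₚ.*-identityˡ (+ k)
  sign-witness -[1+ k ] = -1ℤ , refl , ℤₚ.-1*i≡-i -[1+ k ]

  correction : ∀ {n} (F : Fin n → Fin n → ℤ) m s A B (d : Dec (Irregular F m s A B)) →
    Correction F m s A B (isYes d)
  correction F m s A B (no _) = record
    { δ = 0ℤ ; X = λ _ → false ; Y = λ _ → false ; X⊑A = λ _ () ; Y⊑B = λ _ ()
    ; gain = ℤₚ.≤-reflexive (trans (cong ((+ (m ℕ.* m)) *_) (∬-box F 0ℤ (λ _ → false) (λ _ → false)))
        (ℤₚ.*-zeroʳ (+ (m ℕ.* m)))) }
  correction F m s A B (yes (X , Y , X⊑ , Y⊑ , bigX , bigY , big)) = record
    { δ = δ ; X = lookup X ; Y = lookup Y ; X⊑A = X⊑ ; Y⊑B = Y⊑ ; gain = gain }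
    where
    open ℤₚ.≤-Reasoning
    S = boxSum F (lookup X) (lookup Y)
    cX = card (lookup X)
    cY = card (lookup Y)
    P = cX ℕ.* cY
    δ = proj₁ (sign-witness S)
    δδ = proj₁ (proj₂ (sign-witness S))
    δS = proj₂ (proj₂ (sign-witness S))
    assoc : ∀ δ S → + 2 * δ * S ≡ + 2 * (δ * S)
    assoc = ℤR.solve-∀
    -- With `δ` the sign of the box sum `S`, the change is `P` minus twice the absolute value of
    -- `S`, which exceeds `P`.
    inner : δ * δ * + P - + 2 * δ * S ≤ - + P
    inner = begin
      δ * δ * + P - + 2 * δ * S        ≡⟨ cong₂ (λ u v → u * + P - v) δδ (trans (assoc δ S) (cong ((+ 2) *_) δS)) ⟩
      1ℤ * + P - + 2 * + ∣ S ∣         ≤⟨ ℤₚ.+-monoʳ-≤ (1ℤ * + P)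
          (ℤₚ.neg-mono-≤ (ℤₚ.*-monoˡ-≤-nonNeg (+ 2) (+≤+ (ℕₚ.<⇒≤ big)))) ⟩
      1ℤ * + P - + 2 * + P             ≡⟨ simp (+ P) ⟩
      - + P ∎
      where
      simp : ∀ p → 1ℤ * p - + 2 * p ≡ - p
      simp = ℤR.solve-∀
    nat : 1 ℕ.* (s ℕ.* s) ℕ.≤ m ℕ.* m ℕ.* P
    nat = ℕₚ.≤-trans (ℕₚ.≤-reflexive (ℕₚ.*-identityˡ (s ℕ.* s))) (ℕₚ.≤-trans (ℕₚ.*-mono-≤ bigX bigY)
          (ℕₚ.≤-reflexive (ℕₚ.[m*n]*[o*p]≡[m*o]*[n*p] m cX m cY)))
    gain : + (m ℕ.* m) * ∬ (λ x y → box δ (lookup X) (lookup Y) x y * box δ (lookup X)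
        (lookup Y) x y - + 2 * (F x y * box δ (lookup X) (lookup Y) x y))
           ≤ - + (1 ℕ.* (s ℕ.* s))
    gain = begin
      + (m ℕ.* m) * ∬ (λ x y → box δ (lookup X) (lookup Y) x y * box δ (lookup X)
          (lookup Y) x y - + 2 * (F x y * box δ (lookup X) (lookup Y) x y))
        ≡⟨ cong ((+ (m ℕ.* m)) *_) (∬-box F δ (lookup X) (lookup Y)) ⟩
      + (m ℕ.* m) * (δ * δ * + P - + 2 * δ * S)
        ≤⟨ ℤₚ.*-monoˡ-≤-nonNeg (+ (m ℕ.* m)) inner ⟩
      + (m ℕ.* m) * - + P
        ≡⟨ ℤₚ.neg-distribʳ-* (+ (m ℕ.* m)) (+ P) ⟨
      - (+ (m ℕ.* m) * + P)
        ≡⟨ cong -_ (ℤₚ.pos-* (m ℕ.* m) P) ⟨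
      - + (m ℕ.* m ℕ.* P)
        ≤⟨ ℤₚ.neg-mono-≤ (+≤+ nat) ⟩
      - + (1 ℕ.* (s ℕ.* s)) ∎

  -- Refining the cores

  residual : ∀ {n} → Graph n → ℕ → (Fin n → Fin n → ℤ) → Fin n → Fin n → ℤ
  residual G N h x y = + N * ι (adj G x y) - h x y

  -- The constant value of h on C i × C j approximates N times the density of that pair.
  record Cores {n} (G : Graph n) (μ q s : ℕ) (h : Fin n → Fin n → ℤ) : Set where
    field
      C      : Fin q → VSet n
      size   : ∀ i → card (C i) ≡ s
      disj   : Disjoint C
      sparse : ∀ i → μ ℕ.* eB G (C i) (C i) ℕ.≤ s ℕ.* s
      const  : ∀ i j x x′ y y′ → C i x ≡ true → C i x′ ≡ true → C j y ≡ true → C j y′ ≡ true → h x y ≡ h x′ y′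

  -- The number of classes cut out by q cores and the witness sets X i j , Y i j of all pairs.
  tests : ℕ → ℕ
  tests q = 2 ^ q ℕ.* ((2 ^ q) ^ q ℕ.* (2 ^ q) ^ q)

  SparseFinder : ∀ {n} → Graph n → ℕ → ℕ → ℕ → Set
  SparseFinder {n} G μ ρ s = ∀ (W : VSet n) → ρ ℕ.* s ℕ.≤ card W → SparseIn G μ s W

  -- Pass to a piece that is homogeneous for all tests, then look for a sparse set inside it:
  -- heredity keeps the tests constant there, whereas sparsity would not survive a later cut.
  chunks : ∀ {n} (G : Graph n) μ ρ s → SparseFinder G μ ρ s → ∀ b (T : VSet n → Set) → Hereditary T → Splits b T →
    ∀ q (U₀ : VSet n) → q ℕ.* s ℕ.+ b ℕ.* ρ ℕ.* s ℕ.≤ card U₀ →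
    Σ (Fin q → VSet n) λ C → (∀ i → C i ⊑ U₀) × (∀ i → card (C i) ≡ s) ×
      (∀ i → T (C i) × μ ℕ.* eB G (C i) (C i) ℕ.≤ s ℕ.* s) × Disjoint C
  chunks G μ ρ s find b T her sp q U₀ big =
    greedy (λ S → T S × μ ℕ.* eB G S S ℕ.≤ s ℕ.* s) s (b ℕ.* ρ ℕ.* s) q U₀ choose big
    where
    choose : ∀ U → U ⊑ U₀ → b ℕ.* ρ ℕ.* s ℕ.≤ card U → _
    choose U _ le
      with W , W⊑U , leW , TW ← sp U (ρ ℕ.* s) (ℕₚ.≤-trans (ℕₚ.≤-reflexive (≡.sym (ℕₚ.*-assoc b ρ s))) le)
      with S , S⊑W , cardS , spS ← find W leW
      = S , (λ x p → W⊑U x (S⊑W x p)) , cardS , her W S S⊑W TW , spS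

  ∬-pos : ∀ {m n} (f : Fin m → Fin n → ℕ) → + sumFin (λ i → sumFin (f i)) ≡ ∬ (λ i j → + f i j)
  ∬-pos f = trans (∑-pos (λ i → sumFin (f i))) (∑-cong (λ i → ∑-pos (f i)))

  neg-∬ : ∀ {m n} (F : Fin m → Fin n → ℤ) → ∬ (λ i j → - F i j) ≡ - ∬ F
  neg-∬ F = trans (∬-cong (λ i j → ≡.sym (ℤₚ.-1*i≡-i (F i j)))) (trans (∬-*ˡ -1ℤ F) (ℤₚ.-1*i≡-i (∬ F)))

  bad : ∀ {n μ q s h} (G : Graph n) (N m : ℕ) → Cores G μ q s h → Fin q → Fin q → Bool
  bad {s = s} {h} G N m st i j = isYes (irregular? (residual G N h) m s (C i) (C j))
    where open Cores st

  -- A new core inside the union of the old ones and homogeneous for every `C i` lies in a single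
  -- old core; homogeneity for all `X i j` and `Y i j` makes every box constant on pairs of new
  -- cores. So `h′` is again constant on such pairs, while the energy bound depends on the boxes
  -- only.
  refine : ∀ {n} (G : Graph n) μ N m q s h (st : Cores G μ q s h) (bd : Fin q → Fin q → Bool) →
    (∀ i j → Correction (residual G N h) m s (Cores.C st i) (Cores.C st j) (bd i j)) → ∀ ρ s′ q′ →
        SparseFinder G μ ρ s′ →
    q′ ℕ.* s′ ℕ.+ tests q ℕ.* ρ ℕ.* s′ ℕ.≤ q ℕ.* s →
    Σ (Fin n → Fin n → ℤ) λ h′ → Cores G μ q′ s′ h′ ×
      + (m ℕ.* m) * energy (residual G N h′) ≤
      + (m ℕ.* m) * energy (residual G N h) - + (sumFin (λ i → countFin (bd i)) ℕ.* (s ℕ.* s))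
  refine {n} G μ N m q s h st bd corr ρ s′ q′ find big = h′ , st′ , energy≤
    where
    open Cores st
    F = residual G N h
    X Y : Fin q → Fin q → VSet n
    X i j = Correction.X (corr i j)
    Y i j = Correction.Y (corr i j)
    b : Fin q → Fin q → Fin n → Fin n → ℤ
    b i j = box (Correction.δ (corr i j)) (X i j) (Y i j)
    h′ : Fin n → Fin n → ℤ
    h′ x y = h x y + Σ-box b x y
    T : VSet n → Set
    T W = (∀ i → ConstOn (C i) W) × ((∀ i j → ConstOn (X i j) W) × (∀ i j → ConstOn (Y i j) W))
    herFam : ∀ {k} (p : Fin k → VSet n) → Hereditary (λ W → ∀ i → ConstOn (p i) W)
    herFam p W W′ sub c i = constOn-hereditary (p i) W W′ sub (c i)
    splitFam : ∀ {k} (p : Fin k → VSet n) → Splits (2 ^ k) (λ W → ∀ i → ConstOn (p i) W)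
    splitFam {k} p = splits-∀ {b = 2} k (λ i → ConstOn (p i)) (λ i → constOn-hereditary (p i))
        (λ i → splits-const (p i))
    herFam₂ : (p : Fin q → Fin q → VSet n) → Hereditary (λ W → ∀ i j → ConstOn (p i j) W)
    herFam₂ p W W′ sub c i = herFam (p i) W W′ sub (c i)
    splitFam₂ : (p : Fin q → Fin q → VSet n) → Splits ((2 ^ q) ^ q) (λ W → ∀ i j → ConstOn (p i j) W)
    splitFam₂ p = splits-∀ {b = 2 ^ q} q (λ i W → ∀ j → ConstOn (p i j) W) (λ i → herFam (p i)) (λ i → splitFam (p i))
    herT : Hereditary T
    herT W W′ sub (c , cX , cY) = herFam C W W′ sub c , herFam₂ X W W′ sub cX , herFam₂ Y W W′ sub cY
    splitT : Splits (tests q) T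
    splitT = splits-× {b = 2 ^ q} {(2 ^ q) ^ q ℕ.* (2 ^ q) ^ q} (herFam C) (splitFam C)
               (splits-× {b = (2 ^ q) ^ q} {(2 ^ q) ^ q} (herFam₂ X) (splitFam₂ X) (splitFam₂ Y))
    new = chunks G μ ρ s′ find (tests q) T herT splitT q′ (⋃ C) (ℕₚ.≤-trans big (card-⋃ C disj size))
    C′ = proj₁ new
    C′⊑ = proj₁ (proj₂ new)
    good = proj₁ (proj₂ (proj₂ (proj₂ new)))
    const′ : ∀ i j x x′ y y′ → C′ i x ≡ true → C′ i x′ ≡ true → C′ j y ≡ true → C′ j y′ ≡ true → h′ x y ≡ h′ x′ y′
    const′ i j x x′ y y′ px px′ py py′ = cong₂ _+_ old (∬-cong (λ k l →
        cong₂ (λ u v → Correction.δ (corr k l) * (ι u * ι v)) (cX k l x x′ px px′) (cY k l y y′ py py′)))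
      where
      cX = proj₁ (proj₂ (proj₁ (good i)))
      cY = proj₂ (proj₂ (proj₁ (good j)))
      old : h x y ≡ h x′ y′
      old with k , Ckx ← ⋃-elim C x (C′⊑ i x px) | l , Cly ← ⋃-elim C y (C′⊑ j y py)
        = const k l x x′ y y′ Ckx (trans (≡.sym (proj₁ (proj₁ (good i)) k x x′ px px′)) Ckx)
                              Cly (trans (≡.sym (proj₁ (proj₁ (good j)) l y y′ py py′)) Cly)
    st′ : Cores G μ q′ s′ h′
    st′ = record
      { C = C′ ; size = proj₁ (proj₂ (proj₂ new)) ; disj = proj₂ (proj₂ (proj₂ (proj₂ new)))
      ; sparse = λ i → proj₂ (good i) ; const = const′ }
    vanish : ∀ i j x y → X i j x ∧ Y i j y ≡ false → b i j x y ≡ 0ℤ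
    vanish i j x y p with X i j x | Y i j y
    ... | false | _     = ℤₚ.*-zeroʳ (Correction.δ (corr i j))
    ... | true  | false = ℤₚ.*-zeroʳ (Correction.δ (corr i j))
    orth : ∀ i j i′ j′ x y → ¬ (i ≡ i′ × j ≡ j′) → b i j x y * b i′ j′ x y ≡ 0ℤ
    orth i j i′ j′ x y ne with X i j x ∧ Y i j y in e | X i′ j′ x ∧ Y i′ j′ y in e′
    ... | false | _     rewrite vanish i j x y e = ℤₚ.*-zeroˡ (b i′ j′ x y)
    ... | true  | false rewrite vanish i′ j′ x y e′ = ℤₚ.*-zeroʳ (b i j x y)
    -- A common point of two boxes lies in `C i × C j` and in `C i′ × C j′`; disjointness of the
    -- cores identifies the indices.
    ... | true  | true  = ⊥-elim (ne
        ( disj i i′ x (Correction.X⊑A (corr i j) x (∧-trueˡ {X i j x} e))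
            (Correction.X⊑A (corr i′ j′) x (∧-trueˡ {X i′ j′ x} e′))
        , disj j j′ y (Correction.Y⊑B (corr i j) y (∧-trueʳ {X i j x} e))
            (Correction.Y⊑B (corr i′ j′) y (∧-trueʳ {X i′ j′ x} e′))))
    open ℤₚ.≤-Reasoning
    mm = + (m ℕ.* m)
    ss = s ℕ.* s
    D : Fin q → Fin q → ℤ
    D i j = ∬ (λ x y → b i j x y * b i j x y - + 2 * (F x y * b i j x y))
    bads : ∬ (λ i j → - + (𝟙 (bd i j) ℕ.* ss)) ≡ - + (sumFin (λ i → countFin (bd i)) ℕ.* ss)
    bads = trans (neg-∬ (λ i j → + (𝟙 (bd i j) ℕ.* ss)))
      (cong -_ (trans (≡.sym (∬-pos (λ i j → 𝟙 (bd i j) ℕ.* ss)))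
        (cong +_ (trans (sum-cong (λ i → sum-*ʳ ss (λ j → 𝟙 (bd i j)))) (sum-*ʳ ss (λ i → countFin (bd i)))))))
    regroup : ∀ a h b → a - (h + b) ≡ (a - h) - b
    regroup = ℤR.solve-∀
    energy≤ : mm * energy (residual G N h′) ≤ mm * energy F - + (sumFin (λ i → countFin (bd i)) ℕ.* ss)
    energy≤ = begin
      mm * energy (residual G N h′)
        ≡⟨ cong (mm *_) (∬-cong (λ x y → cong (λ z → z * z) (regroup (+ N * ι (adj G x y)) (h x y) (Σ-box b x y)))) ⟩
      mm * energy (λ x y → F x y - Σ-box b x y)
        ≡⟨ cong (mm *_) (energy-update F b orth) ⟩
      mm * (energy F + ∬ D)
        ≡⟨ ℤₚ.*-distribˡ-+ mm (energy F) (∬ D) ⟩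
      mm * energy F + mm * ∬ D
        ≡⟨ cong (λ z → mm * energy F + z) (≡.sym (∬-*ˡ mm D)) ⟩
      mm * energy F + ∬ (λ i j → mm * D i j)
        ≤⟨ ℤₚ.+-monoʳ-≤ (mm * energy F) (∬-mono (λ i j → Correction.gain (corr i j))) ⟩
      mm * energy F + ∬ (λ i j → - + (𝟙 (bd i j) ℕ.* ss))
        ≡⟨ cong (λ z → mm * energy F + z) bads ⟩
      mm * energy F - + (sumFin (λ i → countFin (bd i)) ℕ.* ss) ∎

  -- Iterating the refinement.

  sparse-finder : ∀ {n} (G : Graph n) μ r s → 1 ℕ.≤ μ → 1 ℕ.≤ s → r ! ℕ.* kᵣ G r ℕ.< s ^ r →
    SparseFinder G μ (R μ r) s
  sparse-finder G μ r s μ≥1 s≥1 few W big with sparse-or-cliques G μ s μ≥1 s≥1 r W big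
  ... | inj₁ found = found
  ... | inj₂ many  = ⊥-elim (ℕₚ.<-irrefl refl
      (ℕₚ.<-≤-trans few (ℕₚ.≤-trans many (ℕₚ.*-monoʳ-≤ (r !) (cliques≤kᵣ G r W)))))

  energy≥0 : ∀ {n} (F : Fin n → Fin n → ℤ) → 0ℤ ≤ energy F
  energy≥0 {n} F = ℤₚ.≤-trans (ℤₚ.≤-reflexive (≡.sym (trans (∑-cong {n} (λ _ → ∑-zero n)) (∑-zero n))))
      (∬-mono (λ x y → sq≥0 (F x y)))
    where
    sq≥0 : ∀ i → 0ℤ ≤ i * i
    sq≥0 (+ zero)  = +≤+ z≤n
    sq≥0 (+ suc _) = +≤+ z≤n
    sq≥0 -[1+ _ ]  = +≤+ z≤n

  -- The number of cores delivered by `chunk-size` with `b = tests q * R μ r`: a `1/b` share is what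
  -- survives the tests and the search for a sparse set.
  next : ℕ → ℕ → ℕ → ℕ → ℕ
  next D μ r q = q ℕ.* (tests q ℕ.* R μ r ℕ.* D)

  -- The recursion changes the argument `q`, so a bound on `reach` passes unaltered from one round
  -- of `iterate` to the next.
  reach : ℕ → ℕ → ℕ → ℕ → ℕ → ℕ
  reach D μ r zero    q = q
  reach D μ r (suc f) q = reach D μ r f (next D μ r q)

  tests≥1 : ∀ q → 1 ℕ.≤ tests q
  tests≥1 q = ℕₚ.*-mono-≤ (ℕₚ.m^n>0 2 q) (ℕₚ.*-mono-≤ pow pow)
    where
    pow : 1 ℕ.≤ (2 ^ q) ^ q
    pow = ℕₚ.m^n>0 (2 ^ q) {{>-nonZero (ℕₚ.m^n>0 2 q)}} q

  q≤next : ∀ D μ r q → 1 ℕ.≤ D → q ℕ.≤ next D μ r q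
  q≤next D μ r q D≥1 = ℕₚ.≤-trans (ℕₚ.≤-reflexive (≡.sym (ℕₚ.*-identityʳ q)))
    (ℕₚ.*-monoʳ-≤ q (ℕₚ.*-mono-≤ (ℕₚ.*-mono-≤ (tests≥1 q) (R≥1 μ r)) D≥1))

  q≤reach : ∀ D μ r f q → 1 ℕ.≤ D → q ℕ.≤ reach D μ r f q
  q≤reach D μ r zero    q D≥1 = ℕₚ.≤-refl
  q≤reach D μ r (suc f) q D≥1 = ℕₚ.≤-trans (q≤next D μ r q D≥1) (q≤reach D μ r f (next D μ r q) D≥1)

  record Regular {n} (G : Graph n) (M m N μ k K D B : ℕ) : Set where
    field
      q s L    : ℕ
      h        : Fin n → Fin n → ℤ
      cores    : Cores G μ q s h
      n≡       : n ≡ q ℕ.* s ℕ.+ L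
      leftover : D ℕ.* L ℕ.≤ B ℕ.* n
      k≤q      : k ℕ.≤ q
      q≤K      : q ℕ.≤ K
      few-bad  : M ℕ.* countPairs (bad G N m cores) ℕ.≤ q ℕ.* q

  countPairs≤ : ∀ {q} (b : Fin q → Fin q → Bool) → countPairs b ℕ.≤ sumFin (λ i → countFin (b i))
  countPairs≤ b = sum-mono (λ i → sum-mono (λ j → 𝟙-mono {(toℕ i ℕ.<ᵇ toℕ j) ∧ b i j} (∧-trueʳ {toℕ i ℕ.<ᵇ toℕ j})))

  -- The cores cover half of the vertices and `t` is at least `q² / M`, hence
  -- `n² ≤ 4 (q s)² ≤ 4 M t s²`. Multiplying the drop by `4 * M` makes it at least `n²`.
  energy-drop : ∀ n q s M m t (E E′ : ℤ) → n ℕ.≤ 2 ℕ.* (q ℕ.* s) → q ℕ.* q ℕ.≤ M ℕ.* t →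
    + (m ℕ.* m) * E′ ≤ + (m ℕ.* m) * E - + (t ℕ.* (s ℕ.* s)) →
    + (4 ℕ.* M ℕ.* (m ℕ.* m)) * E′ + + (n ℕ.* n) ≤ + (4 ℕ.* M ℕ.* (m ℕ.* m)) * E
  energy-drop n q s M m t E E′ n≤ many drop = begin
      + (4 ℕ.* M ℕ.* (m ℕ.* m)) * E′ + + (n ℕ.* n)
        ≡⟨ cong (λ z → z * E′ + + (n ℕ.* n)) (ℤₚ.pos-* (4 ℕ.* M) (m ℕ.* m)) ⟩
      c * mm * E′ + + (n ℕ.* n)
        ≡⟨ cong (_+ + (n ℕ.* n)) (ℤₚ.*-assoc c mm E′) ⟩
      c * (mm * E′) + + (n ℕ.* n)
        ≤⟨ ℤₚ.+-mono-≤ (ℤₚ.*-monoˡ-≤-nonNeg c drop) (+≤+ n²≤) ⟩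
      c * (mm * E - + (t ℕ.* (s ℕ.* s))) + + (4 ℕ.* M ℕ.* (t ℕ.* (s ℕ.* s)))
        ≡⟨ cong (λ z → c * (mm * E - + (t ℕ.* (s ℕ.* s))) + z) (ℤₚ.pos-* (4 ℕ.* M) (t ℕ.* (s ℕ.* s))) ⟩
      c * (mm * E - + (t ℕ.* (s ℕ.* s))) + c * + (t ℕ.* (s ℕ.* s))
        ≡⟨ cancel c mm E (+ (t ℕ.* (s ℕ.* s))) ⟩
      c * mm * E
        ≡⟨ cong (_* E) (ℤₚ.pos-* (4 ℕ.* M) (m ℕ.* m)) ⟨
      + (4 ℕ.* M ℕ.* (m ℕ.* m)) * E ∎
    where
    open ℤₚ.≤-Reasoning
    c = + (4 ℕ.* M)
    mm = + (m ℕ.* m)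
    cancel : ∀ c mm E x → c * (mm * E - x) + c * x ≡ c * mm * E
    cancel = ℤR.solve-∀
    n²≤ : n ℕ.* n ℕ.≤ 4 ℕ.* M ℕ.* (t ℕ.* (s ℕ.* s))
    n²≤ = ℕₚ.≤-trans (ℕₚ.*-mono-≤ n≤ n≤) (ℕₚ.≤-trans (ℕₚ.≤-reflexive (sq q s))
            (ℕₚ.≤-trans (ℕₚ.*-monoʳ-≤ 4 (ℕₚ.*-monoˡ-≤ (s ℕ.* s) many)) (ℕₚ.≤-reflexive (assoc M t (s ℕ.* s)))))
      where
      sq : ∀ q s → 2 ℕ.* (q ℕ.* s) ℕ.* (2 ℕ.* (q ℕ.* s)) ≡ 4 ℕ.* (q ℕ.* q ℕ.* (s ℕ.* s))
      sq = ℕR.solve-∀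
      assoc : ∀ M t x → 4 ℕ.* (M ℕ.* t ℕ.* x) ≡ 4 ℕ.* M ℕ.* (t ℕ.* x)
      assoc = ℕR.solve-∀

  module Iteration {n} (G : Graph n) (M m N μ r k K D B : ℕ)
    (n≥1 : 1 ℕ.≤ n) (μ≥1 : 1 ℕ.≤ μ) (k≥1 : 1 ℕ.≤ k) (D≥1 : 1 ℕ.≤ D) (B≥1 : 1 ℕ.≤ B)
    (2B≤D : 2 ℕ.* B ℕ.≤ D) (large : 2 ℕ.* D ℕ.* K ℕ.≤ n)
    (few : suc (r ! ℕ.* (2 ℕ.* K) ^ r) ℕ.* kᵣ G r ℕ.≤ n ^ r) where

    Z : ℕ
    Z = 4 ℕ.* M ℕ.* (m ℕ.* m)

    -- At every stage `s` is at least `n / (2K)`, so the one hypothesis `few` excludes the clique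
    -- alternative for all core sizes that occur.
    finder : ∀ q s L → q ℕ.≤ K → n ≡ q ℕ.* s ℕ.+ L → D ℕ.* L ℕ.≤ B ℕ.* n → SparseFinder G μ (R μ r) s
    finder q s L q≤K n≡ small = sparse-finder G μ r s μ≥1 s≥1 (few-cliques n r (kᵣ G r) K s n≥1 n≤2Ks few)
      where
      n≤2qs = half-covered n q s L D B B≥1 2B≤D n≡ small
      n≤2Ks : n ℕ.≤ 2 ℕ.* (K ℕ.* s)
      n≤2Ks = ℕₚ.≤-trans n≤2qs (ℕₚ.*-monoʳ-≤ 2 (ℕₚ.*-monoˡ-≤ s q≤K))
      s≥1 : 1 ℕ.≤ s
      s≥1 = positive s (ℕₚ.≤-trans n≥1 n≤2qs)
        where
        positive : ∀ s → 1 ℕ.≤ 2 ℕ.* (q ℕ.* s) → 1 ℕ.≤ s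
        positive zero p with () ← subst (λ z → 1 ℕ.≤ 2 ℕ.* z) (ℕₚ.*-zeroʳ q) p
        positive (suc s) _ = s≤s z≤n

    -- Both budgets are measured in `fuel`: a round costs `2 * n` of the leftover bound and `n * n`
    -- of the scaled energy. The additional `n * n` in the energy bound makes empty fuel contradict
    -- nonnegativity of the energy.
    iterate : ∀ fuel q s L h → Cores G μ q s h → n ≡ q ℕ.* s ℕ.+ L → k ℕ.≤ q →
      reach D μ r fuel q ℕ.≤ K → D ℕ.* L ℕ.+ 2 ℕ.* fuel ℕ.* n ℕ.≤ B ℕ.* n →
      + Z * energy (residual G N h) + + (n ℕ.* n) ≤ + (fuel ℕ.* (n ℕ.* n)) → Regular G M m N μ k K D B
    iterate zero q s L h st n≡ k≤q reach≤ small en = ⊥-elim (absurd n n≥1 (ℤₚ.≤-trans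
        (ℤₚ.≤-trans (ℤₚ.≤-reflexive (≡.sym (ℤₚ.+-identityˡ (+ (n ℕ.* n)))))
          (ℤₚ.+-monoˡ-≤ (+ (n ℕ.* n)) (ℤₚ.≤-trans (ℤₚ.≤-reflexive (≡.sym (ℤₚ.*-zeroʳ (+ Z))))
            (ℤₚ.*-monoˡ-≤-nonNeg (+ Z) (energy≥0 (residual G N h)))))) en))
      where
      absurd : ∀ n → 1 ℕ.≤ n → ¬ (+ (n ℕ.* n) ≤ + 0)
      absurd (suc n) _ (+≤+ ())
    iterate (suc f) q s L h st n≡ k≤q reach≤ small en with M ℕ.* countPairs (bad G N m st) ℕₚ.≤? q ℕ.* q
    ... | yes fewbad = record
        { q = q ; s = s ; L = L ; h = h ; cores = st ; n≡ = n≡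
        ; leftover = ℕₚ.≤-trans (ℕₚ.m≤m+n (D ℕ.* L) _) small ; k≤q = k≤q
        ; q≤K = ℕₚ.≤-trans (q≤reach D μ r (suc f) q D≥1) reach≤ ; few-bad = fewbad }
    ... | no manybad = iterate f q′ s′ L′ (proj₁ refined) (proj₁ (proj₂ refined)) n≡′
            (ℕₚ.≤-trans k≤q (q≤next D μ r q D≥1)) reach≤ small′ en′
      where
      q′ = next D μ r q
      b = tests q ℕ.* R μ r
      q′≤K : q′ ℕ.≤ K
      q′≤K = ℕₚ.≤-trans (q≤reach D μ r f q′ D≥1) reach≤
      cs = chunk-size n q s L b D (ℕₚ.≤-trans k≥1 k≤q) (ℕₚ.*-mono-≤ (tests≥1 q) (R≥1 μ r)) D≥1 n≡
             (ℕₚ.≤-trans (ℕₚ.*-monoʳ-≤ (2 ℕ.* D) q′≤K) large)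
      s′ = proj₁ cs
      L′ = proj₁ (proj₂ cs)
      n≡′ = proj₁ (proj₂ (proj₂ (proj₂ cs)))
      small′ : D ℕ.* L′ ℕ.+ 2 ℕ.* f ℕ.* n ℕ.≤ B ℕ.* n
      small′ = ℕₚ.≤-trans (ℕₚ.+-monoˡ-≤ (2 ℕ.* f ℕ.* n) (proj₂ (proj₂ (proj₂ (proj₂ cs)))))
        (ℕₚ.≤-trans (ℕₚ.≤-reflexive (regroup (D ℕ.* L) n f)) small)
        where
        regroup : ∀ x n f → x ℕ.+ 2 ℕ.* n ℕ.+ 2 ℕ.* f ℕ.* n ≡ x ℕ.+ 2 ℕ.* suc f ℕ.* n
        regroup = ℕR.solve-∀
      refined = refine G μ N m q s h st (bad G N m st)
        (λ i j → correction (residual G N h) m s (Cores.C st i) (Cores.C st j)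
            (irregular? (residual G N h) m s (Cores.C st i) (Cores.C st j)))
        (R μ r) s′ q′ (finder q′ s′ L′ q′≤K n≡′ (ℕₚ.≤-trans (ℕₚ.m≤m+n (D ℕ.* L′) _) small′))
        (proj₁ (proj₂ (proj₂ cs)))
      t = sumFin (λ i → countFin (bad G N m st i))
      drop = energy-drop n q s M m t (energy (residual G N h)) (energy (residual G N (proj₁ refined)))
        (half-covered n q s L D B B≥1 2B≤D n≡ (ℕₚ.≤-trans (ℕₚ.m≤m+n (D ℕ.* L) _) small))
        (ℕₚ.≤-trans (ℕₚ.<⇒≤ (ℕₚ.≰⇒> manybad)) (ℕₚ.*-monoʳ-≤ M (countPairs≤ (bad G N m st))))
        (proj₂ (proj₂ refined))
      en′ : + Z * energy (residual G N (proj₁ refined)) + + (n ℕ.* n) ≤ + (f ℕ.* (n ℕ.* n))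
      en′ = ℤₚ.≤-trans drop (cancel-n² (+ Z * energy (residual G N h)) (n ℕ.* n) (f ℕ.* (n ℕ.* n)) en)
        where
        cancel-n² : ∀ E x y → E + + x ≤ + (x ℕ.+ y) → E ≤ + y
        cancel-n² E x y p = ℤₚ.≤-trans (ℤₚ.≤-reflexive (addsub E (+ x))) (ℤₚ.≤-trans (ℤₚ.+-monoˡ-≤ (- + x) p)
          (ℤₚ.≤-reflexive (trans (cong (_- + x) (ℤₚ.pos-+ x y)) (subadd (+ x) (+ y)))))
          where
          addsub : ∀ E x → E ≡ E + x - x
          addsub = ℤR.solve-∀
          subadd : ∀ x y → x + y - x ≡ y
          subadd = ℤR.solve-∀

    initial-energy : energy (residual G N (λ _ _ → 0ℤ)) ≤ + (N ℕ.* N ℕ.* (n ℕ.* n))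
    initial-energy = ℤₚ.≤-trans (∬-mono (λ x y → point (adj G x y)))
      (ℤₚ.≤-reflexive (trans (≡.sym (∬-pos {n} {n} (λ _ _ → N ℕ.* N)))
        (cong +_ (trans (sum-cong {n} (λ _ → sum-const n (N ℕ.* N))) (trans (sum-const n (n ℕ.* (N ℕ.* N)))
            (comm n (N ℕ.* N)))))))
      where
      comm : ∀ n x → n ℕ.* (n ℕ.* x) ≡ x ℕ.* (n ℕ.* n)
      comm = ℕR.solve-∀
      value : ∀ a → + N * ι a - 0ℤ ≡ + (N ℕ.* 𝟙 a)
      value a = trans (ℤₚ.+-identityʳ (+ N * ι a)) (≡.sym (ℤₚ.pos-* N (𝟙 a)))
      point : ∀ a → (+ N * ι a - 0ℤ) * (+ N * ι a - 0ℤ) ≤ + (N ℕ.* N)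
      point a rewrite value a = ℤₚ.≤-trans (ℤₚ.≤-reflexive (≡.sym (ℤₚ.pos-* (N ℕ.* 𝟙 a) (N ℕ.* 𝟙 a))))
        (+≤+ (ℕₚ.*-mono-≤ N𝟙≤ N𝟙≤))
        where
        N𝟙≤ : N ℕ.* 𝟙 a ℕ.≤ N
        N𝟙≤ = ℕₚ.≤-trans (ℕₚ.*-monoʳ-≤ N (𝟙≤1 a)) (ℕₚ.≤-reflexive (ℕₚ.*-identityʳ N))

    -- For `h = 0` the scaled energy is at most `Z * (N * N)` times `n * n`; the successor supplies
    -- the additional `n * n` demanded by `iterate`.
    T : ℕ
    T = suc (Z ℕ.* (N ℕ.* N))

    -- The initial cut treats the whole vertex set as one old core, with `b = k * R μ r`; the factor
    -- `k` guarantees at least `k` parts.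
    q₀ : ℕ
    q₀ = 1 ℕ.* (k ℕ.* R μ r ℕ.* D)

    regular : 2 ℕ.* suc T ℕ.≤ B → reach D μ r T q₀ ℕ.≤ K → Regular G M m N μ k K D B
    regular steps reach≤ = iterate T q₀ s₀ L₀ (λ _ _ → 0ℤ) start n≡₀ k≤q₀ reach≤ small₀ en₀
      where
      kR≥1 : 1 ℕ.≤ k ℕ.* R μ r
      kR≥1 = ℕₚ.*-mono-≤ k≥1 (R≥1 μ r)
      q₀≤K : q₀ ℕ.≤ K
      q₀≤K = ℕₚ.≤-trans (q≤reach D μ r T q₀ D≥1) reach≤
      k≤q₀ : k ℕ.≤ q₀
      k≤q₀ = ℕₚ.≤-trans (ℕₚ.≤-reflexive (≡.sym (trans (ℕₚ.*-identityʳ (k ℕ.* 1)) (ℕₚ.*-identityʳ k))))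
        (ℕₚ.≤-trans (ℕₚ.*-mono-≤ (ℕₚ.*-monoʳ-≤ k (R≥1 μ r)) D≥1)
            (ℕₚ.≤-reflexive (≡.sym (ℕₚ.*-identityˡ (k ℕ.* R μ r ℕ.* D)))))
      cs = chunk-size n 1 n 0 (k ℕ.* R μ r) D ℕₚ.≤-refl kR≥1 D≥1
        (≡.sym (trans (ℕₚ.+-identityʳ (1 ℕ.* n)) (ℕₚ.*-identityˡ n))) (ℕₚ.≤-trans (ℕₚ.*-monoʳ-≤ (2 ℕ.* D) q₀≤K) large)
      s₀ = proj₁ cs
      L₀ = proj₁ (proj₂ cs)
      n≡₀ = proj₁ (proj₂ (proj₂ (proj₂ cs)))
      DL₀≤ : D ℕ.* L₀ ℕ.≤ 2 ℕ.* n
      DL₀≤ = ℕₚ.≤-trans (proj₂ (proj₂ (proj₂ (proj₂ cs)))) (ℕₚ.≤-reflexive (cong (ℕ._+ 2 ℕ.* n) (ℕₚ.*-zeroʳ D)))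
      small₀ : D ℕ.* L₀ ℕ.+ 2 ℕ.* T ℕ.* n ℕ.≤ B ℕ.* n
      small₀ = ℕₚ.≤-trans (ℕₚ.+-monoˡ-≤ (2 ℕ.* T ℕ.* n) DL₀≤)
        (ℕₚ.≤-trans (ℕₚ.≤-reflexive (regroup n T)) (ℕₚ.*-monoˡ-≤ n steps))
        where
        regroup : ∀ n T → 2 ℕ.* n ℕ.+ 2 ℕ.* T ℕ.* n ≡ 2 ℕ.* suc T ℕ.* n
        regroup = ℕR.solve-∀
      find = finder q₀ s₀ L₀ q₀≤K n≡₀ (ℕₚ.≤-trans (ℕₚ.m≤m+n (D ℕ.* L₀) _) small₀)
      new = greedy (λ S → μ ℕ.* eB G S S ℕ.≤ s₀ ℕ.* s₀) s₀ (k ℕ.* R μ r ℕ.* s₀) q₀ (λ _ → true)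
        (λ U _ le → find U (ℕₚ.≤-trans
            (ℕₚ.*-monoˡ-≤ s₀ (ℕₚ.≤-trans (ℕₚ.≤-reflexive (≡.sym (ℕₚ.*-identityˡ (R μ r))))
            (ℕₚ.*-monoˡ-≤ (R μ r) k≥1))) le))
        (ℕₚ.≤-trans (proj₁ (proj₂ (proj₂ cs))) (ℕₚ.≤-reflexive (trans (ℕₚ.*-identityˡ n) (≡.sym (card-full n)))))
      start : Cores G μ q₀ s₀ (λ _ _ → 0ℤ)
      start = record { C = proj₁ new ; size = proj₁ (proj₂ (proj₂ new)) ; disj = proj₂ (proj₂ (proj₂ (proj₂ new)))
                     ; sparse = proj₁ (proj₂ (proj₂ (proj₂ new))) ; const = λ _ _ _ _ _ _ _ _ _ _ → refl }
      en₀ : + Z * energy (residual G N (λ _ _ → 0ℤ)) + + (n ℕ.* n) ≤ + (T ℕ.* (n ℕ.* n))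
      en₀ = ℤₚ.≤-trans (ℤₚ.+-monoˡ-≤ (+ (n ℕ.* n)) (ℤₚ.*-monoˡ-≤-nonNeg (+ Z) initial-energy))
        (ℤₚ.≤-reflexive (trans (cong (_+ + (n ℕ.* n)) (≡.sym (ℤₚ.pos-* Z (N ℕ.* N ℕ.* (n ℕ.* n)))))
          (trans (≡.sym (ℤₚ.pos-+ (Z ℕ.* (N ℕ.* N ℕ.* (n ℕ.* n))) (n ℕ.* n)))
              (cong +_ (regroup Z (N ℕ.* N) (n ℕ.* n))))))
        where
        regroup : ∀ Z a x → Z ℕ.* (a ℕ.* x) ℕ.+ x ≡ suc (Z ℕ.* a) ℕ.* x
        regroup = ℕR.solve-∀

  -- Densities between enlarged cores

  0≤-* : ∀ {i j} → 0ℤ ≤ i → 0ℤ ≤ j → 0ℤ ≤ i * j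
  0≤-* {i} {j} p q with i | j | p | q
  ... | + a | + b | _ | _ = subst (0ℤ ≤_) (ℤₚ.pos-* a b) (+≤+ z≤n)

  -- The format of the certificates below: the difference of the two sides is written as a sum of
  -- products of nonnegative terms, and the ring solver checks the identity.
  ≤-from : ∀ {i j} c → 0ℤ ≤ c → j - i ≡ c → i ≤ j
  ≤-from c p eq = ℤₚ.0≤i-j⇒j≤i (subst (0ℤ ≤_) (≡.sym eq) p)

  regular-bound : ∀ {n} (F : Fin n → Fin n → ℤ) m s A B → ¬ Irregular F m s A B → (X Y : VSet n) → X ⊑ A → Y ⊑ B →
    s ℕ.≤ m ℕ.* card X → s ℕ.≤ m ℕ.* card Y → ∣ boxSum F X Y ∣ ℕ.≤ card X ℕ.* card Y
  regular-bound {n} F m s A B reg X Y X⊑A Y⊑B bigX bigY = ℕₚ.≮⇒≥ (λ gt → reg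
      ( tabulate X , tabulate Y
      , (λ x p → X⊑A x (trans (≡.sym (tX x)) p)) , (λ y p → Y⊑B y (trans (≡.sym (tY y)) p))
      , subst (λ c → s ℕ.≤ m ℕ.* c) (≡.sym cX) bigX , subst (λ c → s ℕ.≤ m ℕ.* c) (≡.sym cY) bigY
      , ℕₚ.≤-trans (ℕₚ.≤-reflexive (cong₂ (λ u v → suc (u ℕ.* v)) cX cY))
          (ℕₚ.≤-trans gt (ℕₚ.≤-reflexive (cong ∣_∣ (≡.sym box≡))))))
    where
    tX : ∀ x → lookup (tabulate X) x ≡ X x
    tX = lookup∘tabulate X
    tY : ∀ y → lookup (tabulate Y) y ≡ Y y
    tY = lookup∘tabulate Y
    cX : card (lookup (tabulate X)) ≡ card X
    cX = sum-cong (λ x → cong 𝟙 (tX x))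
    cY : card (lookup (tabulate Y)) ≡ card Y
    cY = sum-cong (λ y → cong 𝟙 (tY y))
    box≡ : boxSum F (lookup (tabulate X)) (lookup (tabulate Y)) ≡ boxSum F X Y
    box≡ = ∬-cong (λ x y → cong₂ (λ u v → ι u * ι v * F x y) (tX x) (tY y))

  boxSum-residual : ∀ {n} (G : Graph n) N h (γ : ℤ) (X Y : VSet n) →
    (∀ x y → X x ≡ true → Y y ≡ true → h x y ≡ γ) →
    boxSum (residual G N h) X Y ≡ + N * + eB G X Y - γ * + (card X ℕ.* card Y)
  boxSum-residual G N h γ X Y const = begin
      boxSum (residual G N h) X Y
        ≡⟨ ∬-cong point ⟩
      ∬ (λ x y → + N * + 𝟙 (X x ∧ Y y ∧ adj G x y) + (- γ) * (ι (X x) * ι (Y y)))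
        ≡⟨ ∬-+ (λ x y → + N * + 𝟙 (X x ∧ Y y ∧ adj G x y)) (λ x y → (- γ) * (ι (X x) * ι (Y y))) ⟩
      ∬ (λ x y → + N * + 𝟙 (X x ∧ Y y ∧ adj G x y)) + ∬ (λ x y → (- γ) * (ι (X x) * ι (Y y)))
        ≡⟨ cong₂ _+_ (trans (∬-*ˡ (+ N) (λ x y → + 𝟙 (X x ∧ Y y ∧ adj G x y)))
            (cong (λ z → + N * z) (≡.sym (∬-pos (λ x y → 𝟙 (X x ∧ Y y ∧ adj G x y))))))
                     (trans (∬-*ˡ (- γ) (λ x y → ι (X x) * ι (Y y)))
                         (trans (cong (λ z → (- γ) * z) (∬-rect X Y))
                         (≡.sym (ℤₚ.neg-distribˡ-* γ (+ (card X ℕ.* card Y)))))) ⟩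
      + N * + eB G X Y - γ * + (card X ℕ.* card Y) ∎
    where
    open ≡.≡-Reasoning
    in-box : ∀ N a γ → 1ℤ * 1ℤ * (N * a - γ) ≡ N * a + (- γ) * (1ℤ * 1ℤ)
    in-box = ℤR.solve-∀
    outside₁ : ∀ N γ y f → 0ℤ * y * f ≡ N * 0ℤ + (- γ) * (0ℤ * y)
    outside₁ = ℤR.solve-∀
    outside₂ : ∀ N γ f → 1ℤ * 0ℤ * f ≡ N * 0ℤ + (- γ) * (1ℤ * 0ℤ)
    outside₂ = ℤR.solve-∀
    point : ∀ x y → ι (X x) * ι (Y y) * residual G N h x y
                  ≡ + N * + 𝟙 (X x ∧ Y y ∧ adj G x y) + (- γ) * (ι (X x) * ι (Y y))
    point x y with X x in Xx | Y y in Yy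
    ... | false | b     = outside₁ (+ N) γ (ι b) (residual G N h x y)
    ... | true  | false = outside₂ (+ N) γ (residual G N h x y)
    ... | true  | true  rewrite const x y Xx Yy = in-box (+ N) (ι (adj G x y)) γ

  abs-upper : ∀ i p → ∣ i ∣ ℕ.≤ p → i ≤ + p
  abs-upper (+ a)    p le = +≤+ le
  abs-upper -[1+ a ] p le = -≤+

  abs-lower : ∀ i p → ∣ i ∣ ℕ.≤ p → - + p ≤ i
  abs-lower (+ a)    p le = ℤₚ.≤-trans (ℤₚ.neg-mono-≤ (+≤+ (z≤n {p}))) (+≤+ z≤n)
  abs-lower -[1+ a ] p le = ℤₚ.neg-mono-≤ (+≤+ le)

  -- Primes mark the core part of the rectangle. There `N * e′` is within `p′` of `γ * p′`. Upwards,
  -- the pairs outside contribute at most `N * (p - p′) ≤ p`, and `-1 ≤ γ` allows replacing `p′` by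
  -- `p`; downwards, `γ - 1 ≤ N` bounds the loss from this replacement by `p`. Hence the error of
  -- two units.
  close-arith : ∀ (N e e′ p p′ γ : ℤ) → 0ℤ ≤ N → e′ ≤ e → e + p′ ≤ e′ + p → p′ ≤ p → N * p ≤ N * p′ + p →
    γ ≤ N + 1ℤ → -1ℤ ≤ γ → N * e′ - γ * p′ ≤ p′ → - p′ ≤ N * e′ - γ * p′ →
    N * e ≤ (γ + + 2) * p × (γ - + 2) * p ≤ N * e
  close-arith N e e′ p p′ γ N≥0 e′≤e defect p′≤p Np γ≤ γ≥ up lo = upper , lower
    where
    infixl 6 _⊕_
    _⊕_ : ∀ {i j} → 0ℤ ≤ i → 0ℤ ≤ j → 0ℤ ≤ i + j
    _⊕_ = ℤₚ.+-mono-≤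
    d = ℤₚ.i≤j⇒0≤j-i
    upper : N * e ≤ (γ + + 2) * p
    upper = ≤-from _ (0≤-* (d γ≥) (d p′≤p) ⊕ d Np ⊕ d up ⊕ 0≤-* N≥0 (d defect)) (cert N e e′ p p′ γ)
      where
      cert : ∀ N e e′ p p′ γ → (γ + + 2) * p - N * e ≡
        (γ - -1ℤ) * (p - p′) + (N * p′ + p - N * p) + (p′ - (N * e′ - γ * p′)) + N * (e′ + p - (e + p′))
      cert = ℤR.solve-∀
    lower : (γ - + 2) * p ≤ N * e
    lower = ≤-from _ (0≤-* N≥0 (d e′≤e) ⊕ d lo ⊕ 0≤-* (d γ≤) (d p′≤p) ⊕ d Np) (cert N e e′ p p′ γ)
      where
      cert : ∀ N e e′ p p′ γ → N * e - (γ - + 2) * p ≡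
        N * (e - e′) + (N * e′ - γ * p′ - (- p′)) + (N + 1ℤ - γ) * (p - p′) + (N * p′ + p - N * p)
      cert = ℤR.solve-∀

  -- A density lies between 0 and 1, and `γ` is within one of `N` times the density of the core
  -- pair.
  γ-range : ∀ (N e p : ℕ) (γ : ℤ) → 1 ℕ.≤ p → e ℕ.≤ p → + N * + e - γ * + p ≤ + p → - + p ≤ + N * + e - γ * + p →
    γ ≤ + N + 1ℤ × -1ℤ ≤ γ
  γ-range N e p@(suc _) γ _ e≤p up lo = upper , lower
    where
    upper : γ ≤ + N + 1ℤ
    upper = ℤₚ.*-cancelʳ-≤-pos γ (+ N + 1ℤ) (+ p) (≤-from _
      (ℤₚ.+-mono-≤ (ℤₚ.i≤j⇒0≤j-i lo) (0≤-* {+ N} (+≤+ z≤n) (ℤₚ.i≤j⇒0≤j-i (+≤+ e≤p)))) (cert (+ N) (+ e) (+ p) γ))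
      where
      cert : ∀ N e p γ → (N + 1ℤ) * p - γ * p ≡ (N * e - γ * p - (- p)) + N * (p - e)
      cert = ℤR.solve-∀
    lower : -1ℤ ≤ γ
    lower = ℤₚ.*-cancelʳ-≤-pos -1ℤ γ (+ p) (≤-from _
      (ℤₚ.+-mono-≤ (ℤₚ.i≤j⇒0≤j-i up) (0≤-* {+ N} {+ e} (+≤+ z≤n) (+≤+ z≤n))) (cert (+ N) (+ e) (+ p) γ))
      where
      cert : ∀ N e p γ → γ * p - -1ℤ * p ≡ (p - (N * e - γ * p)) + N * e
      cert = ℤR.solve-∀

  eB≤product : ∀ {n} (G : Graph n) (X Y : VSet n) → eB G X Y ℕ.≤ card X ℕ.* card Y
  eB≤product G X Y = ℕₚ.≤-trans (sum-mono (λ x → sum-mono (λ y → 𝟙-mono {X x ∧ Y y ∧ adj G x y} {X x ∧ Y y} (λ p →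
      ∧-true {X x} (∧-trueˡ {X x} p) (∧-trueˡ {Y y} (∧-trueʳ {X x} p))))))
    (ℕₚ.≤-reflexive (≡.sym (card-product X Y)))

  -- The density of the pair is within `2 / N` of `γ / N`, with denominators cleared.
  DensityNear : ∀ {n} → Graph n → ℕ → ℤ → VSet n → VSet n → Set
  DensityNear G N γ X Y =
    + N * + eB G X Y ≤ (γ + + 2) * + (card X ℕ.* card Y) × (γ - + 2) * + (card X ℕ.* card Y) ≤ + N * + eB G X Y

  -- Regularity is applied twice: to `X ∩ C` and `Y ∩ C′`, which are still large, and to the full
  -- cores, which confines `γ` and thereby the error caused by vertices outside the cores.
  regular-extends : ∀ {n} (G : Graph n) M N s h γ (C C′ V V′ : VSet n) → 1 ℕ.≤ M → 1 ℕ.≤ N → 1 ℕ.≤ s →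
    C ⊑ V → C′ ⊑ V′ → card C ≡ s → card C′ ≡ s →
    16 ℕ.* M ℕ.* N ℕ.* card (V ∖ C) ℕ.≤ s → 16 ℕ.* M ℕ.* N ℕ.* card (V′ ∖ C′) ℕ.≤ s →
    (∀ x y → C x ≡ true → C′ y ≡ true → h x y ≡ γ) → ¬ Irregular (residual G N h) (2 ℕ.* M) s C C′ →
    ∀ X Y → X ⊑ V → Y ⊑ V′ → card V ℕ.≤ M ℕ.* card X → card V′ ℕ.≤ M ℕ.* card Y → DensityNear G N γ X Y
  regular-extends G M N s h γ C C′ V V′ M≥1 N≥1 s≥1 C⊑V C′⊑V′ cC cC′ a≤ b≤ const reg X Y X⊑V Y⊑V′ bigX bigY =
    close-arith (+ N) (+ eB G X Y) (+ eB G X₀ Y₀) (+ p) (+ p₀) γ (+≤+ z≤n)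
      (+≤+ (eB-mono G X₀⊑X Y₀⊑Y)) (+≤+ (eB-defect G X₀⊑X Y₀⊑Y)) (+≤+ (ℕₚ.*-mono-≤ (card-mono X₀⊑X) (card-mono Y₀⊑Y)))
      Np (proj₁ range) (proj₂ range) (proj₁ near₀) (proj₂ near₀)
    where
    a = card (V ∖ C)
    b = card (V′ ∖ C′)
    X₀ = X ∩ C
    Y₀ = Y ∩ C′
    p = card X ℕ.* card Y
    p₀ = card X₀ ℕ.* card Y₀
    X₀⊑X : X₀ ⊑ X
    X₀⊑X x = ∧-trueˡ {X x}
    Y₀⊑Y : Y₀ ⊑ Y
    Y₀⊑Y y = ∧-trueˡ {Y y}
    sV : s ℕ.+ a ℕ.≤ M ℕ.* card X
    sV = ℕₚ.≤-trans (ℕₚ.≤-reflexive (≡.sym (trans (card-superset C V C⊑V) (cong (ℕ._+ a) cC)))) bigX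
    sV′ : s ℕ.+ b ℕ.≤ M ℕ.* card Y
    sV′ = ℕₚ.≤-trans (ℕₚ.≤-reflexive (≡.sym (trans (card-superset C′ V′ C′⊑V′) (cong (ℕ._+ b) cC′)))) bigY
    X≤ = card-∩-core C V X X⊑V
    Y≤ = card-∩-core C′ V′ Y Y⊑V′
    Np : + N * + p ≤ + N * + p₀ + + p
    Np = ℤₚ.≤-trans (ℤₚ.≤-reflexive (≡.sym (ℤₚ.pos-* N p)))
        (ℤₚ.≤-trans (+≤+ (product-defect N (card X) (card X₀) (card Y) (card Y₀) a b X≤ Y≤
           (card-mono X₀⊑X) (excess-relative M N s a (card X) M≥1 a≤ sV)
               (excess-relative M N s b (card Y) M≥1 b≤ sV′)))
         (ℤₚ.≤-reflexive (trans (ℤₚ.pos-+ (N ℕ.* p₀) p) (cong (_+ + p) (ℤₚ.pos-* N p₀)))))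
    near : ∀ X₁ Y₁ → X₁ ⊑ C → Y₁ ⊑ C′ → s ℕ.≤ 2 ℕ.* M ℕ.* card X₁ → s ℕ.≤ 2 ℕ.* M ℕ.* card Y₁ →
      + N * + eB G X₁ Y₁ - γ * + (card X₁ ℕ.* card Y₁) ≤ + (card X₁ ℕ.* card Y₁) ×
      - + (card X₁ ℕ.* card Y₁) ≤ + N * + eB G X₁ Y₁ - γ * + (card X₁ ℕ.* card Y₁)
    near X₁ Y₁ sX sY bX bY = abs-upper _ _ bound , abs-lower _ _ bound
      where
      bound : ∣ + N * + eB G X₁ Y₁ - γ * + (card X₁ ℕ.* card Y₁) ∣ ℕ.≤ card X₁ ℕ.* card Y₁
      bound = subst (λ z → ∣ z ∣ ℕ.≤ card X₁ ℕ.* card Y₁)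
        (boxSum-residual G N h γ X₁ Y₁ (λ x y px py → const x y (sX x px) (sY y py)))
        (regular-bound (residual G N h) (2 ℕ.* M) s C C′ reg X₁ Y₁ sX sY bX bY)
    near₀ = near X₀ Y₀ (λ x → ∧-trueʳ {X x}) (λ y → ∧-trueʳ {Y y})
      (core-large M N s a (card X) (card X₀) N≥1 a≤ sV X≤) (core-large M N s b (card Y) (card Y₀) N≥1 b≤ sV′ Y≤)
    s≤2Ms : ∀ c → c ≡ s → s ℕ.≤ 2 ℕ.* M ℕ.* c
    s≤2Ms c refl = ℕₚ.≤-trans (ℕₚ.≤-reflexive (≡.sym (ℕₚ.*-identityˡ s)))
        (ℕₚ.*-monoˡ-≤ s (ℕₚ.*-mono-≤ {1} {2} (s≤s z≤n) M≥1))
    nearC = near C C′ (λ _ q → q) (λ _ q → q) (s≤2Ms (card C) cC) (s≤2Ms (card C′) cC′)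
    range = γ-range N (eB G C C′) (card C ℕ.* card C′) γ
      (ℕₚ.*-mono-≤ (ℕₚ.≤-trans s≥1 (ℕₚ.≤-reflexive (≡.sym cC))) (ℕₚ.≤-trans s≥1 (ℕₚ.≤-reflexive (≡.sym cC′))))
      (eB≤product G C C′) (proj₁ nearC) (proj₂ nearC)

open Energy

open import Data.Nat.Base as ℕ using (ℕ; zero; suc; z≤n; s≤s; _≤_; _<_; _*_; _^_; _!; >-nonZero)
open import Data.Nat.Combinatorics using (_C_)
open import Data.Nat.Coprimality using (Coprime; 1-coprimeTo)
import Data.Nat.Properties as ℕₚ
open import Data.Integer.Base as ℤ using (ℤ; +_; -[1+_]; +≤+; +<+)
import Data.Integer.Properties as ℤₚ
open import Data.Rational.Base as ℚ using (ℚ; 0ℚ; mkℚ; toℚᵘ)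
import Data.Rational.Properties as ℚₚ
open import Data.Rational.Unnormalised.Base as ℚᵘ using (mkℚᵘ; *≤*; *<*)
import Data.Rational.Unnormalised.Properties as ℚᵘₚ
open import Data.Fin.Subset using (∣_∣)
open import Algebra.Properties.Group ℚₚ.+-0-group using (⁻¹-involutive)

-- Rational inequalities

private
  ⟦⟧≃ : ∀ x → toℚᵘ ⟦ x ⟧ ℚᵘ.≃ mkℚᵘ (+ x) 0
  ⟦⟧≃ x = ℚₚ.toℚᵘ-fromℚᵘ (mkℚᵘ (+ x) 0)

  *⟦⟧≃ : ∀ p y → toℚᵘ (p ℚ.* ⟦ y ⟧) ℚᵘ.≃ toℚᵘ p ℚᵘ.* mkℚᵘ (+ y) 0
  *⟦⟧≃ p y = ℚᵘₚ.≃-trans (ℚₚ.toℚᵘ-homo-* p ⟦ y ⟧) (ℚᵘₚ.*-cong (ℚᵘₚ.≃-refl {toℚᵘ p}) (⟦⟧≃ y))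

⟦⟧≤*⟦⟧ : ∀ a d .(c : Coprime a (suc d)) x y → x * suc d ≤ a * y → ⟦ x ⟧ ℚ.≤ mkℚ (+ a) d c ℚ.* ⟦ y ⟧
⟦⟧≤*⟦⟧ a d c x y le = ℚₚ.toℚᵘ-cancel-≤ (ℚᵘₚ.≤-respˡ-≃ (ℚᵘₚ.≃-sym (⟦⟧≃ x))
    (ℚᵘₚ.≤-respʳ-≃ (ℚᵘₚ.≃-sym (*⟦⟧≃ (mkℚ (+ a) d c) y))
  (*≤* cross)))
  where
  cross : + x ℤ.* + (suc d * 1) ℤ.≤ (+ a ℤ.* + y) ℤ.* + 1
  cross = ℤₚ.≤-trans (ℤₚ.≤-reflexive (trans (cong (λ z → + x ℤ.* + z) (ℕₚ.*-identityʳ (suc d)))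
      (≡.sym (ℤₚ.pos-* x (suc d)))))
    (ℤₚ.≤-trans (+≤+ le) (ℤₚ.≤-reflexive (trans (ℤₚ.pos-* a y) (≡.sym (ℤₚ.*-identityʳ (+ a ℤ.* + y))))))

⟦⟧≤*⟦⟧⁻¹ : ∀ a d .(c : Coprime a (suc d)) x y → ⟦ x ⟧ ℚ.≤ mkℚ (+ a) d c ℚ.* ⟦ y ⟧ → x * suc d ≤ a * y
⟦⟧≤*⟦⟧⁻¹ a d c x y le with ℚᵘₚ.≤-respˡ-≃ (⟦⟧≃ x) (ℚᵘₚ.≤-respʳ-≃ (*⟦⟧≃ (mkℚ (+ a) d c) y) (ℚₚ.toℚᵘ-mono-≤ le))
... | *≤* cross = ℤₚ.drop‿+≤+ (ℤₚ.≤-trans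
    (ℤₚ.≤-reflexive (trans (ℤₚ.pos-* x (suc d)) (cong (λ z → + x ℤ.* + z) (≡.sym (ℕₚ.*-identityʳ (suc d))))))
    (ℤₚ.≤-trans cross (ℤₚ.≤-reflexive (trans (ℤₚ.*-identityʳ (+ a ℤ.* + y)) (≡.sym (ℤₚ.pos-* a y))))))

*⟦⟧≤⟦⟧⁻¹ : ∀ a d .(c : Coprime a (suc d)) x y → mkℚ (+ a) d c ℚ.* ⟦ y ⟧ ℚ.≤ ⟦ x ⟧ → a * y ≤ x * suc d
*⟦⟧≤⟦⟧⁻¹ a d c x y le with ℚᵘₚ.≤-respʳ-≃ (⟦⟧≃ x) (ℚᵘₚ.≤-respˡ-≃ (*⟦⟧≃ (mkℚ (+ a) d c) y) (ℚₚ.toℚᵘ-mono-≤ le))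
... | *≤* cross = ℤₚ.drop‿+≤+ (ℤₚ.≤-trans
    (ℤₚ.≤-reflexive (trans (ℤₚ.pos-* a y) (≡.sym (ℤₚ.*-identityʳ (+ a ℤ.* + y)))))
    (ℤₚ.≤-trans cross (ℤₚ.≤-reflexive (trans (cong (λ z → + x ℤ.* + z) (ℕₚ.*-identityʳ (suc d)))
        (≡.sym (ℤₚ.pos-* x (suc d)))))))

-- Both ratios are within `2 / N` of `γ / N`, so they differ by at most `4 / (5 * suc d)`. The
-- factor 5 instead of 4 gives the strict inequality.
ratio-diff-< : ∀ a d .(c : Coprime (suc a) (suc d)) e p e′ p′ γ → let N = + (5 * suc d) in
  N ℤ.* + e ℤ.≤ (γ ℤ.+ + 2) ℤ.* + suc p → (γ ℤ.- + 2) ℤ.* + suc p′ ℤ.≤ N ℤ.* + e′ →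
  ratio e (suc p) ℚ.- ratio e′ (suc p′) ℚ.< mkℚ (+ suc a) d c
ratio-diff-< a d c e p e′ p′ γ up lo = subst (ratio e (suc p) ℚ.- y ℚ.<_) shift (ℚₚ.+-monoˡ-< (ℚ.- y) x<ε+y)
  where
  ε = mkℚ (+ suc a) d c
  y = ratio e′ (suc p′)
  shift : ε ℚ.+ y ℚ.- y ≡ ε
  shift = trans (ℚₚ.+-assoc ε y (ℚ.- y)) (trans (cong (ε ℚ.+_) (ℚₚ.+-inverseʳ y)) (ℚₚ.+-identityʳ ε))
  E E′ P P′ S A : ℤ
  E = + e
  E′ = + e′
  P = + suc p
  P′ = + suc p′
  S = + suc d
  A = + suc a
  five : + (5 * suc d) ≡ + 5 ℤ.* S
  five = ℤₚ.pos-* 5 (suc d)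
  scaled : + 5 ℤ.* (E ℤ.* (S ℤ.* P′)) ℤ.< + 5 ℤ.* ((A ℤ.* P′ ℤ.+ E′ ℤ.* S) ℤ.* P)
  scaled = ℤₚ.≤-<-trans
    (≤-from _ (ℤₚ.+-mono-≤ (0≤-* {j = P′} (ℤₚ.i≤j⇒0≤j-i (subst (λ N → N ℤ.* E ℤ.≤ (γ ℤ.+ + 2) ℤ.* P) five up))
        (+≤+ z≤n))
                           (0≤-* {j = P} (ℤₚ.i≤j⇒0≤j-i (subst (λ N → (γ ℤ.- + 2) ℤ.* P′ ℤ.≤ N ℤ.* E′) five lo))
                               (+≤+ z≤n)))
      (cert E E′ P P′ S γ))
    (ℤₚ.<-≤-trans (ℤₚ.+-monoʳ-< (+ 5 ℤ.* (E′ ℤ.* S ℤ.* P)) 4PP<)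
      (ℤₚ.≤-reflexive (regroup A E′ S P P′)))
    where
    cert : ∀ E E′ P P′ S γ →
      (+ 5 ℤ.* (E′ ℤ.* S ℤ.* P) ℤ.+ + 4 ℤ.* (P ℤ.* P′)) ℤ.- + 5 ℤ.* (E ℤ.* (S ℤ.* P′)) ≡
      ((γ ℤ.+ + 2) ℤ.* P ℤ.- + 5 ℤ.* S ℤ.* E) ℤ.* P′ ℤ.+ (+ 5 ℤ.* S ℤ.* E′ ℤ.- (γ ℤ.- + 2) ℤ.* P′) ℤ.* P
    cert = ℤR.solve-∀
    regroup : ∀ A E′ S P P′ → + 5 ℤ.* (E′ ℤ.* S ℤ.* P) ℤ.+ + 5 ℤ.* (A ℤ.* (P ℤ.* P′)) ≡ + 5
        ℤ.* ((A ℤ.* P′ ℤ.+ E′ ℤ.* S) ℤ.* P)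
    regroup = ℤR.solve-∀
    nat : 4 * (suc p * suc p′) < 5 * (suc a * (suc p * suc p′))
    nat = ℕₚ.<-≤-trans (ℕₚ.*-monoˡ-< (suc p * suc p′) (ℕₚ.n<1+n 4))
      (ℕₚ.*-monoʳ-≤ 5 (ℕₚ.m≤m+n (suc p * suc p′) (a * (suc p * suc p′))))
    4PP< : + 4 ℤ.* (P ℤ.* P′) ℤ.< + 5 ℤ.* (A ℤ.* (P ℤ.* P′))
    4PP< = +<+ nat
  x<ε+y : ratio e (suc p) ℚ.< ε ℚ.+ y
  x<ε+y = ℚₚ.toℚᵘ-cancel-< (ℚᵘₚ.<-respˡ-≃ (ℚᵘₚ.≃-sym (ℚₚ.toℚᵘ-fromℚᵘ (mkℚᵘ (+ e) p)))
    (ℚᵘₚ.<-respʳ-≃ (ℚᵘₚ.≃-sym (ℚᵘₚ.≃-trans (ℚₚ.toℚᵘ-homo-+ ε y)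
        (ℚᵘₚ.+-cong (ℚᵘₚ.≃-refl {toℚᵘ ε}) (ℚₚ.toℚᵘ-fromℚᵘ (mkℚᵘ (+ e′) p′)))))
      (*<* (ℤₚ.*-cancelˡ-<-nonNeg {E ℤ.* (S ℤ.* P′)} {(A ℤ.* P′ ℤ.+ E′ ℤ.* S) ℤ.* P} (+ 5) scaled))))

ratio-close : ∀ a d .(c : Coprime (suc a) (suc d)) e p e′ p′ γ → 1 ≤ p → 1 ≤ p′ → let N = + (5 * suc d) in
  N ℤ.* + e ℤ.≤ (γ ℤ.+ + 2) ℤ.* + p → (γ ℤ.- + 2) ℤ.* + p ℤ.≤ N ℤ.* + e →
  N ℤ.* + e′ ℤ.≤ (γ ℤ.+ + 2) ℤ.* + p′ → (γ ℤ.- + 2) ℤ.* + p′ ℤ.≤ N ℤ.* + e′ →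
  ℚ.∣ ratio e p ℚ.- ratio e′ p′ ∣ ℚ.< mkℚ (+ suc a) d c
ratio-close a d c e (suc p) e′ (suc p′) γ _ _ up lo up′ lo′ with ℚₚ.∣p∣≡p∨∣p∣≡-p
    (ratio e (suc p) ℚ.- ratio e′ (suc p′))
... | inj₁ eq = subst (ℚ._< mkℚ (+ suc a) d c) (≡.sym eq) (ratio-diff-< a d c e p e′ p′ γ up lo′)
... | inj₂ eq = subst (ℚ._< mkℚ (+ suc a) d c) (≡.sym (trans eq flip)) (ratio-diff-< a d c e′ p′ e p γ up′ lo)
  where
  x = ratio e (suc p)
  y = ratio e′ (suc p′)
  flip : ℚ.- (x ℚ.- y) ≡ y ℚ.- x
  flip = trans (ℚₚ.neg-distrib-+ x (ℚ.- y)) (trans (ℚₚ.+-comm (ℚ.- x) (ℚ.- (ℚ.- y)))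
      (cong (ℚ._+ (ℚ.- x)) (⁻¹-involutive y)))

-- From regular cores to a partition of all vertices.

∣∣≡card : ∀ {n} (S : Subset n) → ∣ S ∣ ≡ card (lookup S)
∣∣≡card []          = refl
∣∣≡card (true ∷ S)  = cong suc (∣∣≡card S)
∣∣≡card (false ∷ S) = ∣∣≡card S

⊆⇒⊑ : ∀ {n} {S T : Subset n} → S ⊆ T → lookup S ⊑ lookup T
⊆⇒⊑ {S = S} sub x p = []=⇒lookup (sub (lookup⇒[]= x S p))

lookup-part : ∀ {n q} (f : Fin n → Fin q) i x → lookup (part f i) x ≡ fibre f i x
lookup-part f i = lookup∘tabulate (fibre f i)

card-part : ∀ {n q} (f : Fin n → Fin q) i → ∣ part f i ∣ ≡ card (fibre f i)
card-part f i = trans (∣∣≡card (part f i)) (sum-cong (λ x → cong 𝟙 (lookup-part f i x)))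

record Partitioned {n} (G : Graph n) (M k K : ℕ) : Set where
  field
    q′       : ℕ
    k≤q      : k ≤ suc q′
    q≤K      : suc q′ ≤ K
    f        : Fin n → Fin (suc q′)
    balanced : Balanced (λ i → card (fibre f i))
    nonempty : ∀ i → 1 ≤ card (fibre f i)
    sparse   : ∀ i → M * eB G (fibre f i) (fibre f i) ≤ card (fibre f i) C 2
    bad′     : Fin (suc q′) → Fin (suc q′) → Bool
    few-bad  : M * countPairs bad′ ≤ suc q′ * suc q′
    near     : ∀ i j → bad′ i j ≡ false → Σ ℤ λ γ → ∀ X Y → X ⊑ fibre f i → Y ⊑ fibre f j →
               card (fibre f i) ≤ M * card X → card (fibre f j) ≤ M * card Y → DensityNear G (5 * M) γ X Y

distribute-leftover : ∀ {n} (G : Graph n) M k K B → 1 ≤ M → 1 ≤ k → 1 ≤ B →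
  2 * (4 * (16 * M * (5 * M)) * B) * K ≤ n →
  Regular G M (2 * M) (5 * M) (8 * M) k K (4 * (16 * M * (5 * M)) * B) B → Partitioned G M k K
distribute-leftover G M k K B M≥1 k≥1 B≥1 large record { q = zero ; k≤q = k≤q } with () ← ℕₚ.≤-trans k≥1 k≤q
distribute-leftover {n} G M k K B M≥1 k≥1 B≥1 large
  record { q = suc q′ ; s = s ; L = L ; h = h ; cores = st ; n≡ = n≡ ; leftover = leftover
         ; k≤q = k≤q ; q≤K = q≤K ; few-bad = few-bad } = record
  { q′ = q′ ; k≤q = k≤q ; q≤K = q≤K ; f = f ; balanced = bal
  ; nonempty = λ i → ℕₚ.≤-trans s≥1 (ℕₚ.≤-trans (ℕₚ.m≤m+n s (a i)) (ℕₚ.≤-reflexive (≡.sym (v≡ i))))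
  ; sparse = λ i → sparse-extends M N s (a i) (v i) (eB G (V i) (V i)) (eB G (core i) (core i)) N≥1 s≥2 (v≡ i)
      (a≤ i) (sparse i)
      (subst (λ c → eB G (V i) (V i) ℕ.+ c * c ≤ eB G (core i) (core i) ℕ.+ v i * v i) (size i)
          (eB-defect G (C⊑V i) (C⊑V i)))
  ; bad′ = bad G N (2 * M) st ; few-bad = few-bad
  -- Since `h` is constant on a pair of cores, `γ` is read off at arbitrary representatives.
  ; near = λ i j good → h (rep i) (rep j) , regular-extends G M N s h (h (rep i) (rep j)) (core i) (core j)
      (V i) (V j) M≥1 N≥1 s≥1
      (C⊑V i) (C⊑V j) (size i) (size j) (a≤ i) (a≤ j)
      (λ x y Cx Cy → const i j x (rep i) y (rep j) Cx (rep∈ i) Cy (rep∈ j))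
      (not-irregular (irregular? (residual G N h) (2 * M) s (core i) (core j)) good) }
  where
  open Cores st renaming (C to core)
  N = 5 * M
  D = 16 * M * N
  N≥1 : 1 ≤ N
  N≥1 = ℕₚ.≤-trans M≥1 (ℕₚ.m≤m+n M (4 * M))
  D≥1 : 1 ≤ D
  D≥1 = ℕₚ.*-mono-≤ (ℕₚ.*-mono-≤ {1} {16} (s≤s z≤n) M≥1) N≥1
  2B≤ : 2 * B ≤ 4 * D * B
  2B≤ = ℕₚ.*-monoˡ-≤ B (ℕₚ.*-mono-≤ {2} {4} (s≤s (s≤s z≤n)) D≥1)
  half : n ≤ 2 * (suc q′ * s)
  half = half-covered n (suc q′) s L (4 * D * B) B B≥1 2B≤ n≡ leftover
  K≥1 : 1 ≤ K
  K≥1 = ℕₚ.≤-trans (s≤s z≤n) q≤K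
  -- From `4 * K ≤ n ≤ 2 * K * s`; this is needed to compare `v * v` with `v C 2`.
  s≥2 : 2 ≤ s
  s≥2 = ℕₚ.*-cancelˡ-≤ (2 * K) {{>-nonZero (ℕₚ.*-mono-≤ {1} {2} (s≤s z≤n) K≥1)}} (begin
    2 * K * 2                  ≡⟨ comm K ⟩
    2 * 2 * K                  ≤⟨ ℕₚ.*-monoˡ-≤ K (ℕₚ.*-monoʳ-≤ 2 (ℕₚ.≤-trans (ℕₚ.*-monoʳ-≤ 2 B≥1) 2B≤)) ⟩
    2 * (4 * D * B) * K        ≤⟨ large ⟩
    n                          ≤⟨ half ⟩
    2 * (suc q′ * s)           ≤⟨ ℕₚ.*-monoʳ-≤ 2 (ℕₚ.*-monoˡ-≤ s q≤K) ⟩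
    2 * (K * s)                ≡⟨ ℕₚ.*-assoc 2 K s ⟨
    2 * K * s ∎)
    where
    open ℕₚ.≤-Reasoning
    comm : ∀ K → 2 * K * 2 ≡ 2 * 2 * K
    comm = ℕR.solve-∀
  s≥1 : 1 ≤ s
  s≥1 = ℕₚ.≤-trans (s≤s z≤n) s≥2
  4DL≤n : 4 * D * L ≤ n
  4DL≤n = ℕₚ.*-cancelˡ-≤ B {{>-nonZero B≥1}} (ℕₚ.≤-trans (ℕₚ.≤-reflexive (comm B D L)) leftover)
    where
    comm : ∀ B D L → B * (4 * D * L) ≡ 4 * D * B * L
    comm = ℕR.solve-∀
  4Dq≤n : 4 * D * suc q′ ≤ n
  4Dq≤n = ℕₚ.≤-trans (ℕₚ.*-mono-≤ 4D≤ q≤K) large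
    where
    4D≤ : 4 * D ≤ 2 * (4 * D * B)
    4D≤ = ℕₚ.≤-trans (ℕₚ.≤-reflexive (≡.sym (ℕₚ.*-identityʳ (4 * D)))) (ℕₚ.≤-trans (ℕₚ.*-monoʳ-≤ (4 * D) B≥1)
        (ℕₚ.m≤m+n (4 * D * B) _))
  extended = extend-cores core disj size
  f = proj₁ extended
  C⊑V = proj₁ (proj₂ extended)
  bal = proj₂ (proj₂ extended)
  V : Fin (suc q′) → VSet n
  V = fibre f
  v a : Fin (suc q′) → ℕ
  v i = card (V i)
  a i = card (V i ∖ core i)
  v≡ : ∀ i → v i ≡ s ℕ.+ a i
  v≡ i = trans (card-superset (core i) (V i) (C⊑V i)) (cong (ℕ._+ a i) (size i))
  a≤ : ∀ i → 16 * M * N * a i ≤ s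
  a≤ i = excess≤ M N s (a i) (v i) (v≡ i)
    (excess-small n q′ s L D (v i) 4DL≤n 4Dq≤n half n≡ (balanced-upper-* n v (Σ-fibres f) bal i))
  rep : Fin (suc q′) → Fin n
  rep i = proj₁ (card-element (core i) (ℕₚ.≤-trans s≥1 (ℕₚ.≤-reflexive (≡.sym (size i)))))
  rep∈ : ∀ i → core i (rep i) ≡ true
  rep∈ i = proj₂ (card-element (core i) (ℕₚ.≤-trans s≥1 (ℕₚ.≤-reflexive (≡.sym (size i)))))
  not-irregular : ∀ {A : Set} (dec : Dec A) → isYes dec ≡ false → ¬ A
  not-irregular (no ¬a) _ = ¬a

-- There is no circularity: `T` depends on `M` only, it determines `B` and `D`, these determine `K`,
-- and only then is the clique bound `P` chosen.
partition-theorem : ∀ M r k → 1 ≤ M → 1 ≤ k → Σ ℕ λ P → Σ ℕ λ K → Σ ℕ λ n₀ →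
  ∀ n → n₀ ≤ n → (G : Graph n) → suc P * kᵣ G r ≤ n ^ r → Partitioned G M k K
partition-theorem M r k M≥1 k≥1 = r ! * (2 * K) ^ r , K , 2 * D * K , λ n large G few →
  let n≥1 = ℕₚ.≤-trans (ℕₚ.*-mono-≤ (ℕₚ.*-mono-≤ {1} {2} (s≤s z≤n) D≥1) K≥1) large
  in distribute-leftover G M k K B M≥1 k≥1 B≥1 large
       (Iteration.regular G M m N μ r k K D B n≥1 μ≥1 k≥1 D≥1 B≥1 2B≤D large few ℕₚ.≤-refl ℕₚ.≤-refl)
  where
  m N μ T B D q₀ K : ℕ
  m = 2 * M
  N = 5 * M
  μ = 8 * M
  -- 4 M m² times the energy is at most (4 M m² N²) n² initially and drops by n² with every refinement.
  T = suc (4 * M * (m * m) * (N * N))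
  -- The initial cut and each of at most `T` refinements lose up to `2n / D` vertices, in total
  -- `B / D` of all; the next line makes this share `1 / (64 M N)`.
  B = 2 * suc T
  D = 4 * (16 * M * N) * B
  q₀ = 1 * (k * R μ r * D)
  K = reach D μ r T q₀
  μ≥1 : 1 ≤ μ
  μ≥1 = ℕₚ.*-mono-≤ {1} {8} (s≤s z≤n) M≥1
  B≥1 : 1 ≤ B
  B≥1 = s≤s z≤n
  16MN≥1 : 1 ≤ 16 * M * N
  16MN≥1 = ℕₚ.*-mono-≤ (ℕₚ.*-mono-≤ {1} {16} (s≤s z≤n) M≥1) (ℕₚ.*-mono-≤ {1} {5} (s≤s z≤n) M≥1)
  2B≤D : 2 * B ≤ D
  2B≤D = ℕₚ.*-monoˡ-≤ B (ℕₚ.*-mono-≤ {2} {4} (s≤s (s≤s z≤n)) 16MN≥1)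
  D≥1 : 1 ≤ D
  D≥1 = ℕₚ.≤-trans (ℕₚ.*-mono-≤ {1} {2} (s≤s z≤n) B≥1) 2B≤D
  K≥1 : 1 ≤ K
  K≥1 = ℕₚ.≤-trans (ℕₚ.≤-trans (ℕₚ.*-mono-≤ (ℕₚ.*-mono-≤ k≥1 (R≥1 μ r)) D≥1)
      (ℕₚ.≤-reflexive (≡.sym (ℕₚ.*-identityˡ (k * R μ r * D)))))
    (q≤reach D μ r T q₀ D≥1)

-- Translation into rational densities.

1≤from : ∀ M a x → 1 ≤ a → a ≤ M * x → 1 ≤ x
1≤from M a zero    a≥1 le with () ← ℕₚ.≤-trans a≥1 (ℕₚ.≤-trans le (ℕₚ.≤-reflexive (ℕₚ.*-zeroʳ M)))
1≤from M a (suc x) a≥1 le = s≤s z≤n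

-- The parts themselves satisfy the size conditions, so their density and that of `X` and `Y` are
-- near the same `γ`.
near⇒uniform : ∀ {n q} (G : Graph n) a d .(c : Coprime (suc a) (suc d)) (f : Fin n → Fin q) i j γ →
  1 ≤ card (fibre f i) → 1 ≤ card (fibre f j) →
  (∀ X Y → X ⊑ fibre f i → Y ⊑ fibre f j → card (fibre f i) ≤ suc d * card X → card (fibre f j) ≤ suc d * card Y →
    DensityNear G (5 * suc d) γ X Y) →
  Uniform G (mkℚ (+ suc a) d c) (part f i) (part f j)
near⇒uniform G a d c f i j γ posA posB near X Y X⊆A Y⊆B bigX bigY =
  ratio-close a d c (eBetween G X Y) (∣ X ∣ * ∣ Y ∣) (eBetween G (part f i) (part f j))
      (∣ part f i ∣ * ∣ part f j ∣) γ
    (ℕₚ.*-mono-≤ X≥1 Y≥1) (ℕₚ.*-mono-≤ A≥1 B≥1) (proj₁ nearXY) (proj₂ nearXY) (proj₁ nearAB) (proj₂ nearAB)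
  where
  A≥1 : 1 ≤ ∣ part f i ∣
  A≥1 = ℕₚ.≤-trans posA (ℕₚ.≤-reflexive (≡.sym (card-part f i)))
  B≥1 : 1 ≤ ∣ part f j ∣
  B≥1 = ℕₚ.≤-trans posB (ℕₚ.≤-reflexive (≡.sym (card-part f j)))
  large : ∀ A X → mkℚ (+ suc a) d c ℚ.* ⟦ A ⟧ ℚ.≤ ⟦ X ⟧ → A ≤ suc d * X
  large A X le = ℕₚ.≤-trans (ℕₚ.m≤m+n A (a * A)) (ℕₚ.≤-trans (*⟦⟧≤⟦⟧⁻¹ (suc a) d c X A le)
      (ℕₚ.≤-reflexive (ℕₚ.*-comm X (suc d))))
  X≥1 : 1 ≤ ∣ X ∣
  X≥1 = 1≤from (suc d) ∣ part f i ∣ ∣ X ∣ A≥1 (large ∣ part f i ∣ ∣ X ∣ bigX)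
  Y≥1 : 1 ≤ ∣ Y ∣
  Y≥1 = 1≤from (suc d) ∣ part f j ∣ ∣ Y ∣ B≥1 (large ∣ part f j ∣ ∣ Y ∣ bigY)
  part⊑ : ∀ i → lookup (part f i) ⊑ fibre f i
  part⊑ i x p = trans (≡.sym (lookup-part f i x)) p
  Near : Subset _ → Subset _ → ℕ → Set
  Near S T p = (+ (5 * suc d) ℤ.* + eBetween G S T ℤ.≤ (γ ℤ.+ + 2) ℤ.* + p) ×
    ((γ ℤ.- + 2) ℤ.* + p ℤ.≤ + (5 * suc d) ℤ.* + eBetween G S T)
  both : ∀ S T → S ⊆ part f i → T ⊆ part f j → ∣ part f i ∣ ≤ suc d * ∣ S ∣ → ∣ part f j ∣ ≤ suc d * ∣ T ∣ →
      Near S T (∣ S ∣ * ∣ T ∣)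
  both S T S⊆ T⊆ bS bT = subst (Near S T) (≡.sym (cong₂ _*_ (∣∣≡card S) (∣∣≡card T)))
    (near (lookup S) (lookup T) (λ x p → part⊑ i x (⊆⇒⊑ S⊆ x p)) (λ x p → part⊑ j x (⊆⇒⊑ T⊆ x p))
      (subst₂′ (card-part f i) (∣∣≡card S) bS) (subst₂′ (card-part f j) (∣∣≡card T) bT))
    where
    subst₂′ : ∀ {u u′ w w′} → u ≡ u′ → w ≡ w′ → u ≤ suc d * w → u′ ≤ suc d * w′
    subst₂′ refl refl le = le
  nearXY = both X Y X⊆A Y⊆B (large ∣ part f i ∣ ∣ X ∣ bigX) (large ∣ part f j ∣ ∣ Y ∣ bigY)
  nearAB = both (part f i) (part f j) (λ p → p) (λ p → p) (ℕₚ.m≤m+n ∣ part f i ∣ _) (ℕₚ.m≤m+n ∣ part f j ∣ _)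

EquitablePartition : ∀ {n} → Graph n → ℚ → ℕ → ℕ → Set
EquitablePartition {n} G ε k K =
    Σ ℕ λ q → k ≤ q × q ≤ K × Σ (Fin n → Fin q) λ f →
    (∀ (i : Fin q) →
    ⌊ n / q ⌋ ≤ ∣ part f i ∣ × ∣ part f i ∣ ≤ ⌈ n / q ⌉ ×
    ⟦ eIn G (part f i) ⟧ ℚ.≤ ε ℚ.* ⟦ ∣ part f i ∣ C 2 ⟧) ×
    Σ (Fin q → Fin q → Bool) λ bad →
    ⟦ countPairs bad ⟧ ℚ.≤ ε ℚ.* ⟦ q * q ⟧ ×
    (∀ (i j : Fin q) → toℕ i < toℕ j → bad i j ≡ false →
    Uniform G ε (part f i) (part f j))

partitioned⇒equitable : ∀ {n} (G : Graph n) a d .(c : Coprime (suc a) (suc d)) k K →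
  Partitioned G (suc d) k K → EquitablePartition G (mkℚ (+ suc a) d c) k K
partitioned⇒equitable {n} G a d c k K pt = suc q′ , k≤q , q≤K , f , (λ i → lower i , upper i , sparse′ i) ,
    bad′ , few′ ,
    λ i j _ good → near⇒uniform G a d c f i j (proj₁ (near i j good)) (nonempty i) (nonempty j)
        (proj₂ (near i j good))
  where
  open Partitioned pt
  scale : ∀ x y → suc d * x ≤ y → x * suc d ≤ suc a * y
  scale x y le = ℕₚ.≤-trans (ℕₚ.≤-reflexive (ℕₚ.*-comm x (suc d))) (ℕₚ.≤-trans le (ℕₚ.m≤m+n y (a * y)))
  part⊑ : ∀ i → lookup (part f i) ⊑ fibre f i
  part⊑ i x p = trans (≡.sym (lookup-part f i x)) p
  lower : ∀ i → ⌊ n / suc q′ ⌋ ≤ ∣ part f i ∣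
  lower i = ℕₚ.≤-trans (balanced-lower n (λ j → card (fibre f j)) (Σ-fibres f) balanced i)
      (ℕₚ.≤-reflexive (≡.sym (card-part f i)))
  upper : ∀ i → ∣ part f i ∣ ≤ ⌈ n / suc q′ ⌉
  upper i = ℕₚ.≤-trans (ℕₚ.≤-reflexive (card-part f i)) (balanced-upper n (λ j → card (fibre f j))
      (Σ-fibres f) balanced i)
  sparse′ : ∀ i → ⟦ eIn G (part f i) ⟧ ℚ.≤ mkℚ (+ suc a) d c ℚ.* ⟦ ∣ part f i ∣ C 2 ⟧
  sparse′ i = ⟦⟧≤*⟦⟧ (suc a) d c (eIn G (part f i)) (∣ part f i ∣ C 2) (scale (eIn G (part f i)) (∣ part f i ∣ C 2)
    (ℕₚ.≤-trans (ℕₚ.*-monoʳ-≤ (suc d) (ℕₚ.≤-trans (eIn≤eB G (part f i)) (eB-mono G (part⊑ i) (part⊑ i))))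
      (ℕₚ.≤-trans (sparse i) (ℕₚ.≤-reflexive (cong (_C 2) (≡.sym (card-part f i)))))))
  few′ : ⟦ countPairs bad′ ⟧ ℚ.≤ mkℚ (+ suc a) d c ℚ.* ⟦ suc q′ * suc q′ ⟧
  few′ = ⟦⟧≤*⟦⟧ (suc a) d c (countPairs bad′) (suc q′ * suc q′) (scale (countPairs bad′) (suc q′ * suc q′) few-bad)

theorem13 : (ε : ℚ) → 0ℚ ℚ.< ε → (r k : ℕ) → 2 ≤ r → 2 ≤ k →
    Σ ℚ λ ρ → 0ℚ ℚ.< ρ × Σ ℕ λ K → Σ ℕ λ n₀ →
    ∀ (n : ℕ) → n₀ ≤ n → (G : Graph n) →
    ⟦ kᵣ G r ⟧ ℚ.≤ ρ ℚ.* ⟦ n ^ r ⟧ →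
    Σ ℕ λ q → k ≤ q × q ≤ K × Σ (Fin n → Fin q) λ f →
    (∀ (i : Fin q) →
    ⌊ n / q ⌋ ≤ ∣ part f i ∣ × ∣ part f i ∣ ≤ ⌈ n / q ⌉ ×
    ⟦ eIn G (part f i) ⟧ ℚ.≤ ε ℚ.* ⟦ ∣ part f i ∣ C 2 ⟧) ×
    Σ (Fin q → Fin q → Bool) λ bad →
    ⟦ countPairs bad ⟧ ℚ.≤ ε ℚ.* ⟦ q * q ⟧ ×
    (∀ (i j : Fin q) → toℕ i < toℕ j → bad i j ≡ false →
    Uniform G ε (part f i) (part f j))
theorem13 (mkℚ (+ zero) d c) (ℚ.*<* (+<+ ())) r k 2≤r 2≤k
theorem13 (mkℚ -[1+ a ] d c) (ℚ.*<* ()) r k 2≤r 2≤k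
theorem13 (mkℚ (+ suc a) d c) ε>0 r k 2≤r 2≤k =
  let P , K , n₀ , partition = partition-theorem (suc d) r k (s≤s z≤n) (ℕₚ.≤-trans (s≤s z≤n) 2≤k)
  in mkℚ (+ 1) P (1-coprimeTo (suc P)) , ℚ.*<* (+<+ (s≤s z≤n)) , K , n₀ , λ n n₀≤n G few →
     partitioned⇒equitable G a d c k K (partition n n₀≤n G
      (ℕₚ.≤-trans (ℕₚ.≤-reflexive (ℕₚ.*-comm (suc P) (kᵣ G r)))
        (ℕₚ.≤-trans (⟦⟧≤*⟦⟧⁻¹ 1 P (1-coprimeTo (suc P)) (kᵣ G r) (n ^ r) few)
            (ℕₚ.≤-reflexive (ℕₚ.*-identityˡ (n ^ r))))))
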